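{- The unweighted problem max-min-BCP (with $k$ part of the input), parameterized by the size of a vertex cover of the input graph, is fixed-parameter tractable. That is, there are a computable function $f$ and an algorithm that, given a connected graph $G$, a positive integer $k\le |V(G)|$ and a vertex cover $X$ of $G$, finds a connected $k$-partition of $G$ maximizing the size of a smallest class, in time $f(|X|)\cdot |G|^{O(1)}$.
   Context: Graphs are finite, simple and undirected; $|G|$ denotes the size of $G$. A connected $k$-partition of a connected graph $G$ is a partition of $V(G)$ into $k$ nonempty classes each inducing a connected subgraph of $G$. Unweighted max-min-BCP: given a connected graph $G$ and a positive integer $k$, find a connected $k$-partition $\{V_i\}_{i\in[k]}$ of $G$ maximizing $\min_{i}|V_i|$. A vertex cover of $G$ is a set $X\subseteq V(G)$ meeting every edge. -}

module Defs where

open import Data.Bool using (Bool; true; false; T)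
open import Data.Fin using (Fin; toℕ) renaming (_<?_ to _<ᶠ?_; _≟_ to _≟ᶠ_)
open import Data.Fin.Subset using (Subset; _∈_; ∣_∣; ⊤; Nonempty)
open import Data.List using (List; []; _∷_; length; filter; cartesianProduct; allFin)
open import Data.Nat using (ℕ; zero; suc; _+_; _≤_; _⊓_; NonZero)
open import Data.Product using (_×_; _,_; ∃-syntax; proj₁; proj₂)
open import Data.Sum using (_⊎_)
open import Data.Vec using (Vec; []; _∷_; lookup; tabulate; foldr₁; toList)
open import Relation.Binary.Construct.Closure.ReflexiveTransitive using (Star)
open import Relation.Nullary using (¬_)
open import Relation.Nullary.Decidable using (does; _×-dec_; T?)

------------------------------------------------------------------------
-- Graphs

record Graph : Set where
  field
    order  : ℕ
    adj    : Fin order → Fin order → Bool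
    adj-sym    : ∀ {u v} → T (adj u v) → T (adj v u)
    adj-irrefl : ∀ {v} → ¬ T (adj v v)

  Vertex : Set
  Vertex = Fin order

  Adj : Vertex → Vertex → Set
  Adj u v = T (adj u v)

  edges : List (Vertex × Vertex)
  edges = filter (λ e → (proj₁ e <ᶠ? proj₂ e) ×-dec T? (adj (proj₁ e) (proj₂ e)))
                 (cartesianProduct (allFin order) (allFin order))

  -- The size |G|: vertices plus edges.
  size : ℕ
  size = order + length edges

  -- S induces a connected subgraph: any two of its vertices are joined by a
  -- walk all of whose vertices lie in S.  Nonemptiness of S is not included.
  InducesConnected : Subset order → Set
  InducesConnected S = ∀ {u v} → u ∈ S → v ∈ S →
    Star (λ x y → Adj x y × x ∈ S × y ∈ S) u v

  Connected : Set
  Connected = InducesConnected ⊤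

  VertexCover : Subset order → Set
  VertexCover X = ∀ {u v} → Adj u v → u ∈ X ⊎ v ∈ X

open Graph public using (order; size; Connected; VertexCover)

------------------------------------------------------------------------
-- Connected k-partitions

-- A family of classes V_i (i ∈ [k]) partitioning V(G) is given by the map
-- sending each vertex to the index of its class.
record ConnectedPartition (G : Graph) (k : ℕ) : Set where
  field
    index : Fin (order G) → Fin k

  class : Fin k → Subset (order G)
  class i = tabulate (λ v → does (index v ≟ᶠ i))

  field
    nonempty  : ∀ i → Nonempty (class i)
    connected : ∀ i → Graph.InducesConnected G (class i)

open ConnectedPartition public using (index; class)

minimum : ∀ {k} .{{_ : NonZero k}} → (Fin k → ℕ) → ℕ
minimum {suc _} f = foldr₁ _⊓_ (tabulate f)

minClass : ∀ {G k} .{{_ : NonZero k}} → ConnectedPartition G k → ℕ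
minClass P = minimum (λ i → ∣ class P i ∣)

IsMaxMin : ∀ {G k} .{{_ : NonZero k}} → ConnectedPartition G k → Set
IsMaxMin {G} {k} P = (Q : ConnectedPartition G k) → minClass Q ≤ minClass P

------------------------------------------------------------------------
-- The model of computation: pure call-by-value Lisp on binary trees.
--
-- `Tm n` is the type of terms with n free variables (de Bruijn indices).
-- The cost of an evaluation is the number of rules used in its big-step
-- derivation.  An environment machine with shared (pointer) representations
-- of trees and closures executes each rule in a number of steps depending
-- only on the program, so cost is polynomially equivalent to time on a
-- Turing machine or a logarithmic-cost RAM.

infixr 5 _∙_

data Tm (n : ℕ) : Set where
  var  : Fin n → Tm n
  nil  : Tm n
  _∙_  : Tm n → Tm n → Tm n
  -- In the third argument, variable 0 is the left and 1 the right subtree.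
  case : Tm n → Tm n → Tm (2 + n) → Tm n
  -- In the body, variable 0 is the argument and 1 the function itself.
  fun  : Tm (2 + n) → Tm n
  app  : Tm n → Tm n → Tm n

data Value : Set where
  nil     : Value
  _∙_     : Value → Value → Value
  closure : ∀ {n} → Vec Value n → Tm (2 + n) → Value

infix 4 _⊢_⇓_[_]

-- ρ ⊢ e ⇓ v [ t ]: in environment ρ, e evaluates to v with cost t.
data _⊢_⇓_[_] {n} (ρ : Vec Value n) : Tm n → Value → ℕ → Set where
  var : ∀ x → ρ ⊢ var x ⇓ lookup ρ x [ 1 ]
  nil : ρ ⊢ nil ⇓ nil [ 1 ]
  _∙_ : ∀ {a b v w s t} →
        ρ ⊢ a ⇓ v [ s ] → ρ ⊢ b ⇓ w [ t ] →
        ρ ⊢ a ∙ b ⇓ v ∙ w [ 1 + (s + t) ]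
  case-nil : ∀ {a b c v s t} →
        ρ ⊢ a ⇓ nil [ s ] → ρ ⊢ b ⇓ v [ t ] →
        ρ ⊢ case a b c ⇓ v [ 1 + (s + t) ]
  case-∙ : ∀ {a b c x y v s t} →
        ρ ⊢ a ⇓ x ∙ y [ s ] → x ∷ y ∷ ρ ⊢ c ⇓ v [ t ] →
        ρ ⊢ case a b c ⇓ v [ 1 + (s + t) ]
  fun : ∀ e → ρ ⊢ fun e ⇓ closure ρ e [ 1 ]
  app : ∀ {a b m} {σ : Vec Value m} {e x v r s t} →
        ρ ⊢ a ⇓ closure σ e [ r ] → ρ ⊢ b ⇓ x [ s ] →
        x ∷ closure σ e ∷ σ ⊢ e ⇓ v [ t ] →
        ρ ⊢ app a b ⇓ v [ 1 + (r + s + t) ]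

-- A program has one free variable, holding its input.
Program : Set
Program = Tm 1

_on_yields_within_ : Program → Value → Value → ℕ → Set
p on x yields y within b = ∃[ t ] t ≤ b × (x ∷ [] ⊢ p ⇓ y [ t ])

------------------------------------------------------------------------
-- Encodings

encodeList : ∀ {A : Set} → (A → Value) → List A → Value
encodeList enc []       = nil
encodeList enc (x ∷ xs) = enc x ∙ encodeList enc xs

encodeVec : ∀ {A : Set} {n} → (A → Value) → Vec A n → Value
encodeVec enc xs = encodeList enc (toList xs)

encodeBool : Bool → Value
encodeBool false = nil
encodeBool true  = nil ∙ nil

-- Unary; this is harmless because every number in an instance or a solution
-- is at most |V(G)|.
encodeℕ : ℕ → Value
encodeℕ zero    = nil
encodeℕ (suc n) = nil ∙ encodeℕ n

encodeSubset : ∀ {n} → Subset n → Value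
encodeSubset = encodeVec encodeBool

-- The adjacency matrix, by rows.
encodeGraph : Graph → Value
encodeGraph G = encodeVec encodeSubset
  (tabulate (λ u → tabulate (λ v → Graph.adj G u v)))

encodeInstance : (G : Graph) → ℕ → Subset (order G) → Value
encodeInstance G k X = encodeGraph G ∙ encodeℕ k ∙ encodeSubset X

-- The list of class indices of the vertices 0, 1, 2, …
encodePartition : ∀ {G k} → ConnectedPartition G k → Value
encodePartition P = encodeVec (λ i → encodeℕ (toℕ i)) (tabulate (index P))

Computable : (ℕ → ℕ) → Set
Computable f = ∃[ p ] ∀ n → ∃[ t ] (encodeℕ n ∷ [] ⊢ p ⇓ encodeℕ (f n) [ t ])

{-# OPTIONS --safe #-}
-- A class that misses X is a single vertex.  So if k > |X|, then every connected k-partition is optimal.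
-- Otherwise only partitions all of whose classes meet X matter.  Such a class is held together by its
-- vertices in X and a few helpers outside X, and exchanging two vertices with the same neighbours is an
-- automorphism of G, so a helper need only be chosen up to its neighbourhood.  Hence the following finds,
-- up to automorphism, the core of any such partition: starting from the vertices of X as singletons, merge
-- two classes |X| - k times, along an edge or through a helper, trying all possibilities.
--
-- The vertices outside the core may then be moved to any adjacent class.  To raise all classes to a target
-- size λ, move one vertex along each step of a chain of classes from a class above λ to a class below λ.
-- If no chain exists, the classes R from which such a chain could come have fewer than λ|R| vertices in
-- all, and no vertex outside can be moved into R; so no partition with this core reaches λ.
module Submission where

open import Defs
open import Data.Fin.Subset using (Subset; ∣_∣)
open import Data.Nat using (ℕ; _*_; _^_; _≤_; NonZero)
open import Data.Product using (_×_; Σ-syntax)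

open import Data.Bool using (Bool; true; false; if_then_else_; _∧_; _∨_; not)
open import Data.Bool.Properties using (T-≡)
open import Data.Empty using (⊥)
open import Data.Fin as Fin using (Fin; zero; suc; toℕ; fromℕ<)
open import Data.Fin.Patterns
open import Data.Fin.Permutation using (Permutation; permutation)
open import Data.Fin.Properties as Finₚ using (toℕ<n; toℕ-fromℕ<; pigeonhole)
open import Data.Fin.Subset using () renaming (_∈_ to _∈ˢ_)
open import Data.Fin.Subset.Properties using (∈⊤)
open import Data.List as List using (List; []; _∷_; _++_; length; foldr; replicate; allFin)
open import Data.List.Membership.Propositional using (_∈_; _∉_; find; lose)
open import Data.List.Membership.Propositional.Properties using (∈-allFin; ∈-lookup; ∈-++⁺ʳ; ∈-concatMap⁺; ∈-concatMap⁻)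
open import Data.List.Properties using (length-tabulate; length-replicate; length-drop; length-++)
open import Data.List.Relation.Unary.All as All using (All; []; _∷_)
open import Data.List.Relation.Unary.AllPairs using (AllPairs; []; _∷_)
open import Data.List.Relation.Unary.AllPairs.Properties using (tabulate⁺-<)
open import Data.List.Relation.Unary.Any as Any using (here; there)
open import Data.List.Relation.Unary.Any.Properties using (lookup-index)
open import Data.List.Relation.Unary.Unique.Propositional using (Unique)
open import Data.List.Relation.Unary.Unique.Propositional.Properties using (allFin⁺; drop⁺; ++⁺)
open import Data.Maybe using (Maybe; just; nothing; maybe′)
open import Data.Nat using (zero; suc; pred; _+_; _∸_; _⊓_; _<_; z≤n; s≤s; _≤?_; >-nonZero; >-nonZero⁻¹)
open import Data.Nat.Properties
open import Data.Nat.Tactic.RingSolver using (solve-∀)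
open import Data.Product using (∃-syntax; _,_; -,_; proj₁; proj₂; map₂)
open import Data.Sum using (_⊎_; inj₁; inj₂)
open import Data.Unit using (⊤; tt)
open import Data.Vec as Vec using (Vec; []; _∷_; lookup)
open import Data.Vec.Properties using ([]=⇒lookup; lookup⇒[]=; lookup∘tabulate)
open import Function using (_∘_; Equivalence)
open import Relation.Binary.Construct.Closure.ReflexiveTransitive as Star using (Star; ε; _◅_; _◅◅_)
open import Relation.Binary.PropositionalEquality
open import Relation.Nullary using (¬_; does; yes; no; contradiction)
open import Algebra.Properties.CommutativeMonoid.Sum +-0-commutativeMonoid using (sum; sum-cong-≗; ∑-comm; sum-permute)

-- Computable growth functions

-- The running time belongs to the theorem, so the algorithm is given as plain functions and again
-- as a term of the model, built from combinators. Each combinator carries a proof that its term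
-- computes the function, and a cost bound g(s) N^c with s = |X|, N = |G| and g a formal expression.
-- So the f of the theorem is read off from the program and is computable by construction. The
-- danger lies in recursion: a branching factor that depends on N, raised to a depth that depends on
-- s, is not fixed-parameter time. Hence both recursions, for the core and for a chain, have depth
-- at most s and branch only over vertices of X, over classes, and over groups of vertices alike
-- towards X, at most 2 · 2^s of them for a class. Loops over V contain no recursive call. Within
-- these limits plain backtracking is affordable; no flow and no shortest chain has to be computed.
-- Completeness of the search is an induction in which the partition aimed at does not stay fixed:
-- when the search takes another helper than this partition does, the partition is replaced by its
-- image under the exchange.

infixl 6 _⊞_
infixl 7 _⊠_
infixr 8 _⊡_

-- Just the operations that cost bounds produce: sequencing adds, loops multiply, and recursion
-- raises to a power given by its depth.
data Growth : Set where
  con : ℕ → Growth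
  par : Growth
  _⊞_ _⊠_ _⊡_ : Growth → Growth → Growth

⟦_⟧ : Growth → ℕ → ℕ
⟦ con a ⟧ s = a
⟦ par ⟧   s = s
⟦ a ⊞ b ⟧ s = ⟦ a ⟧ s + ⟦ b ⟧ s
⟦ a ⊠ b ⟧ s = ⟦ a ⟧ s * ⟦ b ⟧ s
⟦ a ⊡ b ⟧ s = ⟦ a ⟧ s ^ ⟦ b ⟧ s

record Binary (f : ℕ → ℕ → ℕ) : Set where
  field
    code : ∀ {m} → Fin m → Fin m → Tm m
    runs : ∀ {m} (ρ : Vec Value m) {x y a b} →
           lookup ρ x ≡ encodeℕ a → lookup ρ y ≡ encodeℕ b →
           ∃[ t ] (ρ ⊢ code x y ⇓ encodeℕ (f a b) [ t ])

var-at : ∀ {m} {ρ : Vec Value m} x {v} → lookup ρ x ≡ v → ρ ⊢ var x ⇓ v [ 1 ]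
var-at {ρ = ρ} x eq = subst (λ v → ρ ⊢ var x ⇓ v [ 1 ]) eq (var x)

-- Sum, product and power each iterate the operation before them with the first argument held fixed,
-- so recursion on a unary second argument yields all three.
primrec : ∀ {f g : ℕ → ℕ → ℕ} (z : ∀ {m} → Fin m → Tm m) →
          (∀ {m} (ρ : Vec Value m) {x a} → lookup ρ x ≡ encodeℕ a →
             ∃[ t ] (ρ ⊢ z x ⇓ encodeℕ (g a 0) [ t ])) →
          Binary f → (∀ a b → g a (suc b) ≡ f a (g a b)) → Binary g
primrec {f} {g} z zok op eq = record { code = code ; runs = runs }
  where
  open Binary op using () renaming (code to opcode; runs to opruns)
  body : ∀ {m} → Fin m → Tm (2 + m)
  body x = case (var zero) (z (suc (suc x)))
             -- The model has no local definitions: pairing a value with `nil` and taking the pair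
             -- apart binds the value to a variable.
             (case (app (var (suc (suc (suc zero)))) (var (suc zero)) ∙ nil) nil
               (opcode (suc (suc (suc (suc (suc (suc x)))))) zero))
  code : ∀ {m} → Fin m → Fin m → Tm m
  code x y = app (fun (body x)) (var y)
  runs : ∀ {m} (ρ : Vec Value m) {x y a b} →
         lookup ρ x ≡ encodeℕ a → lookup ρ y ≡ encodeℕ b →
         ∃[ t ] (ρ ⊢ code x y ⇓ encodeℕ (g a b) [ t ])
  runs ρ {x} {y} {a} {b} ex ey = -, app (fun (body x)) (var-at y ey) (proj₂ (loop b))
    where
    loop : ∀ b → ∃[ t ] (encodeℕ b ∷ closure ρ (body x) ∷ ρ ⊢ body x ⇓ encodeℕ (g a b) [ t ])
    loop zero    = -, case-nil (var zero) (proj₂ (zok (_ ∷ _ ∷ ρ) ex))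
    loop (suc b) rewrite eq a b =
      -, case-∙ (var zero)
           (case-∙ (app (var (suc (suc (suc zero)))) (var (suc zero)) (proj₂ (loop b)) ∙ nil)
                   (proj₂ (opruns (_ ∷ _ ∷ _ ∷ _ ∷ _ ∷ _ ∷ ρ) ex refl)))

successor : Binary (λ _ → suc)
successor = record { code = λ _ y → nil ∙ var y ; runs = λ ρ {y = y} _ ey → -, nil ∙ var-at y ey }

plus : Binary _+_
plus = primrec var (λ ρ {x} {a} ex → -, var-at x (trans ex (cong encodeℕ (sym (+-identityʳ a)))))
               successor +-suc

times : Binary _*_
times = primrec (λ _ → nil)
          (λ ρ {_} {a} _ → -, subst (λ r → ρ ⊢ nil ⇓ encodeℕ r [ 1 ]) (sym (*-zeroʳ a)) nil)
          plus *-suc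

power : Binary _^_
power = primrec (λ _ → nil ∙ nil) (λ ρ _ → -, nil ∙ nil) times (λ _ _ → refl)

numeral : ∀ {m} → ℕ → Tm m
numeral zero    = nil
numeral (suc a) = nil ∙ numeral a

numeral-runs : ∀ {m} {ρ : Vec Value m} a → ∃[ t ] (ρ ⊢ numeral a ⇓ encodeℕ a [ t ])
numeral-runs zero    = -, nil
numeral-runs (suc a) = -, nil ∙ proj₂ (numeral-runs a)

growthCode : Growth → ∀ {m} → Fin m → Tm m
binaryCode : ∀ {f} → Binary f → Growth → Growth → ∀ {m} → Fin m → Tm m
growthCode (con a) x = numeral a
growthCode par     x = var x
growthCode (a ⊞ b) x = binaryCode plus a b x
growthCode (a ⊠ b) x = binaryCode times a b x
growthCode (a ⊡ b) x = binaryCode power a b x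
binaryCode op a b x =
  case (growthCode a x ∙ growthCode b x) nil (Binary.code op zero (suc zero))

growth-runs : ∀ a {m} (ρ : Vec Value m) {x n} → lookup ρ x ≡ encodeℕ n →
              ∃[ t ] (ρ ⊢ growthCode a x ⇓ encodeℕ (⟦ a ⟧ n) [ t ])
binary-runs : ∀ {f} (op : Binary f) a b {m} (ρ : Vec Value m) {x n} → lookup ρ x ≡ encodeℕ n →
              ∃[ t ] (ρ ⊢ binaryCode op a b x ⇓ encodeℕ (f (⟦ a ⟧ n) (⟦ b ⟧ n)) [ t ])
growth-runs (con a) ρ ex     = numeral-runs a
growth-runs par     ρ {x} ex = -, var-at x ex
growth-runs (a ⊞ b) ρ ex     = binary-runs plus a b ρ ex
growth-runs (a ⊠ b) ρ ex     = binary-runs times a b ρ ex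
growth-runs (a ⊡ b) ρ ex     = binary-runs power a b ρ ex
binary-runs op a b ρ ex =
  -, case-∙ (proj₂ (growth-runs a ρ ex) ∙ proj₂ (growth-runs b ρ ex))
            (proj₂ (Binary.runs op (_ ∷ _ ∷ ρ) refl refl))

growth-computable : ∀ a → Computable ⟦ a ⟧
growth-computable a = growthCode a zero , λ n → growth-runs a (encodeℕ n ∷ []) refl

-- Programs with cost bounds

-- The value of `bd g c h` at parameter s and size N, when a call of the function being defined by
-- recursion costs at most B, is g(s) N^c + h(s) B.
record Bd : Set where
  constructor bd
  field
    coef  : Growth
    deg   : ℕ
    calls : Growth

infixr 6 _⊕_
-- The sum of the degrees gives a common power of N that dominates both, as N is at least 1.
_⊕_ : Bd → Bd → Bd
bd g c h ⊕ bd g′ c′ h′ = bd (g ⊞ g′) (c + c′) (h ⊞ h′)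

steps : ℕ → Bd
steps a = bd (con a) 0 (con 0)

Len : Set
Len = Growth × ℕ

infixl 7 _⊗_
_⊗_ : Len → Bd → Bd
(l , d) ⊗ bd g c h = bd (l ⊠ g) (d + c) (l ⊠ h)

-- The cost T(d) at depth d satisfies T(0) ≤ g N^c and T(d + 1) ≤ g N^c + h T(d), and (1 + g + h)^(1
-- + d) N^c dominates the solution. The degree stays c because h depends on the parameter alone.
recBd : Growth → Bd → Bd
recBd d (bd g c h) = bd ((con 1 ⊞ g ⊞ h) ⊡ (con 1 ⊞ d)) c (con 0)

-- The list is fuel, of which only the length counts: a list no longer than the parameter allows
-- bounds the depth of the recursion.
recur : {X A C : Set} → (A → C) → ((A → C) → A → C) → List X → A → C
recur b s []       = b
recur b s (_ ∷ xs) = s (recur b s xs)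

listCase : {A C : Set} → C → (A → List A → C) → List A → C
listCase z f []       = z
listCase z f (x ∷ xs) = f x xs

infix 4 _⊢_⇓_within_
data _⊢_⇓_within_ {m} (ρ : Vec Value m) (e : Tm m) (P : Value → Set) (b : ℕ) : Set where
  returns : ∀ {v t} → ρ ⊢ e ⇓ v [ t ] → P v → t ≤ b → ρ ⊢ e ⇓ P within b

loosen : ∀ {m} {ρ : Vec Value m} {e P b b′} → b ≤ b′ → ρ ⊢ e ⇓ P within b → ρ ⊢ e ⇓ P within b′
loosen b≤b′ (returns d p t≤b) = returns d p (≤-trans t≤b b≤b′)

module Programs (I : Set) (N par# : I → ℕ) (N>0 : ∀ i → 1 ≤ N i) where

  record size≤ (a : ℕ) (l : Len) (i : I) : Set where
    constructor within
    field
      length≤ : a ≤ ⟦ proj₁ l ⟧ (par# i) * N i ^ proj₂ l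

  1≤N^ : ∀ i c → 1 ≤ N i ^ c
  1≤N^ i zero    = ≤-refl
  1≤N^ i (suc c) = *-mono-≤ (N>0 i) (1≤N^ i c)

  m≤m*N^ : ∀ m i c → m ≤ m * N i ^ c
  m≤m*N^ m i c = ≤-trans (≤-reflexive (sym (*-identityʳ m))) (*-monoʳ-≤ m (1≤N^ i c))

  opaque
    cost : Bd → I → ℕ → ℕ
    cost (bd g c h) i B = ⟦ g ⟧ (par# i) * N i ^ c + ⟦ h ⟧ (par# i) * B

    ⊕-ok : ∀ b b′ {i B} → cost b i B + cost b′ i B ≤ cost (b ⊕ b′) i B
    ⊕-ok (bd g c h) (bd g′ c′ h′) {i} {B} = begin
      G * X + H * B + (G′ * X′ + H′ * B) ≡⟨ shuffle (G * X) (H * B) (G′ * X′) (H′ * B) ⟩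
      G * X + G′ * X′ + (H * B + H′ * B)
        ≤⟨ +-monoˡ-≤ _ (+-mono-≤ (*-monoʳ-≤ G (m≤m*N^ X i c′)) (*-monoʳ-≤ G′ (m≤m*N^ X′ i c))) ⟩
      G * (X * X′) + G′ * (X′ * X) + (H * B + H′ * B) ≡⟨ collect G G′ H H′ X X′ B ⟩
      (G + G′) * (X * X′) + (H + H′) * B
        ≡⟨ cong (λ z → (G + G′) * z + (H + H′) * B) (sym (^-distribˡ-+-* (N i) c c′)) ⟩
      (G + G′) * N i ^ (c + c′) + (H + H′) * B ∎
      where
      open ≤-Reasoning
      G G′ H H′ X X′ : ℕ
      G = ⟦ g ⟧ (par# i)
      G′ = ⟦ g′ ⟧ (par# i)
      H = ⟦ h ⟧ (par# i)
      H′ = ⟦ h′ ⟧ (par# i)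
      X = N i ^ c
      X′ = N i ^ c′
      shuffle : ∀ a b c d → a + b + (c + d) ≡ a + c + (b + d)
      shuffle = solve-∀
      collect : ∀ G G′ H H′ X X′ B →
        G * (X * X′) + G′ * (X′ * X) + (H * B + H′ * B) ≡ (G + G′) * (X * X′) + (H + H′) * B
      collect = solve-∀

    steps-ok : ∀ a {i B} → a ≤ cost (steps a) i B
    steps-ok a = ≤-trans (≤-reflexive (sym (*-identityʳ a))) (m≤m+n (a * 1) _)

    -- A loop of l(s) N^d rounds also multiplies the term h B, and `Bd` has no room for a product
    -- N^d B. So either nothing is called, B = 0, or the number of rounds is free of N.
    ⊗-ok : ∀ l b {i B a} → B ≡ 0 ⊎ proj₂ l ≡ 0 → size≤ a l i → a * cost b i B ≤ cost (l ⊗ b) i B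
    ⊗-ok (l , d) (bd g c h) {i} {B} {a} short (within a≤) = begin
      a * (G * X + H * B) ≡⟨ *-distribˡ-+ a (G * X) (H * B) ⟩
      a * (G * X) + a * (H * B) ≤⟨ +-mono-≤ (*-monoˡ-≤ (G * X) a≤) (calls short a≤) ⟩
      L * Y * (G * X) + L * (H * B) ≡⟨ collect L Y G X H B ⟩
      L * G * (Y * X) + L * H * B
        ≡⟨ cong (λ z → L * G * z + L * H * B) (sym (^-distribˡ-+-* (N i) d c)) ⟩
      L * G * N i ^ (d + c) + L * H * B ∎
      where
      open ≤-Reasoning
      L G H X Y : ℕ
      L = ⟦ l ⟧ (par# i)
      G = ⟦ g ⟧ (par# i)
      H = ⟦ h ⟧ (par# i)
      X = N i ^ c
      Y = N i ^ d
      calls : B ≡ 0 ⊎ d ≡ 0 → a ≤ L * N i ^ d → a * (H * B) ≤ L * (H * B)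
      calls (inj₁ refl) _ rewrite *-zeroʳ H | *-zeroʳ a = z≤n
      calls (inj₂ refl) a≤ = *-monoˡ-≤ (H * B) (≤-trans a≤ (≤-reflexive (*-identityʳ L)))
      collect : ∀ L Y G X H B → L * Y * (G * X) + L * (H * B) ≡ L * G * (Y * X) + L * H * B
      collect = solve-∀

  infixr 6 _⊕≤_
  _⊕≤_ : ∀ {b b′ i B t t′} → t ≤ cost b i B → t′ ≤ cost b′ i B → t + t′ ≤ cost (b ⊕ b′) i B
  _⊕≤_ {b} {b′} p q = ≤-trans (+-mono-≤ p q) (⊕-ok b b′)

  opaque
    unfolding cost

    cost-mono : ∀ b {i B} → cost b i 0 ≤ cost b i B
    cost-mono (bd g c h) {i} =
      +-monoʳ-≤ (⟦ g ⟧ (par# i) * N i ^ c) (*-monoʳ-≤ (⟦ h ⟧ (par# i)) z≤n)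

    cost-pure : ∀ b {i} → cost b i 0 ≤ ⟦ Bd.coef b ⟧ (par# i) * N i ^ Bd.deg b
    cost-pure (bd g c h) {i} = ≤-reflexive (trans (cong (⟦ g ⟧ (par# i) * N i ^ c +_) (*-zeroʳ (⟦ h ⟧ (par# i)))) (+-identityʳ _))

    one-call : ∀ {i B} → B ≤ cost (bd (con 0) 0 (con 1)) i B
    one-call {B = B} = ≤-reflexive (sym (*-identityˡ B))

    depthCost : Bd → I → ℕ → ℕ
    depthCost (bd g c h) i d = (1 + ⟦ g ⟧ (par# i) + ⟦ h ⟧ (par# i)) ^ suc d * N i ^ c

    depthCost-zero : ∀ b {i} → cost b i 0 ≤ depthCost b i 0
    depthCost-zero (bd g c h) {i} = begin
      G * X + H * 0     ≡⟨ simplify G H X ⟩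
      G * X             ≤⟨ *-monoˡ-≤ X (≤-trans (n≤1+n G) (m≤m+n (1 + G) H)) ⟩
      (1 + G + H) * X   ≡⟨ cong (_* X) (sym (*-identityʳ (1 + G + H))) ⟩
      (1 + G + H) * 1 * X ∎
      where
      open ≤-Reasoning
      G H X : ℕ
      G = ⟦ g ⟧ (par# i)
      H = ⟦ h ⟧ (par# i)
      X = N i ^ c
      simplify : ∀ G H X → G * X + H * 0 ≡ G * X
      simplify = solve-∀

    depthCost-suc : ∀ b {i} d → cost b i (depthCost b i d) ≤ depthCost b i (suc d)
    depthCost-suc (bd g c h) {i} d = begin
      G * X + H * (P * X)       ≤⟨ +-monoˡ-≤ _ (*-monoʳ-≤ G 1≤P) ⟩
      G * (P * X) + H * (P * X) ≡⟨ collect G H P X ⟩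
      (G + H) * P * X           ≤⟨ *-monoˡ-≤ X (*-monoˡ-≤ P (n≤1+n (G + H))) ⟩
      (1 + G + H) * P * X       ∎
      where
      open ≤-Reasoning
      G H X P : ℕ
      G = ⟦ g ⟧ (par# i)
      H = ⟦ h ⟧ (par# i)
      X = N i ^ c
      P = (1 + G + H) ^ suc d
      1≤P : X ≤ P * X
      1≤P = ≤-trans (≤-reflexive (sym (*-identityˡ X))) (*-monoˡ-≤ X (m^n>0 (1 + G + H) (suc d)))
      collect : ∀ G H P X → G * (P * X) + H * (P * X) ≡ (G + H) * P * X
      collect = solve-∀

    depthCost-rec : ∀ b D {i B d} → d ≤ ⟦ D ⟧ (par# i) → depthCost b i d ≤ cost (recBd D b) i B
    depthCost-rec (bd g c h) D {i} d≤ =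
      ≤-trans (*-monoˡ-≤ (N i ^ c) (^-monoʳ-≤ (1 + ⟦ g ⟧ (par# i) + ⟦ h ⟧ (par# i)) (s≤s d≤)))
              (m≤m+n _ _)

  -- Representation is a relation rather than an encoding function: it can also record facts about
  -- the represented object, such as a bound on the length of a list, and it can leave a value
  -- unspecified, as `AnyT` does.
  record Ty : Set₁ where
    no-eta-equality
    field
      Carrier : I → Set
      Rep     : ∀ {i} → Carrier i → Value → Set
  open Ty public

  private
    variable
      A C D : Ty
      Γ Δ : List Ty
      i : I
      B : ℕ
      m : ℕ

  -- φ is the type of the function being defined by recursion, if any.
  Oracle : Set₁
  Oracle = Maybe (Ty × Ty)

  private
    variable
      φ : Oracle

  OSem : Oracle → I → Set
  OSem nothing        i = ⊤
  OSem (just (A , C)) i = Carrier A i → Carrier C i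

  Sem : Oracle → List Ty → I → Set
  Sem φ []      i = OSem φ i
  Sem φ (A ∷ Γ) i = Carrier A i × Sem φ Γ i

  OPos : Oracle → ℕ → Set
  OPos nothing  m = ⊤
  OPos (just _) m = Fin m

  -- The environment at run time also holds closures and intermediate values that no typed context
  -- lists, so every typed variable comes with its actual index.
  Pos : Oracle → List Ty → ℕ → Set
  Pos φ []      m = OPos φ m
  Pos φ (A ∷ Γ) m = Fin m × Pos φ Γ m

  data Runs (A C : Ty) (F : Carrier A i → Carrier C i) (B : ℕ) : Value → Set where
    runs : ∀ {m} {σ : Vec Value m} {e} →
           (∀ {a w} → Rep A a w → w ∷ closure σ e ∷ σ ⊢ e ⇓ Rep C (F a) within B) →
           Runs A C F B (closure σ e)

  -- Outside a recursion there is nothing to call, and B = 0 makes the term h B of every bound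
  -- vanish.
  OEnv : ∀ φ (ρ : Vec Value m) → ℕ → OSem φ i → OPos φ m → Set
  OEnv nothing        ρ B F x = B ≡ 0
  OEnv (just (A , C)) ρ B F x = Runs A C F B (lookup ρ x)

  Env : ∀ φ (ρ : Vec Value m) (B : ℕ) Γ → Sem φ Γ i → Pos φ Γ m → Set
  Env φ ρ B []      F       x       = OEnv φ ρ B F x
  Env φ ρ B (A ∷ Γ) (a , γ) (x , ξ) = Rep A a (lookup ρ x) × Env φ ρ B Γ γ ξ

  oshift : ∀ φ → OPos φ m → OPos φ (suc m)
  oshift nothing  x = tt
  oshift (just _) x = suc x

  shift : ∀ Γ → Pos φ Γ m → Pos φ Γ (suc m)
  shift {φ} []  x       = oshift φ x
  shift (A ∷ Γ) (x , ξ) = suc x , shift Γ ξ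

  oshift-env : ∀ φ {ρ : Vec Value m} {F : OSem φ i} {x v} → OEnv φ ρ B F x → OEnv φ (v ∷ ρ) B F (oshift φ x)
  oshift-env nothing  e = e
  oshift-env (just _) e = e

  shift-env : ∀ Γ {ρ : Vec Value m} {γ : Sem φ Γ i} {ξ v} →
              Env φ ρ B Γ γ ξ → Env φ (v ∷ ρ) B Γ γ (shift Γ ξ)
  shift-env {φ = φ} [] e = oshift-env φ e
  shift-env (A ∷ Γ) (r , e) = r , shift-env Γ e

  Spec : Oracle → List Ty → Ty → Set
  Spec φ Γ A = ∀ i → Sem φ Γ i → Carrier A i

  record Comp (φ : Oracle) (Γ : List Ty) (A : Ty) (f : Spec φ Γ A) : Set₁ where
    field
      code  : ∀ {m} → Pos φ Γ m → Tm m
      bound : Bd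
      ok    : ∀ {m i B} {ρ : Vec Value m} γ ξ → Env φ ρ B Γ γ ξ →
              ρ ⊢ code ξ ⇓ Rep A (f i γ) within cost bound i B
  open Comp public

  Comp₀ : (Γ : List Ty) (A : Ty) → (∀ i → Sem nothing Γ i → Carrier A i) → Set₁
  Comp₀ = Comp nothing

  get : ∀ Γ (x : Fin (length Γ)) → Sem φ Γ i → Carrier (List.lookup Γ x) i
  get (A ∷ Γ) zero    (a , γ) = a
  get (A ∷ Γ) (suc x) (a , γ) = get Γ x γ

  pos : ∀ Γ (x : Fin (length Γ)) → Pos φ Γ m → Fin m
  pos (A ∷ Γ) zero    (p , ξ) = p
  pos (A ∷ Γ) (suc x) (p , ξ) = pos Γ x ξ

  get-env : ∀ Γ x {ρ : Vec Value m} {γ : Sem φ Γ i} {ξ} → Env φ ρ B Γ γ ξ →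
            Rep (List.lookup Γ x) (get Γ x γ) (lookup ρ (pos Γ x ξ))
  get-env (A ∷ Γ) zero    (r , e) = r
  get-env (A ∷ Γ) (suc x) (r , e) = get-env Γ x e

  # : ∀ {φ Γ} (x : Fin (length Γ)) → Comp φ Γ (List.lookup Γ x) (λ i γ → get Γ x γ)
  # {Γ = Γ} x = record
    { code  = λ ξ → var (pos Γ x ξ)
    ; bound = steps 1
    ; ok    = λ γ ξ e → returns (var _) (get-env Γ x e) (steps-ok 1)
    }

  osem : ∀ φ Γ → Sem φ Γ i → OSem φ i
  osem φ []      γ       = γ
  osem φ (A ∷ Γ) (_ , γ) = osem φ Γ γ

  opos : ∀ φ Γ → Pos φ Γ m → OPos φ m
  opos φ []      ξ       = ξ
  opos φ (A ∷ Γ) (_ , ξ) = opos φ Γ ξ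

  oenv : ∀ φ Γ {ρ : Vec Value m} {γ : Sem φ Γ i} {ξ} → Env φ ρ B Γ γ ξ → OEnv φ ρ B (osem φ Γ γ) (opos φ Γ ξ)
  oenv φ []      e       = e
  oenv φ (A ∷ Γ) (_ , e) = oenv φ Γ e

  -- Only the reading of the value changes; what the environment guarantees may be used.
  conv : {f : Spec φ Γ A} {g : Spec φ Γ C} →
         (∀ {m i B} {ρ : Vec Value m} γ ξ → Env φ ρ B Γ γ ξ → ∀ {v} → Rep A (f i γ) v → Rep C (g i γ) v) →
         Comp φ Γ A f → Comp φ Γ C g
  conv {φ = φ} {Γ = Γ} {C = C} {g = g} r c = record
    { code  = code c
    ; bound = bound c
    ; ok    = go
    }
    where
    go : ∀ {m i B} {ρ : Vec Value m} γ ξ → Env φ ρ B Γ γ ξ →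
         ρ ⊢ code c ξ ⇓ Rep C (g i γ) within cost (bound c) i B
    go γ ξ e with ok c γ ξ e
    ... | returns d p t≤ = returns d (r γ ξ e p) t≤

  const-nil : {f : Spec φ Γ A} → (∀ i γ → Rep A (f i γ) nil) → Comp φ Γ A f
  const-nil r = record
    { code  = λ _ → nil
    ; bound = steps 1
    ; ok    = λ γ ξ e → returns nil (r _ γ) (steps-ok 1)
    }

  node : {f : Spec φ Γ A} {g : Spec φ Γ C} {h : Spec φ Γ D} →
         Comp φ Γ A f → Comp φ Γ C g →
         (∀ i γ {v w} → Rep A (f i γ) v → Rep C (g i γ) w → Rep D (h i γ) (v ∙ w)) → Comp φ Γ D h
  node {φ = φ} {Γ = Γ} {D = D} {h = h} a b r = record
    { code  = λ ξ → code a ξ ∙ code b ξ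
    ; bound = steps 1 ⊕ (bound a ⊕ bound b)
    ; ok    = go
    }
    where
    go : ∀ {m i B} {ρ : Vec Value m} γ ξ → Env φ ρ B Γ γ ξ → ρ ⊢ code a ξ ∙ code b ξ ⇓ Rep D (h i γ) within _
    go γ ξ e with ok a γ ξ e | ok b γ ξ e
    ... | returns d p x | returns d′ p′ x′ =
      returns (d ∙ d′) (r _ γ p p′)
        (steps-ok 1 ⊕≤ x ⊕≤ x′)

  infixr 5 _⟩⟩_
  _⟩⟩_ : {f : Spec φ Γ A} {g : Spec φ (A ∷ Γ) C} →
         Comp φ Γ A f → Comp φ (A ∷ Γ) C g → Comp φ Γ C (λ i γ → g i (f i γ , γ))
  _⟩⟩_ {φ = φ} {Γ = Γ} {C = C} {f = f} {g = g} a b = record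
    { code  = term
    ; bound = steps 3 ⊕ (bound a ⊕ bound b)
    ; ok    = go
    }
    where
    term : ∀ {m} → Pos φ Γ m → Tm m
    term ξ = case (code a ξ ∙ nil) nil (code b (zero , shift Γ (shift Γ ξ)))
    go : ∀ {m i B} {ρ : Vec Value m} γ ξ → Env φ ρ B Γ γ ξ → ρ ⊢ term ξ ⇓ Rep C (g i (f i γ , γ)) within _
    go {ρ = ρ} γ ξ e with ok a γ ξ e
    ... | returns {v} {t} d p x
      with ok b _ _ (p , shift-env Γ {ρ = nil ∷ ρ} {v = v} (shift-env Γ {v = nil} e))
    ... | returns {t = t′} d′ p′ x′ = returns (case-∙ (d ∙ nil) d′) p′
      (≤-trans (≤-reflexive (eq t t′))
        (steps-ok 3 ⊕≤ x ⊕≤ x′))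
      where
      eq : ∀ t t′ → suc (suc (t + 1) + t′) ≡ 3 + (t + t′)
      eq = solve-∀

  data Split (Nil : Set) (Node : Value → Value → Set) : Value → Set where
    isNil  : Nil → Split Nil Node nil
    isNode : ∀ {x y} → Node x y → Split Nil Node (x ∙ y)

  -- The eliminators of truth values, options and lists are instances, because `case` only tells
  -- `nil` from pairs. The last argument says what either shape of the scrutinized value means for
  -- the result.
  branch : {A P Q : Ty} {f : Spec φ Γ A} {k h : Spec φ Γ C} {l : Spec φ (P ∷ Q ∷ Γ) C} →
           Comp φ Γ A f → Comp φ Γ C k → Comp φ (P ∷ Q ∷ Γ) C l →
           (∀ i γ {v} → Rep A (f i γ) v →
              Split (k i γ ≡ h i γ)
                    (λ x y → Σ[ p ∈ Carrier P i ] Σ[ q ∈ Carrier Q i ]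
                             Rep P p x × Rep Q q y × l i (p , q , γ) ≡ h i γ) v) →
           Comp φ Γ C h
  branch {φ = φ} {Γ = Γ} {C = C} {A = A} {f = f} {h = h} a b c r = record
    { code  = term
    ; bound = steps 1 ⊕ (bound a ⊕ (bound b ⊕ bound c))
    ; ok    = λ γ ξ e → go γ ξ e (ok a γ ξ e)
    }
    where
    term : ∀ {m} → Pos φ Γ m → Tm m
    term ξ = case (code a ξ) (code b ξ) (code c (zero , suc zero , shift Γ (shift Γ ξ)))
    total : ∀ {i B t t′} → t ≤ cost (bound a) i B → t′ ≤ cost (bound b ⊕ bound c) i B →
            1 + (t + t′) ≤ cost (steps 1 ⊕ (bound a ⊕ (bound b ⊕ bound c))) i B
    total x y = steps-ok 1 ⊕≤ x ⊕≤ y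
    go : ∀ {m i B} {ρ : Vec Value m} γ ξ → Env φ ρ B Γ γ ξ →
         ρ ⊢ code a ξ ⇓ Rep A (f i γ) within cost (bound a) i B → ρ ⊢ term ξ ⇓ Rep C (h i γ) within _
    go γ ξ e (returns {v} d p x) with r _ γ {v} p
    go γ ξ e (returns d p x) | isNil eq with ok b γ ξ e
    ... | returns d′ p′ x′ = returns (case-nil d d′) (subst (λ z → Rep C z _) eq p′)
            (total x (≤-trans (m≤m+n _ _) (x′ ⊕≤ z≤n)))
    go {ρ = ρ} γ ξ e (returns d p x) | isNode {u} {w} (_ , _ , pu , pw , eq)
      with ok c _ _ (pu , pw , shift-env Γ {ρ = w ∷ ρ} {v = u} (shift-env Γ {v = w} e))
    ... | returns d′ p′ x′ = returns (case-∙ d d′) (subst (λ z → Rep C z _) eq p′)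
            (total x (z≤n ⊕≤ x′))

  data ListRep {A : Set} (R : A → Value → Set) : List A → Value → Set where
    []  : ListRep R [] nil
    _∷_ : ∀ {x xs v vs} → R x v → ListRep R xs vs → ListRep R (x ∷ xs) (v ∙ vs)

  ListOf : Ty → Ty
  Carrier (ListOf A) i = List (Carrier A i)
  Rep     (ListOf A)   = ListRep (Rep A)

  ListUpTo : Len → Ty → Ty
  Carrier (ListUpTo l A) i            = List (Carrier A i)
  Rep     (ListUpTo l A) {i = i} xs v = ListRep (Rep A) xs v × size≤ (length xs) l i

  -- A recursive call may only be repeated as often as the parameter permits: otherwise a power of N would
  -- be raised to the depth of the recursion.
  Loop : Oracle → ℕ → Set
  Loop nothing  d       = ⊤
  Loop (just _) zero    = ⊤
  Loop (just _) (suc d) = ⊥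

  loop-short : ∀ φ Γ {d} → Loop φ d → {ρ : Vec Value m} {γ : Sem φ Γ i} {ξ : Pos φ Γ m} →
               Env φ ρ B Γ γ ξ → B ≡ 0 ⊎ d ≡ 0
  loop-short nothing  []             _ e       = inj₁ e
  loop-short (just _) []      {zero} _ e       = inj₂ refl
  loop-short nothing  (_ ∷ Γ)        l (_ , e) = loop-short nothing Γ l e
  loop-short (just o) (_ ∷ Γ)        l (_ , e) = loop-short (just o) Γ l e

  -- Besides `recursion` the only source of iteration. The length bound in the type of the list is
  -- what bounds the number of rounds.
  fold : {A C : Ty} {l : Len} {loop : Loop φ (proj₂ l)}
         {f : Spec φ Γ (ListUpTo l A)} {g : Spec φ Γ C} {h : Spec φ (A ∷ C ∷ Γ) C} →
         Comp φ Γ (ListUpTo l A) f → Comp φ Γ C g → Comp φ (A ∷ C ∷ Γ) C h →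
         Comp φ Γ C (λ i γ → foldr (λ x r → h i (x , r , γ)) (g i γ) (f i γ))
  fold {φ = φ} {Γ = Γ} {A = A} {C = C} {l = l} {short} {f} {g} {h} a b c = record
    { code  = term
    ; bound = steps 8 ⊕ bound b ⊕ bound a ⊕ l ⊗ (steps 8 ⊕ bound c)
    ; ok    = go
    }
    where
    shift⁸ : ∀ {m} → Pos φ Γ m → Pos φ Γ (8 + m)
    shift⁸ ξ = shift Γ (shift Γ (shift Γ (shift Γ (shift Γ (shift Γ (shift Γ (shift Γ ξ)))))))
    body : ∀ {m} → Pos φ Γ m → Tm (4 + m)
    body ξ = case (var zero) (var (suc (suc zero)))
               -- This binds the head and the result for the tail in the order of the context of
               -- `c`. Eight bindings then lie above the outer environment: these two, head and
               -- tail, the current list, the closure, the start value and the whole list.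
               (case (var zero ∙ app (var (suc (suc (suc zero)))) (var (suc zero))) nil
                 (code c (zero , suc zero , shift⁸ ξ)))
    term : ∀ {m} → Pos φ Γ m → Tm m
    term ξ = case (code b ξ ∙ code a ξ) nil (app (fun (body ξ)) (var (suc zero)))
    go : ∀ {m i B} {ρ : Vec Value m} γ ξ → Env φ ρ B Γ γ ξ →
         ρ ⊢ term ξ ⇓ Rep C (foldr (λ x r → h i (x , r , γ)) (g i γ) (f i γ)) within _
    go {m} {i} {B} {ρ} γ ξ e with ok b γ ξ e | ok a γ ξ e
    ... | returns {z} {tz} dz rz tz≤ | returns {w} {tw} dw (rw , len) tw≤ = finish (loop rw)
      where
      σ : Vec Value (2 + m)
      σ = z ∷ w ∷ ρ
      K : ℕ
      K = 8 + cost (bound c) i B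
      result : List (Carrier A i) → Carrier C i
      result = foldr (λ x r → h i (x , r , γ)) (g i γ)
      loop : ∀ {xs v} → ListRep (Rep A) xs v →
             v ∷ closure σ (body ξ) ∷ σ ⊢ body ξ ⇓ Rep C (result xs) within (length xs * K + 3)
      loop [] = returns (case-nil (var zero) (var (suc (suc zero)))) rz (s≤s (s≤s (s≤s z≤n)))
      loop {x ∷ xs} {v ∙ vs} (p ∷ ps) with loop ps
      ... | returns {u} {t} d r t≤
        with ok c (x , result xs , γ) (zero , suc zero , shift⁸ ξ)
               (p , r , shift-env Γ {v = v} (shift-env Γ {v = u} (shift-env Γ {v = v}
                        (shift-env Γ {v = vs} (shift-env Γ {v = v ∙ vs}
                        (shift-env Γ {v = closure σ (body ξ)} (shift-env Γ {v = z}
                        (shift-env Γ {v = w} e))))))))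
      ... | returns {t = t′} d′ r′ t≤′ = returns
        (case-∙ (var zero) (case-∙ (var zero ∙ app (var _) (var _) d) d′)) r′
        (≤-trans (≤-reflexive (count t t′))
          (≤-trans (+-mono-≤ (+-monoʳ-≤ 8 t≤′) t≤) (≤-reflexive (sym (+-assoc K (length xs * K) 3)))))
        where
        count : ∀ t t′ → 3 + (1 + (1 + (1 + (1 + 1 + t))) + t′) ≡ 8 + t′ + t
        count = solve-∀
      count : ∀ t tz tw → suc (suc (tz + tw) + suc (1 + 1 + t)) ≡ 5 + (tz + (tw + t))
      count = solve-∀
      finish : w ∷ closure σ (body ξ) ∷ σ ⊢ body ξ ⇓ Rep C (result (f i γ)) within (length (f i γ) * K + 3) →
               ρ ⊢ term ξ ⇓ Rep C (result (f i γ)) within _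
      finish (returns {t = t} d r t≤) = returns (case-∙ (dz ∙ dw) (app (fun _) (var _) d)) r
        (≤-trans (≤-reflexive (count t tz tw))
          (≤-trans (+-monoʳ-≤ 5 (+-monoʳ-≤ tz (+-monoʳ-≤ tw t≤)))
            (≤-trans (≤-reflexive (assoc tz tw (length (f i γ) * K)))
              (steps-ok 8 ⊕≤ tz≤ ⊕≤ tw≤ ⊕≤ loops))))
        where
        assoc : ∀ tz tw a → 5 + (tz + (tw + (a + 3))) ≡ 8 + (tz + (tw + a))
        assoc = solve-∀
        loops : length (f i γ) * K ≤ cost (l ⊗ (steps 8 ⊕ bound c)) i B
        loops = ≤-trans (*-monoʳ-≤ (length (f i γ)) (steps-ok 8 ⊕≤ ≤-refl))
                        (⊗-ok l (steps 8 ⊕ bound c) (loop-short φ Γ short e) len)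

  osem→ : ∀ Γ → Sem nothing Γ i → OSem φ i → Sem φ Γ i
  osem→ []      γ       F = F
  osem→ (A ∷ Γ) (a , γ) F = a , osem→ Γ γ F

  opos→ : ∀ Γ → Pos nothing Γ m → OPos φ m → Pos φ Γ m
  opos→ []      ξ       x = x
  opos→ (A ∷ Γ) (p , ξ) x = p , opos→ Γ ξ x

  oenv→ : ∀ Γ {ρ : Vec Value m} {γ : Sem nothing Γ i} {ξ B′} {F : OSem φ i} {x} →
          Env nothing ρ B Γ γ ξ → OEnv φ ρ B′ F x → Env φ ρ B′ Γ (osem→ Γ γ F) (opos→ Γ ξ x)
  oenv→ []      _       o = o
  oenv→ (A ∷ Γ) (r , e) o = r , oenv→ Γ e o

  wk : {A : Ty} {f : Spec φ Γ C} → Comp φ Γ C f → Comp φ (A ∷ Γ) C (λ i γ → f i (proj₂ γ))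
  wk c = record
    { code  = λ ξ → code c (proj₂ ξ)
    ; bound = bound c
    ; ok    = λ γ ξ e → ok c (proj₂ γ) (proj₂ ξ) (proj₂ e)
    }

  self : {f : Spec (just (A , C)) Γ A} → Comp (just (A , C)) Γ A f →
         Comp (just (A , C)) Γ C (λ i γ → osem (just (A , C)) Γ γ (f i γ))
  self {A = A} {C = C} {Γ = Γ} {f = f} a = record
    { code  = λ ξ → app (var (opos _ Γ ξ)) (code a ξ)
    ; bound = steps 2 ⊕ bound a ⊕ bd (con 0) 0 (con 1)
    ; ok    = go
    }
    where
    go : ∀ {m i B} {ρ : Vec Value m} γ ξ → Env (just (A , C)) ρ B Γ γ ξ →
         ρ ⊢ app (var (opos _ Γ ξ)) (code a ξ) ⇓ Rep C (osem _ Γ γ (f i γ)) within _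
    go {ρ = ρ} γ ξ e with ok a γ ξ e | lookup ρ (opos (just (A , C)) Γ ξ) in eq | oenv (just (A , C)) Γ e
    ... | returns d r t≤ | _ | runs k with k r
    ... | returns d′ r′ t≤′ =
      returns (app (var-at _ eq) d d′) r′ (steps-ok 2 ⊕≤ t≤ ⊕≤ ≤-trans t≤′ one-call)

  -- The term is curried. Given the fuel it only builds a closure; so a call first makes, in
  -- constantly many steps, the closure for one unit of fuel less, and this is the function that `s`
  -- may call. The bound on the fuel has degree 0 in N because the cost is exponential in the depth.
  recursion : {D : Growth} {X A C : Ty} {l : Spec nothing Γ (ListUpTo (D , 0) X)} {f : Spec nothing Γ A}
              {b : Spec nothing (A ∷ Γ) C} {s : Spec (just (A , C)) (A ∷ Γ) C} →
              Comp₀ Γ (ListUpTo (D , 0) X) l → Comp₀ Γ A f →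
              Comp₀ (A ∷ Γ) C b → Comp (just (A , C)) (A ∷ Γ) C s →
              Comp₀ Γ C (λ i γ → recur (λ a → b i (a , γ)) (λ F a → s i (a , osem→ Γ γ F)) (l i γ) (f i γ))
  recursion {Γ = Γ} {D} {X} {A} {C} {l} {f} {b} {s} cl ca cb cs = record
    { code  = term
    ; bound = steps 4 ⊕ bound cl ⊕ bound ca ⊕ recBd D bd₁
    ; ok    = go
    }
    where
    bd₁ : Bd
    bd₁ = steps 9 ⊕ bound cb ⊕ bound cs
    shift⁴ : ∀ {φ m} → Pos φ Γ m → Pos φ Γ (4 + m)
    shift⁴ ξ = shift Γ (shift Γ (shift Γ (shift Γ ξ)))
    inner : ∀ {m} → Pos nothing Γ m → Tm (4 + m)
    inner ξ = case (var (suc (suc zero))) (code cb (zero , shift⁴ ξ))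
      (case (app (var (suc (suc (suc (suc (suc zero)))))) (var (suc zero)) ∙ nil) nil
        (code cs (suc (suc (suc (suc zero))) , opos→ Γ (shift⁴ (shift⁴ ξ)) zero)))
    term : ∀ {m} → Pos nothing Γ m → Tm m
    term ξ = app (app (fun (fun (inner ξ))) (code cl ξ)) (code ca ξ)
    go : ∀ {m i B} {ρ : Vec Value m} γ ξ → Env nothing ρ B Γ γ ξ →
         ρ ⊢ term ξ ⇓ Rep C (recur (λ a → b i (a , γ)) (λ F a → s i (a , osem→ Γ γ F)) (l i γ) (f i γ)) within _
    go {m} {i} {B} {ρ} γ ξ e with oenv nothing Γ e | ok cl γ ξ e | ok ca γ ξ e
    ... | refl | returns {w} {tw} dw (rw , within len) tw≤ | returns {a} {ta} da ra ta≤ = finish (loop rw)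
      where
      G : Value
      G = closure ρ (fun (inner ξ))
      env⁴ : ∀ {φ : Oracle} {m B} {ρ : Vec Value m} {γ : Sem φ Γ i} {ξ} {v₁ v₂ v₃ v₄} → Env φ ρ B Γ γ ξ →
             Env φ (v₁ ∷ v₂ ∷ v₃ ∷ v₄ ∷ ρ) B Γ γ (shift⁴ ξ)
      env⁴ {v₁ = v₁} {v₂} {v₃} {v₄} e =
        shift-env Γ {v = v₁} (shift-env Γ {v = v₂} (shift-env Γ {v = v₃} (shift-env Γ {v = v₄} e)))
      result : List (Carrier X i) → Carrier A i → Carrier C i
      result = recur (λ a → b i (a , γ)) (λ F a → s i (a , osem→ Γ γ F))
      loop : ∀ {xs v} → ListRep (Rep X) xs v →
             Runs A C (result xs) (depthCost bd₁ i (length xs)) (closure (v ∷ G ∷ ρ) (inner ξ))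
      loop [] = runs base
        where
        base : ∀ {a w} → Rep A a w → _ ⊢ inner ξ ⇓ Rep C (b i (a , γ)) within _
        base r with ok cb _ _ (r , env⁴ e)
        ... | returns {t = t} d r′ t≤ = returns (case-nil (var _) d) r′
          (≤-trans (≤-reflexive (cong (2 +_) (sym (+-identityʳ t))))
            (≤-trans (≤-trans (m≤m+n 2 7) (steps-ok 9) ⊕≤ t≤ ⊕≤ z≤n) (depthCost-zero bd₁)))
      loop {x ∷ xs} {v ∙ vs} (p ∷ ps) = runs step
        where
        step : ∀ {a w} → Rep A a w → w ∷ closure ((v ∙ vs) ∷ G ∷ ρ) (inner ξ) ∷ (v ∙ vs) ∷ G ∷ ρ ⊢ inner ξ
                 ⇓ Rep C (s i (a , osem→ Γ γ (result xs))) within depthCost bd₁ i (suc (length xs))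
        step r with ok cs _ _ (r , oenv→ Γ (env⁴ (env⁴ e)) (loop ps))
        ... | returns d r′ t≤ = returns
          (case-∙ (var _) (case-∙ (app (var _) (var _) (fun _) ∙ nil) d)) r′
          (≤-trans (steps-ok 9 ⊕≤ z≤n ⊕≤ t≤) (depthCost-suc bd₁ (length xs)))
      finish : Runs A C (result (l i γ)) (depthCost bd₁ i (length (l i γ))) (closure (w ∷ G ∷ ρ) (inner ξ)) →
               ρ ⊢ term ξ ⇓ Rep C (result (l i γ) (f i γ)) within _
      finish (runs k) with k ra
      ... | returns {t = t} d r t≤ = returns (app (app (fun _) dw (fun _)) da d) r
        (≤-trans (≤-reflexive (count tw ta t))
          (steps-ok 4 ⊕≤ tw≤ ⊕≤ ta≤ ⊕≤ ≤-trans t≤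
            (depthCost-rec bd₁ D (≤-trans len (≤-reflexive (*-identityʳ (⟦ D ⟧ (par# i))))))))
        where
        count : ∀ tw ta t → suc (suc (1 + tw + 1) + ta + t) ≡ 4 + (tw + (ta + t))
        count = solve-∀

  front : ∀ Δ → Sem φ (Δ ++ Γ) i → Sem nothing Δ i
  front []      γ       = tt
  front (A ∷ Δ) (a , γ) = a , front Δ γ

  frontPos : ∀ {φ} Δ → Pos φ (Δ ++ Γ) m → Pos nothing Δ m
  frontPos         []      ξ       = tt
  frontPos {φ = φ} (A ∷ Δ) (p , ξ) = p , frontPos {φ = φ} Δ ξ

  front-env : ∀ Δ {ρ : Vec Value m} {γ : Sem φ (Δ ++ Γ) i} {ξ} → Env φ ρ B (Δ ++ Γ) γ ξ →
              Env nothing ρ 0 Δ (front Δ γ) (frontPos {φ = φ} Δ ξ)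
  front-env []      e       = refl
  front-env (A ∷ Δ) (r , e) = r , front-env Δ e

  -- A finished program may be used inside a recursion: it calls nothing, so its bound at B = 0
  -- holds at every B.
  closed : ∀ {Δ} {f : Spec nothing Δ C} → Comp₀ Δ C f →
           Comp φ (Δ ++ Γ) C (λ i γ → f i (front Δ γ))
  closed {φ = φ} {Δ = Δ} c = record
    { code  = λ ξ → code c (frontPos {φ = φ} Δ ξ)
    ; bound = bound c
    ; ok    = λ γ ξ e → loosen (cost-mono (bound c)) (ok c (front Δ γ) (frontPos {φ = φ} Δ ξ) (front-env Δ e))
    }

  module _ {A₁ : Ty} {f₁ : Spec φ Γ A₁} (c₁ : Comp φ Γ A₁ f₁) where

    -- Binding the arguments to variables first presents the program with exactly the context for
    -- which it was written.
    call₁ : {f : Spec nothing (A₁ ∷ []) C} → Comp₀ (A₁ ∷ []) C f → Comp φ Γ C (λ i γ → f i (f₁ i γ , tt))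
    call₁ c = c₁ ⟩⟩ closed c

    module _ {A₂ : Ty} {f₂ : Spec φ Γ A₂} (c₂ : Comp φ Γ A₂ f₂) where

      call₂ : {f : Spec nothing (A₁ ∷ A₂ ∷ []) C} → Comp₀ (A₁ ∷ A₂ ∷ []) C f →
              Comp φ Γ C (λ i γ → f i (f₁ i γ , f₂ i γ , tt))
      call₂ c = c₂ ⟩⟩ wk c₁ ⟩⟩ closed c

      module _ {A₃ : Ty} {f₃ : Spec φ Γ A₃} (c₃ : Comp φ Γ A₃ f₃) where

        call₃ : {f : Spec nothing (A₁ ∷ A₂ ∷ A₃ ∷ []) C} → Comp₀ (A₁ ∷ A₂ ∷ A₃ ∷ []) C f →
                Comp φ Γ C (λ i γ → f i (f₁ i γ , f₂ i γ , f₃ i γ , tt))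
        call₃ c = c₃ ⟩⟩ wk c₂ ⟩⟩ wk (wk c₁) ⟩⟩ closed c

        module _ {A₄ : Ty} {f₄ : Spec φ Γ A₄} (c₄ : Comp φ Γ A₄ f₄) where

          call₄ : {f : Spec nothing (A₁ ∷ A₂ ∷ A₃ ∷ A₄ ∷ []) C} → Comp₀ (A₁ ∷ A₂ ∷ A₃ ∷ A₄ ∷ []) C f →
                  Comp φ Γ C (λ i γ → f i (f₁ i γ , f₂ i γ , f₃ i γ , f₄ i γ , tt))
          call₄ c = c₄ ⟩⟩ wk c₃ ⟩⟩ wk (wk c₂) ⟩⟩ wk (wk (wk c₁)) ⟩⟩ closed c

          module _ {A₅ : Ty} {f₅ : Spec φ Γ A₅} (c₅ : Comp φ Γ A₅ f₅) where

            call₅ : {f : Spec nothing (A₁ ∷ A₂ ∷ A₃ ∷ A₄ ∷ A₅ ∷ []) C} →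
                    Comp₀ (A₁ ∷ A₂ ∷ A₃ ∷ A₄ ∷ A₅ ∷ []) C f →
                    Comp φ Γ C (λ i γ → f i (f₁ i γ , f₂ i γ , f₃ i γ , f₄ i γ , f₅ i γ , tt))
            call₅ c = c₅ ⟩⟩ wk c₄ ⟩⟩ wk (wk c₃) ⟩⟩ wk (wk (wk c₂)) ⟩⟩ wk (wk (wk (wk c₁))) ⟩⟩ closed c

            module _ {A₆ : Ty} {f₆ : Spec φ Γ A₆} (c₆ : Comp φ Γ A₆ f₆) where

              call₆ : {f : Spec nothing (A₁ ∷ A₂ ∷ A₃ ∷ A₄ ∷ A₅ ∷ A₆ ∷ []) C} →
                      Comp₀ (A₁ ∷ A₂ ∷ A₃ ∷ A₄ ∷ A₅ ∷ A₆ ∷ []) C f →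
                      Comp φ Γ C (λ i γ → f i (f₁ i γ , f₂ i γ , f₃ i γ , f₄ i γ , f₅ i γ , f₆ i γ , tt))
              call₆ c = c₆ ⟩⟩ wk c₅ ⟩⟩ wk (wk c₄) ⟩⟩ wk (wk (wk c₃)) ⟩⟩ wk (wk (wk (wk c₂))) ⟩⟩
                        wk (wk (wk (wk (wk c₁)))) ⟩⟩ closed c

  by : {f g : Spec φ Γ A} → (∀ i γ → f i γ ≡ g i γ) → Comp φ Γ A f → Comp φ Γ A g
  by {A = A} eq = conv (λ {_} {i} γ _ _ {v} → subst (λ x → Rep A x v) (eq i γ))

  -- Basic data types and their operations

  UnitT : Ty
  Carrier UnitT _   = ⊤
  Rep     UnitT _ v = v ≡ nil

  AnyT : Ty
  Carrier AnyT _   = ⊤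
  Rep     AnyT _ _ = ⊤

  BoolT : Ty
  Carrier BoolT _   = Bool
  Rep     BoolT b v = v ≡ encodeBool b

  data PairRep {A C : Set} (R : A → Value → Set) (S : C → Value → Set) : A × C → Value → Set where
    _,_ : ∀ {a c v w} → R a v → S c w → PairRep R S (a , c) (v ∙ w)

  infixr 4 _×ᵀ_
  _×ᵀ_ : Ty → Ty → Ty
  Carrier (A ×ᵀ C) i = Carrier A i × Carrier C i
  Rep     (A ×ᵀ C)   = PairRep (Rep A) (Rep C)

  data MaybeRep {A : Set} (R : A → Value → Set) : Maybe A → Value → Set where
    nothing : MaybeRep R nothing nil
    just    : ∀ {a v} → R a v → MaybeRep R (just a) (v ∙ nil)

  MaybeT : Ty → Ty
  Carrier (MaybeT A) i = Maybe (Carrier A i)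
  Rep     (MaybeT A)   = MaybeRep (Rep A)

  falseᶜ : Comp φ Γ BoolT (λ _ _ → false)
  falseᶜ = const-nil (λ _ _ → refl)

  trueᶜ : Comp φ Γ BoolT (λ _ _ → true)
  trueᶜ = node {A = UnitT} {C = UnitT} (const-nil {A = UnitT} (λ _ _ → refl)) (const-nil {A = UnitT} (λ _ _ → refl))
               (λ { _ _ refl refl → refl })

  ifᶜ : {f : Spec φ Γ BoolT} {g h : Spec φ Γ C} → Comp φ Γ BoolT f → Comp φ Γ C g → Comp φ Γ C h →
        Comp φ Γ C (λ i γ → if f i γ then g i γ else h i γ)
  ifᶜ {φ = φ} {Γ = Γ} {C = C} {f} {g} {h} a b c = branch {P = AnyT} {Q = AnyT} a c (wk (wk b)) (λ i γ → cases (f i γ))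
    where
    cases : ∀ b {X : Set} {x y : X} {v} → v ≡ encodeBool b →
            Split (y ≡ (if b then x else y))
                  (λ _ _ → Σ[ _ ∈ ⊤ ] Σ[ _ ∈ ⊤ ] ⊤ × ⊤ × x ≡ (if b then x else y)) v
    cases false refl = isNil refl
    cases true  refl = isNode (tt , tt , tt , tt , refl)

  notᶜ : {f : Spec φ Γ BoolT} → Comp φ Γ BoolT f → Comp φ Γ BoolT (λ i γ → not (f i γ))
  notᶜ {f = f} a = by (λ i γ → eq (f i γ)) (ifᶜ a falseᶜ trueᶜ)
    where
    eq : ∀ b → (if b then false else true) ≡ not b
    eq false = refl
    eq true  = refl

  infixr 6 _∧ᶜ_
  infixr 5 _∨ᶜ_
  _∧ᶜ_ _∨ᶜ_ : {f g : Spec φ Γ BoolT} → Comp φ Γ BoolT f → Comp φ Γ BoolT g → Comp φ Γ BoolT _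
  _∧ᶜ_ {f = f} {g} a b = by {g = λ i γ → f i γ ∧ g i γ} (λ i γ → eq (f i γ) (g i γ)) (ifᶜ a b falseᶜ)
    where
    eq : ∀ x y → (if x then y else false) ≡ x ∧ y
    eq false y = refl
    eq true  y = refl
  _∨ᶜ_ {f = f} {g} a b = by {g = λ i γ → f i γ ∨ g i γ} (λ i γ → eq (f i γ) (g i γ)) (ifᶜ a trueᶜ b)
    where
    eq : ∀ x y → (if x then true else y) ≡ x ∨ y
    eq false y = refl
    eq true  y = refl

  infixr 4 _,ᶜ_
  _,ᶜ_ : {f : Spec φ Γ A} {g : Spec φ Γ C} → Comp φ Γ A f → Comp φ Γ C g →
         Comp φ Γ (A ×ᵀ C) (λ i γ → f i γ , g i γ)
  a ,ᶜ b = node a b (λ _ _ → _,_)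

  fstᶜ : {f : Spec φ Γ (A ×ᵀ C)} → Comp φ Γ (A ×ᵀ C) f → Comp φ Γ A (λ i γ → proj₁ (f i γ))
  fstᶜ {φ = φ} {Γ = Γ} {A = A} {C = C} {f} a = record
    { code  = λ ξ → case (code a ξ) nil (var zero)
    ; bound = steps 2 ⊕ bound a
    ; ok    = go
    }
    where
    go : ∀ {m i B} {ρ : Vec Value m} γ ξ → Env φ ρ B Γ γ ξ →
         ρ ⊢ case (code a ξ) nil (var zero) ⇓ Rep A (proj₁ (f i γ)) within _
    go {i = i} γ ξ e with f i γ | ok a γ ξ e
    ... | _ | returns {t = t} d (r , _) t≤ = returns (case-∙ d (var zero)) r
      (≤-trans (≤-reflexive (cong suc (+-comm t 1))) (steps-ok 2 ⊕≤ t≤))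

  sndᶜ : {f : Spec φ Γ (A ×ᵀ C)} → Comp φ Γ (A ×ᵀ C) f → Comp φ Γ C (λ i γ → proj₂ (f i γ))
  sndᶜ {φ = φ} {Γ = Γ} {A = A} {C = C} {f} a = record
    { code  = λ ξ → case (code a ξ) nil (var (suc zero))
    ; bound = steps 2 ⊕ bound a
    ; ok    = go
    }
    where
    go : ∀ {m i B} {ρ : Vec Value m} γ ξ → Env φ ρ B Γ γ ξ →
         ρ ⊢ case (code a ξ) nil (var (suc zero)) ⇓ Rep C (proj₂ (f i γ)) within _
    go {i = i} γ ξ e with f i γ | ok a γ ξ e
    ... | _ | returns {t = t} d (_ , r) t≤ = returns (case-∙ d (var (suc zero))) r
      (≤-trans (≤-reflexive (cong suc (+-comm t 1))) (steps-ok 2 ⊕≤ t≤))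

  nothingᶜ : Comp φ Γ (MaybeT A) (λ _ _ → nothing)
  nothingᶜ = const-nil (λ _ _ → nothing)

  justᶜ : {f : Spec φ Γ A} → Comp φ Γ A f → Comp φ Γ (MaybeT A) (λ i γ → just (f i γ))
  justᶜ a = node {C = UnitT} a (const-nil (λ _ _ → refl)) (λ { _ _ r refl → just r })

  maybeᶜ : {f : Spec φ Γ (MaybeT A)} {g : Spec φ Γ C} {h : Spec φ (A ∷ Γ) C} →
           Comp φ Γ (MaybeT A) f → Comp φ Γ C g → Comp φ (A ∷ Γ) C h →
           Comp φ Γ C (λ i γ → maybe′ (λ a → h i (a , γ)) (g i γ) (f i γ))
  maybeᶜ {φ = φ} {Γ = Γ} {A = A} {C = C} {f} {g} {h} a b c =
    branch {P = A} {Q = AnyT} {l = λ i γ → h i (proj₁ γ , proj₂ (proj₂ γ))} a b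
      record { code  = λ ξ → code c (proj₁ ξ , proj₂ (proj₂ ξ))
             ; bound = bound c
             ; ok    = λ γ ξ e → ok c _ _ (proj₁ e , proj₂ (proj₂ e)) }
      (λ i γ → cases (f i γ))
    where
    cases : ∀ {X Y : Set} {R : X → Value → Set} (x : Maybe X) {z : Y} {k v} → MaybeRep R x v →
            Split (z ≡ maybe′ k z x)
                  (λ u _ → Σ[ a ∈ X ] Σ[ _ ∈ ⊤ ] R a u × ⊤ × k a ≡ maybe′ k z x) v
    cases nothing  nothing  = isNil refl
    cases (just x) (just r) = isNode (x , tt , r , tt , refl)

  []ᶜ : Comp φ Γ (ListOf A) (λ _ _ → [])
  []ᶜ = const-nil (λ _ _ → [])

  infixr 5 _∷ᶜ_
  _∷ᶜ_ : {f : Spec φ Γ A} {g : Spec φ Γ (ListOf A)} → Comp φ Γ A f → Comp φ Γ (ListOf A) g →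
         Comp φ Γ (ListOf A) (λ i γ → f i γ ∷ g i γ)
  a ∷ᶜ b = node a b (λ _ _ → _∷_)

  listCaseᶜ : {f : Spec φ Γ (ListOf A)} {g : Spec φ Γ C} {h : Spec φ (A ∷ ListOf A ∷ Γ) C} →
              Comp φ Γ (ListOf A) f → Comp φ Γ C g → Comp φ (A ∷ ListOf A ∷ Γ) C h →
              Comp φ Γ C (λ i γ → listCase (g i γ) (λ x xs → h i (x , xs , γ)) (f i γ))
  listCaseᶜ {f = f} a b c = branch a b c (λ i γ → cases (f i γ))
    where
    cases : ∀ {X Y : Set} {R : X → Value → Set} (xs : List X) {z : Y} {k v} → ListRep R xs v →
            Split (z ≡ listCase z k xs)
                  (λ u w → Σ[ y ∈ X ] Σ[ ys ∈ List X ] R y u × ListRep R ys w × k y ys ≡ listCase z k xs) v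
    cases []       []      = isNil refl
    cases (x ∷ xs) (r ∷ s) = isNode (x , xs , r , s , refl)

  unboundedᶜ : {l : Len} {f : Spec φ Γ (ListUpTo l A)} → Comp φ Γ (ListUpTo l A) f → Comp φ Γ (ListOf A) f
  unboundedᶜ = conv (λ _ _ _ → proj₁)

  nullᶜ : {f : Spec φ Γ (ListOf A)} → Comp φ Γ (ListOf A) f → Comp φ Γ BoolT (λ i γ → List.null (f i γ))
  nullᶜ {f = f} a = by (λ i γ → eq (f i γ)) (listCaseᶜ a trueᶜ falseᶜ)
    where
    eq : ∀ {A : Set} (xs : List A) → listCase true (λ _ _ → false) xs ≡ List.null xs
    eq []      = refl
    eq (_ ∷ _) = refl

  headᶜ : {f : Spec φ Γ (ListOf A)} {g : Spec φ Γ A} → Comp φ Γ (ListOf A) f →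
          (∀ i γ → ∃[ xs ] f i γ ≡ g i γ ∷ xs) → Comp φ Γ A g
  headᶜ {φ = φ} {Γ = Γ} {A = A} {f} {g} a ne = record
    -- The `nil` in the branch for the empty list is a dummy, as `ne` excludes that branch.
    { code  = λ ξ → case (code a ξ) nil (var zero)
    ; bound = steps 2 ⊕ bound a
    ; ok    = go
    }
    where
    go : ∀ {m i B} {ρ : Vec Value m} γ ξ → Env φ ρ B Γ γ ξ →
         ρ ⊢ case (code a ξ) nil (var zero) ⇓ Rep A (g i γ) within _
    go {i = i} γ ξ e with f i γ | ok a γ ξ e | ne i γ
    ... | _ | returns {t = t} d (r ∷ _) t≤ | _ , refl = returns (case-∙ d (var zero)) r
      (≤-trans (≤-reflexive (cong suc (+-comm t 1))) (steps-ok 2 ⊕≤ t≤))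

-- The algorithm

record Instance : Set where
  field
    G   : Graph
    k   : ℕ
    X   : Subset (order G)
    1≤k : 1 ≤ k
    k≤n : k ≤ order G

module _ {A : Set} where
  -- The functions here are folds or `listCase`, the forms for which there are combinators, so that
  -- the program can follow them literally.
  select : (A → Bool) → List A → List A
  select p = foldr (λ x r → if p x then x ∷ r else r) []

  exists : (A → Bool) → List A → Bool
  exists p = foldr (λ x r → p x ∨ r) false

  first : {C : Set} → (A → Maybe C) → List A → Maybe C
  first f = foldr (λ x r → maybe′ just r (f x)) nothing

  tail : List A → List A
  tail = listCase [] (λ _ xs → xs)

  dropBy : {C : Set} → List C → List A → List A
  dropBy ys xs = foldr (λ _ r → tail r) xs ys

module Algorithm (i : Instance) where
  open Instance i public
  open Graph G using (adj) public

  n : ℕ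
  n = order G

  V : Set
  V = Fin n

  verts : List V
  verts = allFin n

  xs : List V
  xs = select (lookup X) verts

  _≈ᵇ_ : V → V → Bool
  u ≈ᵇ v = does (u Fin.≟ v)

  Labels Mask : Set
  Labels = V → V
  Mask   = V → Bool

  _∈ᵇ_ : V → List V → Bool
  v ∈ᵇ K = exists (v ≈ᵇ_) K

  neighbour : V → V
  neighbour v = foldr (λ z r → if adj v z then z else r) v verts

  -- If K contains X, then all neighbours of a vertex outside K lie in X, so `neighbour` leads to an
  -- element of K as soon as there is a neighbour at all.
  attach : List V → Labels
  attach K v = if v ∈ᵇ K then v else neighbour v

  outside : List V → Mask
  outside K v = not (v ∈ᵇ K)

  touches : Labels → V → V → Bool
  touches L v b = exists (λ u → adj v u ∧ (L u ≈ᵇ b)) verts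

  remove : V → List V → List V
  remove a = select (λ x → not (x ≈ᵇ a))

  members : Labels → V → List V
  members L c = select (λ v → L v ≈ᵇ c) verts

  -- The target size of a class is 1 + toℕ t.
  below above : V → Labels → V → Bool
  below t L c = List.null (List.drop (toℕ t) (members L c))
  above t L c = not (List.null (tail (List.drop (toℕ t) (members L c))))

  assign : Labels → V → V → Labels
  assign L v b w = if w ≈ᵇ v then b else L w

  candidate : Mask → Labels → V → V → Maybe V
  candidate M L a b = first (λ v → if M v ∧ ((L v ≈ᵇ a) ∧ touches L v b) then just v else nothing) verts

  -- The vertex moves before the chain is known to succeed; class a is then one short, and the
  -- recursive call has to make up for it. Classes are struck from U along the current chain only,
  -- so branches may revisit a class, which costs a factor depending on |X| alone.
  pullStep : V → Mask → (List V × V × Labels → Maybe Labels) → List V × V × Labels → Maybe Labels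
  pullStep t M rec (U , b , L) = first (λ a → maybe′
    (λ v → if above t L a then just (assign L v b) else rec (remove a U , a , assign L v b))
    nothing (candidate M L a b)) U

  -- Enlarge class b by one vertex, along a chain of moves starting in a class above the target.
  pull : V → Mask → List V → List V × V × Labels → Maybe Labels
  pull t M = recur (λ _ → nothing) (pullStep t M)

  enlarge : V → Mask → List V → V → Labels → Maybe Labels
  enlarge t M K c L = if below t L c then pull t M K (remove c K , c , L) else just L

  -- Each round enlarges a class that is still below the target, and a target is at most n. So n
  -- rounds suffice, whatever the initial size.
  fillClass : V → Mask → List V → V → Maybe Labels → Maybe Labels
  fillClass t M K c r = foldr (λ _ r → maybe′ (enlarge t M K c) nothing r) r verts

  fill : V → Mask → List V → Labels → Maybe Labels
  fill t M K L = foldr (fillClass t M K) (just L) K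

  position : List V → V → ℕ
  position K v = foldr (λ x r → if x ≈ᵇ v then 0 else suc r) 0 K

  output : List V → Labels → V → ℕ
  output K L v = position K (L v)

  State : Set
  State = List V × Labels × Mask

  finish : V → State → Maybe (V → ℕ)
  finish t (K , L , M) = maybe′ (λ L′ → just (output K L′)) nothing (fill t M K L)

  -- The vertices through which class a can be connected to another one: those fixed in it, and the
  -- free vertices with a neighbour in it, which are the possible helpers.
  core fringe : Labels → Mask → V → List V
  core   L M a = select (λ v → not (M v) ∧ (L v ≈ᵇ a)) verts
  fringe L M a = select (λ v → M v ∧ touches L v a) verts

  splitBy : V → List V → List (List V) → List (List V)
  splitBy x g r = select (λ v → adj v x) g ∷ select (λ v → not (adj v x)) g ∷ r

  refine : List (List V) × List V → List (List V) × List V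
  refine (gs , ys) = listCase (gs , []) (λ y zs → foldr (splitBy y) [] gs , zs) ys

  refineAll : List (List V) → List (List V) × List V
  refineAll gs = foldr (λ _ → refine) (gs , xs) xs

  -- The members of a group have the same neighbours in X.
  groups : Labels → Mask → V → List (List V)
  groups L M a = proj₁ (refineAll (core L M a ∷ fringe L M a ∷ []))

  joinable : Labels → V → V → V → Bool
  joinable L a u y = adj u y ∧ not (L y ≈ᵇ a)

  -- Put u into class a for good and merge class b into class a.
  join : State → V → V → V → State
  join (K , L , M) a u b = remove b K
    , (λ w → if w ≈ᵇ u then a else (if L w ≈ᵇ b then a else L w))
    , (λ w → M w ∧ not (w ≈ᵇ u))

  -- Only the head of a group is tried, as it can stand for the others; empty groups occur because a
  -- split keeps both parts. The vertex `y` may be sought in X: if only the other end of an edge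
  -- between two classes is in X, then the classes exchange their roles.
  searchStep : (State → Maybe (V → ℕ)) → State → Maybe (V → ℕ)
  searchStep rec s@(K , L , M) =
    first (λ a → first (λ g → listCase nothing (λ u _ →
      first (λ y → if joinable L a u y then rec (join s a u (L y)) else nothing) xs) g)
      (groups L M a)) K

  search : V → List V → State → Maybe (V → ℕ)
  search t = recur (finish t) searchStep

  start : List V → State
  start K = K , attach K , outside K

  units : List ⊤
  units = replicate k tt

  -- A right fold reaches the last entry first, so the targets are tried in descending order and the
  -- first success is kept.
  solve : Maybe (V → ℕ)
  solve = foldr (λ t r → maybe′ just (search t (dropBy units xs) (start xs)) r) nothing verts

  -- The vertices of X stand at the end and n - k vertices are dropped at the front, so X is among
  -- the k that remain when k > |X|.
  many : List V
  many = dropBy (dropBy units verts) (foldr _∷_ xs (select (λ v → not (lookup X v)) verts))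

  solution : V → ℕ
  solution = if List.null (dropBy xs units)
    -- The default is never taken, because the search for target 1 always succeeds.
    then maybe′ (λ r → r) (λ _ → 0) solve
    else output many (attach many)

-- Booleans, lists and counting

true-false : ∀ {A : Set} {b} → b ≡ true → b ≡ false → A
true-false refl ()

not-true : ∀ {b} → b ≢ true → b ≡ false
not-true {false} _ = refl
not-true {true}  h = contradiction refl h

not⁻ : ∀ {b} → not b ≡ true → b ≡ false
not⁻ {false} _ = refl

not⁺ : ∀ {b} → b ≡ false → not b ≡ true
not⁺ refl = refl

∧⁻ : ∀ {a b} → a ∧ b ≡ true → a ≡ true × b ≡ true
∧⁻ {true} {true} _ = refl , refl

∧⁺ : ∀ {a b} → a ≡ true → b ≡ true → a ∧ b ≡ true
∧⁺ refl refl = refl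

module _ {n : ℕ} {u v : Fin n} where

  ≟⁻ : does (u Fin.≟ v) ≡ true → u ≡ v
  ≟⁻ e with yes p ← u Fin.≟ v = p

  ≟⁺ : u ≡ v → does (u Fin.≟ v) ≡ true
  ≟⁺ p with u Fin.≟ v
  ... | yes _ = refl
  ... | no ¬p = contradiction p ¬p

  ≟-no : u ≢ v → does (u Fin.≟ v) ≡ false
  ≟-no p = not-true (λ e → p (≟⁻ e))

module _ {A : Set} where

  select⁻ : ∀ (p : A → Bool) ys {x} → x ∈ select p ys → x ∈ ys × p x ≡ true
  select⁻ p (y ∷ ys) h with p y in eq
  select⁻ p (y ∷ ys) (here refl) | true = here refl , eq
  select⁻ p (y ∷ ys) (there h)   | true with select⁻ p ys h
  ... | m , e = there m , e
  select⁻ p (y ∷ ys) h           | false with select⁻ p ys h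
  ... | m , e = there m , e

  select⁺ : ∀ (p : A → Bool) {ys x} → x ∈ ys → p x ≡ true → x ∈ select p ys
  select⁺ p {y ∷ ys} (here refl) e rewrite e = here refl
  select⁺ p {y ∷ ys} (there h)   e with p y
  ... | true  = there (select⁺ p h e)
  ... | false = select⁺ p h e

  select-unique : ∀ (p : A → Bool) {ys} → Unique ys → Unique (select p ys)
  select-unique p []             = []
  select-unique p {y ∷ ys} (n ∷ u) with p y
  ... | true  = All.tabulate (λ h → All.lookup n (proj₁ (select⁻ p ys h))) ∷ select-unique p u
  ... | false = select-unique p u

  length-select : ∀ (p : A → Bool) zs → length (select p zs) ≤ length zs
  length-select p []       = z≤n
  length-select p (z ∷ zs) with p z
  ... | true  = s≤s (length-select p zs)
  ... | false = m≤n⇒m≤1+n (length-select p zs)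

  select-shorter : ∀ (p : A → Bool) {ys x} → x ∈ ys → p x ≡ false → length (select p ys) < length ys
  select-shorter p {y ∷ ys} (here refl) e rewrite e = s≤s (length-select p ys)
  select-shorter p {y ∷ ys} (there h) e with p y
  ... | true  = s≤s (select-shorter p h e)
  ... | false = m≤n⇒m≤1+n (select-shorter p h e)

  exists⁻ : ∀ (p : A → Bool) ys → exists p ys ≡ true → ∃[ x ] x ∈ ys × p x ≡ true
  exists⁻ p (y ∷ ys) e with p y in eq
  ... | true  = y , here refl , eq
  ... | false with exists⁻ p ys e
  ...   | x , h , e′ = x , there h , e′

  exists⁺ : ∀ (p : A → Bool) {ys x} → x ∈ ys → p x ≡ true → exists p ys ≡ true
  exists⁺ p {y ∷ ys} (here refl) e rewrite e = refl
  exists⁺ p {y ∷ ys} (there h)   e with p y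
  ... | true  = refl
  ... | false = exists⁺ p h e

  module _ {C : Set} where

    first⁻ : ∀ (f : A → Maybe C) ys {c} → first f ys ≡ just c → ∃[ x ] x ∈ ys × f x ≡ just c
    first⁻ f (y ∷ ys) e with f y in eq
    first⁻ f (y ∷ ys) refl | just _ = y , here refl , eq
    ... | nothing with first⁻ f ys e
    ...   | x , h , e′ = x , there h , e′

    first-nothing : ∀ (f : A → Maybe C) {ys x} → first f ys ≡ nothing → x ∈ ys → f x ≡ nothing
    first-nothing f {y ∷ ys} e h with f y in eq
    first-nothing f {y ∷ ys} e (here refl) | nothing = eq
    first-nothing f {y ∷ ys} e (there h)   | nothing = first-nothing f e h

    first⁺ : ∀ (f : A → Maybe C) {ys x} → x ∈ ys → (∃[ c ] f x ≡ just c) → ∃[ c ] first f ys ≡ just c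
    first⁺ f {ys} h (_ , e) with first f ys in eq
    ... | just c  = c , refl
    ... | nothing with trans (sym e) (first-nothing f eq h)
    ...   | ()

𝟙 : Bool → ℕ
𝟙 b = if b then 1 else 0

♯ : ∀ {n} → (Fin n → Bool) → ℕ
♯ p = sum (λ v → 𝟙 (p v))

length-select-tabulate : ∀ {A : Set} {n} (p : A → Bool) (t : Fin n → A) →
                         length (select p (List.tabulate t)) ≡ ♯ (λ v → p (t v))
length-select-tabulate {n = zero}  p t = refl
length-select-tabulate {n = suc n} p t with p (t zero)
... | true  = cong suc (length-select-tabulate p (λ v → t (suc v)))
... | false = length-select-tabulate p (λ v → t (suc v))

∣∣-♯ : ∀ {n} (Y : Subset n) → ∣ Y ∣ ≡ ♯ (lookup Y)
∣∣-♯ []          = refl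
∣∣-♯ (true ∷ Y)  = cong suc (∣∣-♯ Y)
∣∣-♯ (false ∷ Y) = ∣∣-♯ Y

∣tabulate∣ : ∀ {n} (p : Fin n → Bool) → ∣ Vec.tabulate p ∣ ≡ ♯ p
∣tabulate∣ p = trans (∣∣-♯ (Vec.tabulate p)) (sum-cong-≗ (λ v → cong 𝟙 (lookup∘tabulate p v)))

sum-mono : ∀ {n} {f g : Fin n → ℕ} → (∀ v → f v ≤ g v) → sum f ≤ sum g
sum-mono {zero}  h = z≤n
sum-mono {suc n} h = +-mono-≤ (h zero) (sum-mono (λ v → h (suc v)))

sum-mono-< : ∀ {n} {f g : Fin n → ℕ} → (∀ v → f v ≤ g v) → ∀ v → f v < g v → sum f < sum g
sum-mono-< h zero    l = +-mono-<-≤ l (sum-mono (λ v → h (suc v)))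
sum-mono-< h (suc v) l = +-mono-≤-< (h zero) (sum-mono-< (λ v → h (suc v)) v l)

𝟙-mono : ∀ {a b} → (a ≡ true → b ≡ true) → 𝟙 a ≤ 𝟙 b
𝟙-mono {false}         h = z≤n
𝟙-mono {true}  {true}  h = ≤-refl
𝟙-mono {true}  {false} h with () ← h refl

module _ {n : ℕ} {p q : Fin n → Bool} where

  ♯-mono : (∀ v → p v ≡ true → q v ≡ true) → ♯ p ≤ ♯ q
  ♯-mono h = sum-mono (λ v → 𝟙-mono (h v))

  ♯-mono-< : (∀ v → p v ≡ true → q v ≡ true) → ∀ v → p v ≡ false → q v ≡ true → ♯ p < ♯ q
  ♯-mono-< h v e e′ = sum-mono-< (λ w → 𝟙-mono (h w)) v (strict e e′)
    where
    strict : ∀ {a b} → a ≡ false → b ≡ true → 𝟙 a < 𝟙 b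
    strict refl refl = s≤s z≤n

♯-all : ∀ {n} {p : Fin n → Bool} → ♯ p ≤ n
♯-all {zero}      = z≤n
♯-all {suc n} {p} with p zero
... | true  = s≤s ♯-all
... | false = m≤n⇒m≤1+n ♯-all

♯-none : ∀ {n} {p : Fin n → Bool} → (∀ v → p v ≡ false) → ♯ p ≡ 0
♯-none {zero}  h = refl
♯-none {suc n} h rewrite h zero = ♯-none (λ v → h (suc v))

♯-some : ∀ {n} {p : Fin n → Bool} v → p v ≡ true → 1 ≤ ♯ p
♯-some {n} {p} v e = ≤-trans (≤-reflexive (cong suc (sym (♯-none {n} {λ _ → false} (λ _ → refl)))))
                             (♯-mono-< (λ _ ()) v refl e)

♯-one : ∀ {n} {p : Fin n → Bool} → (∀ u v → p u ≡ true → p v ≡ true → u ≡ v) → ♯ p ≤ 1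
♯-one {zero}      h = z≤n
♯-one {suc n} {p} h with p zero in eq
... | true  = ≤-reflexive (cong suc (♯-none (λ v → not-true (λ e → Finₚ.0≢1+n (h zero (suc v) eq e)))))
... | false = ♯-one (λ u v e e′ → Finₚ.suc-injective (h (suc u) (suc v) e e′))

♯-except : ∀ {n} {p q : Fin n → Bool} w → (∀ v → v ≢ w → q v ≡ true → p v ≡ true) → ♯ q ≤ suc (♯ p)
♯-except {suc n} {p} {q} zero    h = begin
  𝟙 (q zero) + ♯ (λ v → q (suc v)) ≤⟨ +-mono-≤ (𝟙≤1 (q zero)) (♯-mono (λ v → h (suc v) (λ ()))) ⟩
  suc (♯ (λ v → p (suc v)))         ≤⟨ s≤s (m≤n+m _ (𝟙 (p zero))) ⟩
  suc (♯ p)                         ∎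
  where
  open ≤-Reasoning
  𝟙≤1 : ∀ b → 𝟙 b ≤ 1
  𝟙≤1 false = z≤n
  𝟙≤1 true  = ≤-refl
♯-except {suc n} {p} {q} (suc w) h = ≤-trans
  (+-mono-≤ (𝟙-mono (h zero (λ ()))) (♯-except w (λ v v≢ → h (suc v) (λ e → v≢ (Finₚ.suc-injective e)))))
  (≤-reflexive (+-suc (𝟙 (p zero)) _))

null-drop : ∀ {A : Set} a (ys : List A) → List.null (List.drop a ys) ≡ true → length ys ≤ a
null-drop zero    []       e = z≤n
null-drop (suc a) []       e = z≤n
null-drop (suc a) (_ ∷ ys) e = s≤s (null-drop a ys e)

null-drop-false : ∀ {A : Set} a (ys : List A) → List.null (List.drop a ys) ≡ false → a < length ys
null-drop-false zero    (_ ∷ ys) e = s≤s z≤n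
null-drop-false (suc a) (_ ∷ ys) e = s≤s (null-drop-false a ys e)

tail-drop : ∀ {A : Set} a (ys : List A) → tail (List.drop a ys) ≡ List.drop (suc a) ys
tail-drop zero    []       = refl
tail-drop zero    (_ ∷ _)  = refl
tail-drop (suc a) []       = refl
tail-drop (suc a) (_ ∷ ys) = tail-drop a ys

dropBy-drop : ∀ {A C : Set} (ys : List A) (zs : List C) → dropBy ys zs ≡ List.drop (length ys) zs
dropBy-drop []       zs = refl
dropBy-drop (_ ∷ ys) zs = trans (cong tail (dropBy-drop ys zs)) (tail-drop (length ys) zs)

length-dropBy : ∀ {A C : Set} (ys : List A) (zs : List C) → length (dropBy ys zs) ≡ length zs ∸ length ys
length-dropBy ys zs = trans (cong length (dropBy-drop ys zs)) (length-drop (length ys) zs)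

lookup-injective : ∀ {A : Set} {ys : List A} → Unique ys → ∀ i j → List.lookup ys i ≡ List.lookup ys j → i ≡ j
lookup-injective (_ ∷ _) zero    zero    e = refl
lookup-injective {ys = _ ∷ ys} (n ∷ _) zero    (suc j) e = contradiction e (All.lookup n (∈-lookup j))
lookup-injective {ys = _ ∷ ys} (n ∷ _) (suc i) zero    e = contradiction (sym e) (All.lookup n (∈-lookup i))
lookup-injective (_ ∷ u) (suc i) (suc j) e = cong suc (lookup-injective u i j e)

-- The program

module Implementation where

  private
    module A = Algorithm

  graphSize cover# : Instance → ℕ
  graphSize i = size (Instance.G i)
  cover# i = ∣ Instance.X i ∣

  order≤size : ∀ i → order (Instance.G i) ≤ graphSize i
  order≤size i = m≤m+n _ _

  graphSize>0 : ∀ i → 1 ≤ graphSize i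
  graphSize>0 i = ≤-trans (Instance.1≤k i) (≤-trans (Instance.k≤n i) (order≤size i))

  open Programs Instance graphSize cover# graphSize>0

  private
    variable
      φ : Oracle
      Γ : List Ty
      A C D : Ty
      l : Len

  VertexT : Ty
  Carrier VertexT     = A.V
  Rep     VertexT x v = v ≡ encodeℕ (toℕ x)

  NatT : Ty
  Carrier NatT _   = ℕ
  Rep     NatT a v = v ≡ encodeℕ a

  -- Functions on vertices are stored as tables. Reading an entry walks down the list, which costs
  -- only a factor linear in n.
  MapT : Ty → Ty
  Carrier (MapT A) i = A.V i → Carrier A i
  Rep     (MapT A) f = ListRep (Rep A) (List.tabulate f)

  linear covers : Len
  linear = con 1 , 1
  covers = par , 0

  linear-ok : ∀ {i a} → a ≤ A.n i → size≤ a linear i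
  linear-ok {i} a≤n = within (≤-trans a≤n (≤-trans (order≤size i)
    (≤-reflexive (trans (sym (*-identityʳ (graphSize i))) (sym (*-identityˡ (graphSize i * 1)))))))

  covers-ok : ∀ {i a} → a ≤ cover# i → size≤ a covers i
  covers-ok a≤ = within (≤-trans a≤ (≤-reflexive (sym (*-identityʳ _))))

  VertexListT CoverListT LabelsT MaskT : Ty
  VertexListT = ListUpTo linear VertexT
  CoverListT  = ListUpTo covers VertexT
  LabelsT     = MapT VertexT
  MaskT       = MapT BoolT

  -- The carrier is trivial because the instance determines what is represented.
  GlobalT : Ty
  Carrier GlobalT _         = ⊤
  Rep     GlobalT {i = i} _ = Rep (MapT MaskT ×ᵀ VertexListT ×ᵀ CoverListT) {i} (A.adj i , A.verts i , A.xs i)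

  module _ {g : Spec φ Γ GlobalT} (c : Comp φ Γ GlobalT g) where
    private
      all : Comp φ Γ (MapT MaskT ×ᵀ VertexListT ×ᵀ CoverListT) (λ i _ → A.adj i , A.verts i , A.xs i)
      all = conv (λ _ _ _ r → r) c

    adjacencyᶜ : Comp φ Γ (MapT MaskT) (λ i _ → A.adj i)
    adjacencyᶜ = fstᶜ all

    vertsᶜ : Comp φ Γ VertexListT (λ i _ → A.verts i)
    vertsᶜ = fstᶜ (sndᶜ all)

    xsᶜ : Comp φ Γ CoverListT (λ i _ → A.xs i)
    xsᶜ = sndᶜ (sndᶜ all)

  skip : {h : Spec φ (A ∷ Γ) C} → Comp φ (A ∷ Γ) C h →
         Comp φ (A ∷ D ∷ Γ) C (λ i γ → h i (proj₁ γ , proj₂ (proj₂ γ)))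
  skip c = record
    { code  = λ ξ → code c (proj₁ ξ , proj₂ (proj₂ ξ))
    ; bound = bound c
    ; ok    = λ γ ξ e → ok c _ _ (proj₁ e , proj₂ (proj₂ e))
    }

  module _ {l : Len} {loop : Loop φ (proj₂ l)} {f : Spec φ Γ (ListUpTo l A)} (c : Comp φ Γ (ListUpTo l A) f) where

    selectᶜ : {p : Spec φ (A ∷ Γ) BoolT} → Comp φ (A ∷ Γ) BoolT p →
              Comp φ Γ (ListUpTo l A) (λ i γ → select (λ x → p i (x , γ)) (f i γ))
    -- Binding the list puts its length bound into the environment, and from there `conv` takes the
    -- bound for the sublist.
    selectᶜ {p} d = c ⟩⟩ conv (λ γ _ e r → r ,
        within (≤-trans (length-select (λ x → p _ (x , proj₂ γ)) (proj₁ γ)) (size≤.length≤ (proj₂ (proj₁ e)))))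
        (fold {loop = loop} (# 0F) []ᶜ (ifᶜ (skip (skip d)) (# 0F ∷ᶜ # 1F) (# 1F)))

    existsᶜ : {p : Spec φ (A ∷ Γ) BoolT} → Comp φ (A ∷ Γ) BoolT p →
              Comp φ Γ BoolT (λ i γ → exists (λ x → p i (x , γ)) (f i γ))
    existsᶜ d = fold {loop = loop} c falseᶜ (skip d ∨ᶜ # 1F)

    firstᶜ : {h : Spec φ (A ∷ Γ) (MaybeT C)} → Comp φ (A ∷ Γ) (MaybeT C) h →
             Comp φ Γ (MaybeT C) (λ i γ → first (λ x → h i (x , γ)) (f i γ))
    firstᶜ d = fold {loop = loop} c nothingᶜ (maybeᶜ (skip d) (# 1F) (justᶜ (# 0F)))

  tailᶜ : {f : Spec φ Γ (ListOf A)} → Comp φ Γ (ListOf A) f → Comp φ Γ (ListOf A) (λ i γ → tail (f i γ))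
  tailᶜ c = listCaseᶜ c []ᶜ (# 1F)

  dropByᶜ : {f : Spec φ Γ (ListUpTo l A)} {g : Spec φ Γ (ListOf C)} {loop : Loop φ (proj₂ l)} →
            Comp φ Γ (ListUpTo l A) f → Comp φ Γ (ListOf C) g →
            Comp φ Γ (ListOf C) (λ i γ → dropBy (f i γ) (g i γ))
  dropByᶜ {loop = loop} c d = fold {loop = loop} c d (tailᶜ (# 1F))

  -- A unary number is a list of units, so `fold` can also repeat a step a given number of times.
  encodeℕ-rep : ∀ a → ListRep (λ _ v → v ≡ nil) (replicate a tt) (encodeℕ a)
  encodeℕ-rep zero    = []
  encodeℕ-rep (suc a) = refl ∷ encodeℕ-rep a

  asUnitsᶜ : {f : Spec φ Γ VertexT} → Comp φ Γ VertexT f →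
             Comp φ Γ (ListUpTo linear UnitT) (λ i γ → replicate (toℕ (f i γ)) tt)
  asUnitsᶜ {f = f} = conv λ { {i = i} γ _ _ refl → encodeℕ-rep (toℕ (f i γ)) ,
    linear-ok {i} (≤-trans (≤-reflexive (length-replicate (toℕ (f i γ)))) (<⇒≤ (toℕ<n (f i γ)))) }

  dropBy-replicate : ∀ {C : Set} a (ys : List C) → dropBy (replicate a tt) ys ≡ List.drop a ys
  dropBy-replicate a ys =
    trans (dropBy-drop (replicate a tt) ys) (cong (λ b → List.drop b ys) (length-replicate a))

  dropᶜ : {f : Spec nothing Γ VertexT} {g : Spec nothing Γ (ListOf C)} →
          Comp₀ Γ VertexT f → Comp₀ Γ (ListOf C) g →
          Comp₀ Γ (ListOf C) (λ i γ → List.drop (toℕ (f i γ)) (g i γ))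
  dropᶜ {f = f} {g = g} c d =
    by (λ i γ → dropBy-replicate (toℕ (f i γ)) (g i γ)) (dropByᶜ (asUnitsᶜ c) d)

  infixl 9 _!ᶜ_
  _!ᶜ_ : {f : Spec nothing Γ (MapT A)} {g : Spec nothing Γ VertexT} →
         Comp₀ Γ (MapT A) f → Comp₀ Γ VertexT g → Comp₀ Γ A (λ i γ → f i γ (g i γ))
  _!ᶜ_ {A = A} {f = f} {g} c d =
    headᶜ (dropᶜ {C = A} {g = λ i γ → List.tabulate (f i γ)} d (conv (λ _ _ _ r → r) c))
          (λ i γ → drop-tabulate (f i γ) (g i γ))
    where
    drop-tabulate : ∀ {X : Set} {n} (f : Fin n → X) (x : Fin n) →
                    ∃[ ys ] List.drop (toℕ x) (List.tabulate f) ≡ f x ∷ ys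
    drop-tabulate f zero    = _ , refl
    drop-tabulate f (suc x) = drop-tabulate (λ y → f (suc y)) x

  infix 4 _≈ᶜ_
  -- Unary numbers are compared by dropping: nothing is left of b entries after a are dropped
  -- exactly if b ≤ a. Equality is this test in both directions.
  _≈ᶜ_ : {f g : Spec nothing Γ VertexT} → Comp₀ Γ VertexT f → Comp₀ Γ VertexT g →
         Comp₀ Γ BoolT (λ i γ → A._≈ᵇ_ i (f i γ) (g i γ))
  _≈ᶜ_ {f = f} {g} c d = by (λ i γ → antisym (f i γ) (g i γ))
    (nullᶜ (dropᶜ c (unboundedᶜ (asUnitsᶜ d))) ∧ᶜ nullᶜ (dropᶜ d (unboundedᶜ (asUnitsᶜ c))))
    where
    leq : ℕ → ℕ → Bool
    leq a b = List.null (List.drop a (replicate b tt))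
    antisym : ∀ {n} (u v : Fin n) → leq (toℕ u) (toℕ v) ∧ leq (toℕ v) (toℕ u) ≡ does (u Fin.≟ v)
    antisym zero    zero    = refl
    antisym zero    (suc v) = refl
    antisym (suc u) zero    = refl
    antisym (suc u) (suc v) with u Fin.≟ v | antisym u v
    ... | yes _ | e = e
    ... | no  _ | e = e

  module _ {g : Spec nothing Γ GlobalT} (c : Comp₀ Γ GlobalT g) where

    mapᶜ : {h : Spec nothing (VertexT ∷ Γ) A} → Comp₀ (VertexT ∷ Γ) A h →
           Comp₀ Γ (MapT A) (λ i γ v → h i (v , γ))
    mapᶜ {A = A} {h = h} d = conv (λ {_} {i} γ _ _ {v} → subst (λ ys → ListRep (Rep A) ys v) (eq (λ x → h i (x , γ)) (λ x → x)))
      (fold (vertsᶜ c) []ᶜ (skip d ∷ᶜ # 1F))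
      where
      eq : ∀ {X Y : Set} {n} (f : X → Y) (t : Fin n → X) →
           foldr (λ x r → f x ∷ r) [] (List.tabulate t) ≡ List.tabulate (λ v → f (t v))
      eq {n = zero}  f t = refl
      eq {n = suc n} f t = cong (f (t zero) ∷_) (eq f (λ v → t (suc v)))

    adjᶜ : {f g : Spec nothing Γ VertexT} → Comp₀ Γ VertexT f → Comp₀ Γ VertexT g →
           Comp₀ Γ BoolT (λ i γ → A.adj i (f i γ) (g i γ))
    adjᶜ a b = adjacencyᶜ c !ᶜ a !ᶜ b

  touchesᶜ : Comp₀ (LabelsT ∷ VertexT ∷ VertexT ∷ GlobalT ∷ []) BoolT (λ i (L , v , b , _) → A.touches i L v b)
  touchesᶜ = existsᶜ (vertsᶜ (# 3F)) (adjᶜ (# 4F) (# 2F) (# 0F) ∧ᶜ (# 1F !ᶜ # 0F ≈ᶜ # 3F))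

  removeᶜ : Comp₀ (VertexT ∷ CoverListT ∷ []) CoverListT (λ i (a , K , _) → A.remove i a K)
  removeᶜ = selectᶜ (# 1F) (notᶜ (# 0F ≈ᶜ # 1F))

  membersᶜ : Comp₀ (LabelsT ∷ VertexT ∷ GlobalT ∷ []) VertexListT (λ i (L , c , _) → A.members i L c)
  membersᶜ = selectᶜ (vertsᶜ (# 2F)) (# 1F !ᶜ # 0F ≈ᶜ # 2F)

  belowᶜ : Comp₀ (VertexT ∷ LabelsT ∷ VertexT ∷ GlobalT ∷ []) BoolT (λ i (t , L , c , _) → A.below i t L c)
  belowᶜ = nullᶜ (dropᶜ (# 0F) (unboundedᶜ (call₃ (# 1F) (# 2F) (# 3F) membersᶜ)))

  aboveᶜ : Comp₀ (VertexT ∷ LabelsT ∷ VertexT ∷ GlobalT ∷ []) BoolT (λ i (t , L , c , _) → A.above i t L c)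
  aboveᶜ = notᶜ (nullᶜ (tailᶜ (dropᶜ (# 0F) (unboundedᶜ (call₃ (# 1F) (# 2F) (# 3F) membersᶜ)))))

  assignᶜ : Comp₀ (LabelsT ∷ VertexT ∷ VertexT ∷ GlobalT ∷ []) LabelsT (λ i (L , v , b , _) → A.assign i L v b)
  assignᶜ = mapᶜ (# 3F) (ifᶜ (# 0F ≈ᶜ # 2F) (# 3F) (# 1F !ᶜ # 0F))

  candidateᶜ : Comp₀ (MaskT ∷ LabelsT ∷ VertexT ∷ VertexT ∷ GlobalT ∷ []) (MaybeT VertexT)
                 (λ i (M , L , a , b , _) → A.candidate i M L a b)
  candidateᶜ = firstᶜ (vertsᶜ (# 4F))
    (ifᶜ (# 1F !ᶜ # 0F ∧ᶜ (# 2F !ᶜ # 0F ≈ᶜ # 3F) ∧ᶜ call₄ (# 2F) (# 0F) (# 4F) (# 5F) touchesᶜ)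
         (justᶜ (# 0F)) nothingᶜ)

  ChainT : Ty
  ChainT = CoverListT ×ᵀ VertexT ×ᵀ LabelsT

  pullᶜ : Comp₀ (VertexT ∷ MaskT ∷ CoverListT ∷ ChainT ∷ GlobalT ∷ []) (MaybeT LabelsT)
            (λ i (t , M , K , s , _) → A.pull i t M K s)
  pullᶜ = recursion (# 2F) (# 3F) nothingᶜ
    (firstᶜ (fstᶜ (# 0F))
      (maybeᶜ (call₅ (# 3F) (sndᶜ (sndᶜ (# 1F))) (# 0F) (fstᶜ (sndᶜ (# 1F))) (# 6F) candidateᶜ) nothingᶜ
        (call₄ (sndᶜ (sndᶜ (# 2F))) (# 0F) (fstᶜ (sndᶜ (# 2F))) (# 7F) assignᶜ
          ⟩⟩ ifᶜ (call₄ (# 4F) (sndᶜ (sndᶜ (# 3F))) (# 2F) (# 8F) aboveᶜ)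
                 (justᶜ (# 0F))
                 (self (call₂ (# 2F) (fstᶜ (# 3F)) removeᶜ ,ᶜ # 2F ,ᶜ # 0F)))))

  enlargeᶜ : Comp₀ (VertexT ∷ MaskT ∷ CoverListT ∷ VertexT ∷ LabelsT ∷ GlobalT ∷ []) (MaybeT LabelsT)
               (λ i (t , M , K , c , L , _) → A.enlarge i t M K c L)
  enlargeᶜ = ifᶜ (call₄ (# 0F) (# 4F) (# 3F) (# 5F) belowᶜ)
    (call₅ (# 0F) (# 1F) (# 2F) (call₂ (# 3F) (# 2F) removeᶜ ,ᶜ # 3F ,ᶜ # 4F) (# 5F) pullᶜ)
    (justᶜ (# 4F))

  fillᶜ : Comp₀ (VertexT ∷ MaskT ∷ CoverListT ∷ LabelsT ∷ GlobalT ∷ []) (MaybeT LabelsT)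
            (λ i (t , M , K , L , _) → A.fill i t M K L)
  fillᶜ = fold (# 2F) (justᶜ (# 3F))
    (fold (vertsᶜ (# 6F)) (# 1F)
      (maybeᶜ (# 1F) nothingᶜ
        (call₆ (# 5F) (# 6F) (# 7F) (# 3F) (# 0F) (# 9F) enlargeᶜ)))

  zeroᶜ : ∀ {Γ} → Comp₀ Γ NatT (λ _ _ → 0)
  zeroᶜ = const-nil (λ _ _ → refl)

  sucᶜ : ∀ {Γ} {f : Spec nothing Γ NatT} → Comp₀ Γ NatT f → Comp₀ Γ NatT (λ i γ → suc (f i γ))
  sucᶜ c = node {A = UnitT} (const-nil (λ _ _ → refl)) c (λ { _ _ refl refl → refl })

  positionᶜ : ∀ {l} → Comp₀ (ListUpTo l VertexT ∷ VertexT ∷ []) NatT (λ i (K , v , _) → A.position i K v)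
  positionᶜ = fold (# 0F) zeroᶜ (ifᶜ (# 0F ≈ᶜ # 3F) zeroᶜ (sucᶜ (# 1F)))

  outputᶜ : ∀ {l} → Comp₀ (ListUpTo l VertexT ∷ LabelsT ∷ GlobalT ∷ []) (MapT NatT) (λ i (K , L , _) → A.output i K L)
  outputᶜ = mapᶜ (# 2F) (call₂ (# 1F) (# 2F !ᶜ # 0F) positionᶜ)

  StateT : Ty
  StateT = CoverListT ×ᵀ LabelsT ×ᵀ MaskT

  finishᶜ : Comp₀ (VertexT ∷ StateT ∷ GlobalT ∷ []) (MaybeT (MapT NatT)) (λ i (t , s , _) → A.finish i t s)
  finishᶜ = maybeᶜ
    (call₅ (# 0F) (sndᶜ (sndᶜ (# 1F))) (fstᶜ (# 1F)) (fstᶜ (sndᶜ (# 1F))) (# 2F) fillᶜ)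
    nothingᶜ (justᶜ (call₃ (fstᶜ (# 2F)) (# 0F) (# 3F) outputᶜ))

  coreᶜ : Comp₀ (LabelsT ∷ MaskT ∷ VertexT ∷ GlobalT ∷ []) VertexListT (λ i (L , M , a , _) → A.core i L M a)
  coreᶜ = selectᶜ (vertsᶜ (# 3F)) (notᶜ (# 2F !ᶜ # 0F) ∧ᶜ (# 1F !ᶜ # 0F ≈ᶜ # 3F))

  fringeᶜ : Comp₀ (LabelsT ∷ MaskT ∷ VertexT ∷ GlobalT ∷ []) VertexListT (λ i (L , M , a , _) → A.fringe i L M a)
  fringeᶜ = selectᶜ (vertsᶜ (# 3F)) (# 2F !ᶜ # 0F ∧ᶜ call₄ (# 1F) (# 0F) (# 3F) (# 4F) touchesᶜ)

  groups# : Len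
  groups# = con 2 ⊠ con 2 ⊡ par , 0

  -- Splitting along one vertex of X at most doubles the number of groups; the second component holds
  -- the vertices of X still to be used.
  PartialGroupsT : Ty
  Carrier PartialGroupsT i = List (List (A.V i)) × List (A.V i)
  Rep     PartialGroupsT {i = i} p v =
    Rep (ListOf VertexListT ×ᵀ ListOf VertexT) {i} p v ×
    length (proj₁ p) * 2 ^ length (proj₂ p) ≤ 2 * 2 ^ cover# i

  splitByᶜ : Comp₀ (VertexT ∷ VertexListT ∷ ListOf VertexListT ∷ GlobalT ∷ []) (ListOf VertexListT)
               (λ i (x , g , r , _) → A.splitBy i x g r)
  splitByᶜ = selectᶜ (# 1F) (adjᶜ (# 4F) (# 0F) (# 1F))
    ∷ᶜ selectᶜ (# 1F) (notᶜ (adjᶜ (# 4F) (# 0F) (# 1F)))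
    ∷ᶜ # 2F

  fewGroups : ∀ i {a} b → a * 2 ^ b ≤ 2 * 2 ^ cover# i → size≤ a groups# i
  fewGroups i {a} b le = within (≤-trans (≤-trans (≤-reflexive (sym (*-identityʳ a)))
    (*-monoʳ-≤ a (m^n>0 2 b))) (≤-trans le (≤-reflexive (sym (*-identityʳ (2 * 2 ^ cover# i))))))

  refineᶜ : Comp₀ (PartialGroupsT ∷ GlobalT ∷ []) PartialGroupsT (λ i (p , _) → A.refine i p)
  refineᶜ = conv (λ {_} {i} γ _ e r → r , bounded i (proj₁ γ) (proj₂ (proj₁ e)))
    (listCaseᶜ (sndᶜ pairᶜ) (unboundedᶜ groupsᶜ ,ᶜ []ᶜ)
      (fold (wk (wk groupsᶜ)) []ᶜ (call₄ (# 2F) (# 0F) (# 1F) (# 5F) splitByᶜ) ,ᶜ # 1F))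
    where
    pairᶜ : Comp₀ (PartialGroupsT ∷ GlobalT ∷ []) (ListOf VertexListT ×ᵀ ListOf VertexT) (λ i → proj₁)
    pairᶜ = conv (λ _ _ _ → proj₁) (# 0F)
    groupsᶜ : Comp₀ (PartialGroupsT ∷ GlobalT ∷ []) (ListUpTo groups# VertexListT) (λ i γ → proj₁ (proj₁ γ))
    groupsᶜ = conv (λ {_} {i} γ _ e r → r , fewGroups i (length (proj₂ (proj₁ γ))) (proj₂ (proj₁ e))) (fstᶜ pairᶜ)
    doubles : ∀ i x gs → length (foldr (A.splitBy i x) [] gs) ≡ 2 * length gs
    doubles i x []       = refl
    doubles i x (g ∷ gs) = cong suc (trans (cong suc (doubles i x gs)) (sym (+-suc (length gs) (length gs + 0))))
    bounded : ∀ i p → length (proj₁ p) * 2 ^ length (proj₂ p) ≤ 2 * 2 ^ cover# i →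
              length (proj₁ (A.refine i p)) * 2 ^ length (proj₂ (A.refine i p)) ≤ 2 * 2 ^ cover# i
    bounded i (gs , [])     le = le
    bounded i (gs , x ∷ ys) le = ≤-trans (≤-reflexive (trans
      (cong (_* 2 ^ length ys) (trans (doubles i x gs) (*-comm 2 (length gs))))
      (*-assoc (length gs) 2 (2 ^ length ys)))) le

  length-xs : ∀ i → length (A.xs i) ≡ cover# i
  length-xs i = trans (length-select-tabulate (lookup (A.X i)) (λ v → v)) (sym (∣∣-♯ (A.X i)))

  groupsᶜ : Comp₀ (LabelsT ∷ MaskT ∷ VertexT ∷ GlobalT ∷ []) (ListUpTo groups# VertexListT)
              (λ i (L , M , a , _) → A.groups i L M a)
  groupsᶜ = refined ⟩⟩ conv (λ {_} {i} γ _ e r → r , fewGroups i (length (proj₂ (proj₁ γ))) (proj₂ (proj₁ e)))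
                           (fstᶜ (conv {C = ListOf VertexListT ×ᵀ ListOf VertexT} (λ _ _ _ → proj₁) (# 0F)))
    where
    initial : Comp₀ (LabelsT ∷ MaskT ∷ VertexT ∷ GlobalT ∷ []) PartialGroupsT
                (λ i (L , M , a , _) → (A.core i L M a ∷ A.fringe i L M a ∷ []) , A.xs i)
    initial = conv (λ {_} {i} γ _ e r → r , ≤-reflexive (cong (λ z → 2 * 2 ^ z) (length-xs i)))
      (coreᶜ ∷ᶜ fringeᶜ ∷ᶜ []ᶜ ,ᶜ unboundedᶜ (xsᶜ (# 3F)))
    refined : Comp₀ (LabelsT ∷ MaskT ∷ VertexT ∷ GlobalT ∷ []) PartialGroupsT
                (λ i (L , M , a , _) → A.refineAll i (A.core i L M a ∷ A.fringe i L M a ∷ []))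
    refined = fold (xsᶜ (# 3F)) initial (call₂ (# 1F) (# 5F) refineᶜ)

  joinableᶜ : Comp₀ (LabelsT ∷ VertexT ∷ VertexT ∷ VertexT ∷ GlobalT ∷ []) BoolT
                (λ i (L , a , u , y , _) → A.joinable i L a u y)
  joinableᶜ = adjᶜ (# 4F) (# 2F) (# 3F) ∧ᶜ notᶜ (# 0F !ᶜ # 3F ≈ᶜ # 1F)

  joinᶜ : Comp₀ (StateT ∷ VertexT ∷ VertexT ∷ VertexT ∷ GlobalT ∷ []) StateT
            (λ i (s , a , u , y , _) → A.join i s a u (proj₁ (proj₂ s) y))
  joinᶜ = (fstᶜ (sndᶜ (# 0F)) !ᶜ # 3F) ⟩⟩
    (call₂ (# 0F) (fstᶜ (# 1F)) removeᶜ
     ,ᶜ mapᶜ (# 5F) (ifᶜ (# 0F ≈ᶜ # 4F) (# 3F) (ifᶜ (fstᶜ (sndᶜ (# 2F)) !ᶜ # 0F ≈ᶜ # 1F) (# 3F) (fstᶜ (sndᶜ (# 2F)) !ᶜ # 0F)))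
     ,ᶜ mapᶜ (# 5F) (sndᶜ (sndᶜ (# 2F)) !ᶜ # 0F ∧ᶜ notᶜ (# 0F ≈ᶜ # 4F)))

  searchᶜ : Comp₀ (VertexT ∷ CoverListT ∷ StateT ∷ GlobalT ∷ []) (MaybeT (MapT NatT))
              (λ i (t , fuel , s , _) → A.search i t fuel s)
  searchᶜ = recursion (# 1F) (# 2F) (call₃ (# 1F) (# 0F) (# 4F) finishᶜ)
    (firstᶜ (fstᶜ (# 0F))
      (firstᶜ (call₄ (fstᶜ (sndᶜ (# 1F))) (sndᶜ (sndᶜ (# 1F))) (# 0F) (# 5F) groupsᶜ)
        (listCaseᶜ (unboundedᶜ (# 0F)) nothingᶜ
          (firstᶜ (xsᶜ (# 8F))
            (ifᶜ (call₅ (fstᶜ (sndᶜ (# 5F))) (# 4F) (# 1F) (# 0F) (# 9F) joinableᶜ)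
                 (self (call₅ (# 5F) (# 4F) (# 1F) (# 0F) (# 9F) joinᶜ))
                 nothingᶜ)))))

  elemᶜ : ∀ {l} → Comp₀ (VertexT ∷ ListUpTo l VertexT ∷ []) BoolT (λ i (v , K , _) → A._∈ᵇ_ i v K)
  elemᶜ = existsᶜ (# 1F) (# 1F ≈ᶜ # 0F)

  attachᶜ : ∀ {l} → Comp₀ (ListUpTo l VertexT ∷ GlobalT ∷ []) LabelsT (λ i (K , _) → A.attach i K)
  attachᶜ = mapᶜ (# 1F) (ifᶜ (call₂ (# 0F) (# 1F) elemᶜ) (# 0F)
    (fold (vertsᶜ (# 2F)) (# 0F) (ifᶜ (adjᶜ (# 4F) (# 2F) (# 0F)) (# 0F) (# 1F))))

  startᶜ : Comp₀ (CoverListT ∷ GlobalT ∷ []) StateT (λ i (K , _) → A.start i K)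
  startᶜ = # 0F ,ᶜ attachᶜ ,ᶜ mapᶜ (# 1F) (notᶜ (call₂ (# 0F) (# 1F) elemᶜ))

  TargetT : Ty
  Carrier TargetT _         = ⊤
  Rep     TargetT {i = i} _ = Rep (ListUpTo linear UnitT) {i} (A.units i)

  unitsᶜ : ∀ {φ Γ} {f : Spec φ Γ TargetT} → Comp φ Γ TargetT f →
           Comp φ Γ (ListUpTo linear UnitT) (λ i _ → A.units i)
  unitsᶜ = conv (λ _ _ _ r → r)

  dropBy-shorter : ∀ {A C : Set} (ys : List C) (zs : List A) → length (dropBy ys zs) ≤ length zs
  dropBy-shorter ys zs = ≤-trans (≤-reflexive (length-dropBy ys zs)) (m∸n≤m (length zs) (length ys))

  solveᶜ : Comp₀ (GlobalT ∷ TargetT ∷ []) (MaybeT (MapT NatT)) (λ i _ → A.solve i)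
  solveᶜ = fold (vertsᶜ (# 0F)) nothingᶜ
    (maybeᶜ (# 1F) (call₄ (# 0F) fuelᶜ (call₂ (xsᶜ (# 2F)) (# 2F) startᶜ) (# 2F) searchᶜ) (justᶜ (# 0F)))
    where
    fuelᶜ : Comp₀ (VertexT ∷ MaybeT (MapT NatT) ∷ GlobalT ∷ TargetT ∷ []) CoverListT (λ i _ → dropBy (A.units i) (A.xs i))
    fuelᶜ = conv (λ {_} {i} _ _ _ r → r ,
        covers-ok {i} (≤-trans (dropBy-shorter (A.units i) (A.xs i)) (≤-reflexive (length-xs i))))
                 (dropByᶜ (unitsᶜ (# 3F)) (unboundedᶜ (xsᶜ (# 2F))))

  CoverT : Ty
  Carrier CoverT _         = ⊤
  Rep     CoverT {i = i} _ = Rep MaskT {i} (lookup (A.X i))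

  coverᶜ : ∀ {φ Γ} {f : Spec φ Γ CoverT} → Comp φ Γ CoverT f → Comp φ Γ MaskT (λ i _ → lookup (A.X i))
  coverᶜ = conv (λ _ _ _ r → r)

  ManyT : Ty
  ManyT = ListUpTo (con 2 , 1) VertexT

  manyᶜ : Comp₀ (GlobalT ∷ TargetT ∷ CoverT ∷ []) ManyT (λ i _ → A.many i)
  manyᶜ = conv (λ {_} {i} _ _ _ r → r , bounded i)
    (dropByᶜ {l = linear} (conv {C = VertexListT} (λ {_} {i} _ _ _ r → r , droppedBound i)
        (dropByᶜ (unitsᶜ (# 1F)) (unboundedᶜ (vertsᶜ (# 0F)))))
      (fold (selectᶜ (vertsᶜ (# 0F)) (notᶜ (coverᶜ (# 3F) !ᶜ # 0F))) (unboundedᶜ (xsᶜ (# 0F))) (# 0F ∷ᶜ # 1F)))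
    where
    length-verts : ∀ i → length (A.verts i) ≡ A.n i
    length-verts i = length-tabulate (λ v → v)
    droppedBound : ∀ i → size≤ (length (dropBy (A.units i) (A.verts i))) linear i
    droppedBound i = linear-ok {i} (≤-trans (dropBy-shorter (A.units i) (A.verts i)) (≤-reflexive (length-verts i)))
    length-append : ∀ {A : Set} (ys zs : List A) → length (foldr _∷_ zs ys) ≡ length ys + length zs
    length-append []       zs = refl
    length-append (_ ∷ ys) zs = cong suc (length-append ys zs)
    bounded : ∀ i → size≤ (length (A.many i)) (con 2 , 1) i
    bounded i = within (begin
      length (A.many i) ≤⟨ dropBy-shorter (dropBy (A.units i) (A.verts i)) (foldr _∷_ (A.xs i) ys) ⟩
      length (foldr _∷_ (A.xs i) ys) ≡⟨ length-append ys (A.xs i) ⟩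
      length ys + length (A.xs i) ≤⟨ +-mono-≤ (atMost (λ v → not (lookup (A.X i) v))) (atMost (lookup (A.X i))) ⟩
      N + N ≡⟨ cong₂ _+_ (sym (*-identityʳ N)) (sym (trans (+-identityʳ (N * 1)) (*-identityʳ N))) ⟩
      2 * N ^ 1 ∎)
      where
      open ≤-Reasoning
      N = graphSize i
      ys = select (λ v → not (lookup (A.X i) v)) (A.verts i)
      atMost : ∀ p → length (select p (A.verts i)) ≤ N
      atMost p = ≤-trans (length-select p (A.verts i)) (≤-trans (≤-reflexive (length-verts i)) (order≤size i))

  solutionᶜ : Comp₀ (GlobalT ∷ TargetT ∷ CoverT ∷ []) (MapT NatT) (λ i _ → A.solution i)
  solutionᶜ = ifᶜ (nullᶜ (dropByᶜ (xsᶜ (# 0F)) (unboundedᶜ (unitsᶜ (# 1F)))))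
    (maybeᶜ (call₂ (# 0F) (# 1F) solveᶜ) (mapᶜ (# 0F) zeroᶜ) (# 0F))
    (manyᶜ ⟩⟩ call₃ (# 0F) (call₂ (# 0F) (# 1F) attachᶜ) (# 1F) outputᶜ)

  AdjacencyT : Ty
  Carrier AdjacencyT _         = ⊤
  Rep     AdjacencyT {i = i} _ = Rep (MapT MaskT) {i} (A.adj i)

  InputT : Ty
  Carrier InputT _           = ⊤
  Rep     InputT {i = i} _ v = v ≡ encodeInstance (A.G i) (A.k i) (A.X i)

  encodeVec-rep : ∀ {A : Set} {n} {R : A → Value → Set} {enc : A → Value} → (∀ x → R x (enc x)) →
                  (ys : Vec A n) → ListRep R (List.tabulate (lookup ys)) (encodeVec enc ys)
  encodeVec-rep r []       = []
  encodeVec-rep r (y ∷ ys) = r y ∷ encodeVec-rep r ys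

  tabulate-rep : ∀ {A C : Set} {n} {R : A → Value → Set} {enc : C → Value} (f : Fin n → A) (g : Fin n → C) →
                 (∀ v → R (f v) (enc (g v))) → ListRep R (List.tabulate f) (encodeVec enc (Vec.tabulate g))
  tabulate-rep {n = zero}  f g r = []
  tabulate-rep {n = suc n} f g r = r zero ∷ tabulate-rep (λ v → f (suc v)) (λ v → g (suc v)) (λ v → r (suc v))

  inputᶜ : ∀ {Γ} {f : Spec nothing Γ InputT} → Comp₀ Γ InputT f →
           Comp₀ Γ (AdjacencyT ×ᵀ TargetT ×ᵀ CoverT) (λ _ _ → tt , tt , tt)
  inputᶜ = conv λ { {i = i} _ _ _ refl →
    tabulate-rep (A.adj i) _ (λ u → tabulate-rep (A.adj i u) (A.adj i u) (λ _ → refl)) ,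
    (encodeℕ-rep (A.k i) , linear-ok {i} (≤-trans (≤-reflexive (length-replicate (A.k i))) (A.k≤n i))) ,
    encodeVec-rep (λ _ → refl) (A.X i) }

  -- The input contains no list of the vertices. Any list with n entries yields the number n, and
  -- each step prepends the predecessor of the current number, so 0, ..., n - 1 come out in
  -- ascending order.
  countDown : ∀ {A : Set} → List A → List (List ⊤) × List ⊤
  countDown zs = foldr (λ _ p → tail (proj₂ p) ∷ proj₁ p , tail (proj₂ p)) ([] , foldr (λ _ r → tt ∷ r) [] zs) zs

  countDown-correct : ∀ {A : Set} (zs : List A) →
                      proj₁ (countDown zs) ≡ List.applyUpTo (λ t → replicate t tt) (length zs)
  countDown-correct zs =
    trans (cong proj₁ (trans (cong (λ u → foldr step ([] , u) zs) (all zs)) (loop zs ≤-refl)))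
          (cong (λ a → List.applyUpTo (λ t → replicate (a + t) tt) (length zs)) (n∸n≡0 (length zs)))
    where
    N : ℕ
    N = length zs
    step : ∀ {A : Set} → A → List (List ⊤) × List ⊤ → List (List ⊤) × List ⊤
    step _ p = tail (proj₂ p) ∷ proj₁ p , tail (proj₂ p)
    all : ∀ {A : Set} (ys : List A) → foldr (λ _ r → tt ∷ r) [] ys ≡ replicate (length ys) tt
    all []       = refl
    all (_ ∷ ys) = cong (tt ∷_) (all ys)
    applyUpTo-cong : ∀ {f g : ℕ → List ⊤} → (∀ t → f t ≡ g t) → ∀ a → List.applyUpTo f a ≡ List.applyUpTo g a
    applyUpTo-cong e zero    = refl
    applyUpTo-cong e (suc a) = cong₂ _∷_ (e 0) (applyUpTo-cong (λ t → e (suc t)) a)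
    loop : ∀ {A : Set} (ys : List A) → length ys ≤ N →
           foldr step ([] , replicate N tt) ys ≡
           (List.applyUpTo (λ t → replicate (N ∸ length ys + t) tt) (length ys) , replicate (N ∸ length ys) tt)
    loop []       _  = refl
    loop (_ ∷ ys) le rewrite loop ys (≤-trans (n≤1+n _) le) =
      cong₂ _,_ (cong₂ _∷_ (trans shorter (cong (λ a → replicate a tt) (sym (+-identityʳ _))))
                  (applyUpTo-cong (λ t → cong (λ a → replicate a tt)
                    (trans (cong (_+ t) (sym drop)) (sym (+-suc _ t)))) (length ys))) shorter
      where
      drop : suc (N ∸ suc (length ys)) ≡ N ∸ length ys
      drop = sym (+-∸-assoc 1 le)
      shorter : tail (replicate (N ∸ length ys) tt) ≡ replicate (N ∸ suc (length ys)) tt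
      shorter = cong (λ a → tail (replicate a tt)) (sym drop)

  vertices-rep : ∀ {n m} (g : Fin n → Fin m) (f : ℕ → ℕ) → (∀ v → toℕ (g v) ≡ f (toℕ v)) → ∀ {v} →
                 ListRep (ListRep (λ _ w → w ≡ nil)) (List.applyUpTo (λ t → replicate (f t) tt) n) v →
                 ListRep (λ x w → w ≡ encodeℕ (toℕ x)) (List.tabulate g) v
  vertices-rep {zero}  g f eq []       = []
  vertices-rep {suc n} g f eq (r ∷ rs) = trans (unary (f 0) r) (cong encodeℕ (sym (eq zero)))
    ∷ vertices-rep (λ v → g (suc v)) (λ t → f (suc t)) (λ v → eq (suc v)) rs
    where
    unary : ∀ a {w} → ListRep (λ _ w → w ≡ nil) (replicate a tt) w → w ≡ encodeℕ a
    unary zero    []         = refl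
    unary (suc a) (refl ∷ r) = cong (nil ∙_) (unary a r)

  allVerticesᶜ : Comp₀ (CoverT ∷ []) VertexListT (λ i _ → A.verts i)
  allVerticesᶜ = conv (λ {_} {i} _ _ _ r → correct i r , linear-ok {i} (≤-reflexive (length-tabulate (λ v → v))))
    (fstᶜ (fold slots ([]ᶜ ,ᶜ fold slots []ᶜ (unitᶜ ∷ᶜ # 1F))
      ((tailᶜ (sndᶜ (# 1F)) ∷ᶜ fstᶜ (# 1F)) ,ᶜ tailᶜ (sndᶜ (# 1F)))))
    where
    unitᶜ : ∀ {Γ} → Comp₀ Γ UnitT (λ _ _ → tt)
    unitᶜ = const-nil (λ _ _ → refl)
    slots : Comp₀ (CoverT ∷ []) (ListUpTo linear BoolT) (λ i _ → List.tabulate (lookup (A.X i)))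
    slots = conv (λ {_} {i} _ _ _ r → r , linear-ok {i} (≤-reflexive (length-tabulate (lookup (A.X i))))) (# 0F)
    correct : ∀ i {v} → ListRep (ListRep (λ _ w → w ≡ nil)) (proj₁ (countDown (List.tabulate (lookup (A.X i))))) v →
              ListRep (λ x w → w ≡ encodeℕ (toℕ x)) (A.verts i) v
    correct i {v} r = vertices-rep (λ x → x) (λ t → t) (λ _ → refl)
      (subst (λ ys → ListRep (ListRep (λ _ w → w ≡ nil)) ys v)
        (trans (countDown-correct (List.tabulate (lookup (A.X i))))
               (cong (List.applyUpTo (λ t → replicate t tt)) (length-tabulate (lookup (A.X i))))) r)

  globalᶜ : Comp₀ (AdjacencyT ∷ CoverT ∷ []) GlobalT (λ _ _ → tt)
  globalᶜ = conv (λ _ _ _ r → r) (adjacency ,ᶜ call₁ (# 1F) allVerticesᶜ ,ᶜ call₁ (# 1F) coverListᶜ)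
    where
    adjacency : Comp₀ (AdjacencyT ∷ CoverT ∷ []) (MapT MaskT) (λ i _ → A.adj i)
    adjacency = conv (λ _ _ _ r → r) (# 0F)
    coverListᶜ : Comp₀ (CoverT ∷ []) CoverListT (λ i _ → A.xs i)
    coverListᶜ = conv (λ {_} {i} _ _ _ r → proj₁ r , covers-ok {i} (≤-reflexive (length-xs i)))
      (selectᶜ allVerticesᶜ (coverᶜ (# 1F) !ᶜ # 0F))

  mainᶜ : Comp₀ (InputT ∷ []) (MapT NatT) (λ i _ → A.solution i)
  mainᶜ = inputᶜ (# 0F) ⟩⟩ call₂ (fstᶜ (# 0F)) (sndᶜ (sndᶜ (# 0F))) globalᶜ
    ⟩⟩ call₃ (# 0F) (fstᶜ (sndᶜ (# 1F))) (sndᶜ (sndᶜ (# 1F))) solutionᶜ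

-- Correctness

module Correct (i : Instance) (cover : VertexCover (Instance.G i) (Instance.X i)) where
  open Algorithm i

  InX : V → Set
  InX v = lookup X v ≡ true

  E : V → V → Set
  E u v = adj u v ≡ true

  E-sym : ∀ {u v} → E u v → E v u
  E-sym e = Equivalence.to T-≡ (Graph.adj-sym G (Equivalence.from T-≡ e))

  covered : ∀ {u v} → E u v → InX u ⊎ InX v
  covered e with cover (Equivalence.from T-≡ e)
  ... | inj₁ h = inj₁ ([]=⇒lookup h)
  ... | inj₂ h = inj₂ ([]=⇒lookup h)

  classSize : Labels → V → ℕ
  classSize L c = ♯ (λ v → L v ≈ᵇ c)

  length-members : ∀ L c → length (members L c) ≡ classSize L c
  length-members L c = length-select-tabulate (λ v → L v ≈ᵇ c) (λ v → v)

  module _ {t : V} {L : Labels} {c : V} where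

    below⁻ : below t L c ≡ true → classSize L c ≤ toℕ t
    below⁻ e = subst (_≤ toℕ t) (length-members L c) (null-drop (toℕ t) (members L c) e)

    ¬below⁻ : below t L c ≡ false → toℕ t < classSize L c
    ¬below⁻ e = subst (toℕ t <_) (length-members L c) (null-drop-false (toℕ t) (members L c) e)

    above⁻ : above t L c ≡ true → suc (toℕ t) < classSize L c
    above⁻ e = subst (suc (toℕ t) <_) (length-members L c) (null-drop-false (suc (toℕ t)) (members L c)
      (trans (cong List.null (sym (tail-drop (toℕ t) (members L c)))) (not⁻ e)))

    ¬above⁻ : above t L c ≡ false → classSize L c ≤ suc (toℕ t)
    ¬above⁻ e = subst (_≤ suc (toℕ t)) (length-members L c) (null-drop (suc (toℕ t)) (members L c)
      (trans (cong List.null (sym (tail-drop (toℕ t) (members L c)))) (unnot e)))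
      where
      unnot : ∀ {b} → not b ≡ false → b ≡ true
      unnot {true} _ = refl

  touches⁻ : ∀ {L v b} → touches L v b ≡ true → ∃[ u ] E v u × L u ≡ b
  touches⁻ {L} {v} {b} e with exists⁻ (λ u → adj v u ∧ (L u ≈ᵇ b)) verts e
  ... | u , _ , e′ = u , proj₁ (∧⁻ e′) , ≟⁻ (proj₂ (∧⁻ {adj v u} e′))

  touches⁺ : ∀ {L v b} u → E v u → L u ≡ b → touches L v b ≡ true
  touches⁺ {L} {v} {b} u e l = exists⁺ (λ u → adj v u ∧ (L u ≈ᵇ b)) (∈-allFin u) (∧⁺ e (≟⁺ l))

  Movable : Mask → Labels → V → V → V → Set
  Movable M L a b v = M v ≡ true × L v ≡ a × ∃[ u ] E v u × L u ≡ b

  private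
    test : Mask → Labels → V → V → V → Bool
    test M L a b v = M v ∧ ((L v ≈ᵇ a) ∧ touches L v b)

    test⁺ : ∀ {M L a b v} → Movable M L a b v → test M L a b v ≡ true
    test⁺ {M} {L} {a} {b} {v} (m , l , u , e , l′) = ∧⁺ m (∧⁺ (≟⁺ l) (touches⁺ {L} {v} {b} u e l′))

  candidate⁻ : ∀ {M L a b v} → candidate M L a b ≡ just v → Movable M L a b v
  candidate⁻ {M} {L} {a} {b} e with first⁻ (λ v → if test M L a b v then just v else nothing) verts e
  ... | w , _ , e′ with test M L a b w in eq
  candidate⁻ {M} {L} {a} {b} e | w , _ , refl | true =
    proj₁ (∧⁻ eq) , ≟⁻ (proj₁ rest) , touches⁻ {L} {w} {b} (proj₂ rest)
    where
    rest : (L w ≈ᵇ a) ≡ true × touches L w b ≡ true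
    rest = ∧⁻ (proj₂ (∧⁻ {M w} eq))

  candidate-nothing : ∀ {M L a b v} → candidate M L a b ≡ nothing → ¬ Movable M L a b v
  candidate-nothing {M} {L} {a} {b} {v} e m
    with first-nothing (λ v → if test M L a b v then just v else nothing) e (∈-allFin v)
  ... | e′ with trans (sym (cong (λ c → if c then just v else nothing) (test⁺ {M} {L} {a} {b} m))) e′
  ... | ()

  module _ {L : Labels} {v b : V} where

    assign-at : assign L v b v ≡ b
    assign-at rewrite ≟⁺ {u = v} refl = refl

    assign-other : ∀ {w} → w ≢ v → assign L v b w ≡ L w
    assign-other w≢v rewrite ≟-no w≢v = refl

  remove⁻ : ∀ {a K x} → x ∈ remove a K → x ∈ K × x ≢ a
  remove⁻ {a} {K} h with select⁻ (λ x → not (x ≈ᵇ a)) K h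
  ... | m , e = m , λ p → true-false (≟⁺ p) (not⁻ e)

  remove⁺ : ∀ {a K x} → x ∈ K → x ≢ a → x ∈ remove a K
  remove⁺ {a} {K} h x≢a = select⁺ (λ x → not (x ≈ᵇ a)) h (not⁺ (≟-no x≢a))

  ∈ᵇ⁻ : ∀ K {v} → (v ∈ᵇ K) ≡ true → v ∈ K
  ∈ᵇ⁻ K {v} e with exists⁻ (v ≈ᵇ_) K e
  ... | x , x∈K , e′ with ≟⁻ {u = v} e′
  ...   | refl = x∈K

  ∈ᵇ⁺ : ∀ {K v} → v ∈ K → (v ∈ᵇ K) ≡ true
  ∈ᵇ⁺ {v = v} h = exists⁺ (v ≈ᵇ_) h (≟⁺ {u = v} refl)

  record CoreStep (L : Labels) (M : Mask) (u v : V) : Set where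
    constructor step
    field
      edge  : E u v
      coreˡ : M u ≡ false
      coreʳ : M v ≡ false
      same  : L u ≡ L v

  core-sym : ∀ {L M u v} → CoreStep L M u v → CoreStep L M v u
  core-sym (step e m m′ l) = step (E-sym e) m′ m (sym l)

  -- K lists the roots of the classes and L sends a vertex to the root of its class.  The vertices that
  -- are not free (M) connect each class already; the free ones lie outside X and can be moved.
  record Valid (K : List V) (L : Labels) (M : Mask) : Set where
    field
      unique   : Unique K
      root     : ∀ {a} → a ∈ K → L a ≡ a × M a ≡ false
      label    : ∀ v → L v ∈ K
      anchored : ∀ {v} → M v ≡ true → lookup X v ≡ false × ∃[ z ] InX z × E v z × L z ≡ L v
      linked   : ∀ {v} → M v ≡ false → Star (CoreStep L M) v (L v)

    X-core : ∀ {x} → InX x → M x ≡ false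
    X-core h = not-true (λ m → true-false h (proj₁ (anchored m)))

    free-neighbour : ∀ {v u} → M v ≡ true → E v u → InX u
    free-neighbour m e with covered e
    ... | inj₁ h = true-false h (proj₁ (anchored m))
    ... | inj₂ h = h

  module _ {K L M} (valid : Valid K L M) where
    open Valid valid

    -- Only a free vertex changes its label, so core paths and the anchors in X survive. The new
    -- anchor of v is the neighbour that permitted the move; it lies in X, as every neighbour of a
    -- free vertex does.
    assign-valid : ∀ {a b v} → b ∈ K → Movable M L a b v → Valid K (assign L v b) M
    assign-valid {a} {b} {v} b∈K (free , _ , u , e , Lu) = record
      { unique   = unique
      ; root     = λ r∈K → trans (fixed (proj₂ (root r∈K))) (proj₁ (root r∈K)) , proj₂ (root r∈K)
      ; label    = label′
      ; anchored = anchored′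
      ; linked   = λ {w} m → subst (Star _ w) (sym (fixed m)) (Star.map core-step (linked m))
      }
      where
      fixed : ∀ {w} → M w ≡ false → assign L v b w ≡ L w
      fixed {w} m = assign-other {L} {v} {b} {w} (λ { refl → true-false free m })
      label′ : ∀ w → assign L v b w ∈ K
      label′ w with w Fin.≟ v
      ... | yes _ = b∈K
      ... | no  _ = label w
      anchored′ : ∀ {w} → M w ≡ true →
                  lookup X w ≡ false × ∃[ z ] InX z × E w z × assign L v b z ≡ assign L v b w
      anchored′ {w} m with w Fin.≟ v
      ... | yes refl = proj₁ (anchored m) , u , free-neighbour m e , e ,
                       trans (fixed (X-core (free-neighbour m e))) Lu
      ... | no  _    with anchored m
      ...   | w∉X , z , z∈X , ez , Lz = w∉X , z , z∈X , ez , trans (fixed (X-core z∈X)) Lz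
      core-step : ∀ {x y} → CoreStep L M x y → CoreStep (assign L v b) M x y
      core-step (step e m m′ l) = step e m m′ (trans (fixed m) (trans l (sym (fixed m′))))

  Joins : Labels → Mask → V → V → Set
  Joins L M a u = (M u ≡ false × L u ≡ a) ⊎ (M u ≡ true × ∃[ z ] E u z × L z ≡ a)

  ValidState : State → Set
  ValidState (K , L , M) = Valid K L M

  module Joining {K L M} (valid : Valid K L M) {a u y : V} (a∈K : a ∈ K) (joins : Joins L M a u)
                 (y∈X : InX y) (uy : E u y) (Ly≢a : L y ≢ a) where
    open Valid valid

    b : V
    b = L y

    L′ : Labels
    L′ = proj₁ (proj₂ (join (K , L , M) a u b))

    M′ : Mask
    M′ = proj₂ (proj₂ (join (K , L , M) a u b))

    merge : V → V
    merge c = if c ≈ᵇ b then a else c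

    merge-b : merge b ≡ a
    merge-b rewrite ≟⁺ {u = b} refl = refl

    merge-other : ∀ {c} → c ≢ b → merge c ≡ c
    merge-other c≢b rewrite ≟-no c≢b = refl

    at-u : L′ u ≡ a
    at-u rewrite ≟⁺ {u = u} refl = refl

    elsewhere : ∀ {w} → w ≢ u → L′ w ≡ merge (L w)
    elsewhere w≢u rewrite ≟-no w≢u = refl

    -- The exceptional vertex `u` obeys the rule too if it was fixed before: its label was then `a`,
    -- which differs from `b`.
    fixed : ∀ {w} → M w ≡ false → L′ w ≡ merge (L w)
    fixed {w} m with w Fin.≟ u
    ... | no  _    = refl
    ... | yes refl = go joins
      where
      go : Joins L M a u → a ≡ merge (L u)
      go (inj₁ (_ , Lu)) = sym (trans (cong merge Lu) (merge-other (λ e → Ly≢a (sym e))))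
      go (inj₂ (m′ , _)) = true-false m′ m

    still-core : ∀ {w} → M w ≡ false → M′ w ≡ false
    still-core m rewrite m = refl

    u-core : M′ u ≡ false
    u-core with M u
    ... | false = refl
    ... | true  rewrite ≟⁺ {u = u} refl = refl

    free⁻ : ∀ {w} → M′ w ≡ true → M w ≡ true × w ≢ u
    free⁻ {w} e = proj₁ (∧⁻ e) , λ p → true-false (≟⁺ p) (not⁻ (proj₂ (∧⁻ {M w} e)))

    core-step : ∀ {x y} → CoreStep L M x y → CoreStep L′ M′ x y
    core-step (step e m m′ l) =
      step e (still-core m) (still-core m′) (trans (fixed m) (trans (cong merge l) (sym (fixed m′))))

    path : ∀ {x} → M x ≡ false → Star (CoreStep L′ M′) x (L x)
    path m = Star.map core-step (linked m)

    u⇝a : Star (CoreStep L′ M′) u a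
    u⇝a = go joins
      where
      go : Joins L M a u → Star (CoreStep L′ M′) u a
      go (inj₁ (m , Lu)) = subst (Star _ u) Lu (path m)
      go (inj₂ (m , z , e , Lz)) =
        step e u-core (still-core zm)
             (trans at-u (sym (trans (fixed zm) (trans (cong merge Lz) (merge-other (λ e → Ly≢a (sym e)))))))
        ◅ subst (Star _ z) Lz (path zm)
        where
        zm : M z ≡ false
        zm = X-core (free-neighbour m e)

    -- The two old classes meet in the edge between `y` and `u`: the path goes from `b` back to `y`,
    -- across, and on to `a`.
    b⇝a : Star (CoreStep L′ M′) b a
    b⇝a = Star.reverse core-sym (path (X-core y∈X)) ◅◅
          step (E-sym uy) (still-core (X-core y∈X)) u-core (trans (fixed (X-core y∈X)) (trans merge-b (sym at-u))) ◅ u⇝a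

    join-valid : ValidState (join (K , L , M) a u b)
    join-valid = record
      { unique   = select-unique (λ x → not (x ≈ᵇ b)) unique
      ; root     = root′
      ; label    = label′
      ; anchored = anchored′
      ; linked   = linked′
      }
      where
      root′ : ∀ {r} → r ∈ remove b K → L′ r ≡ r × M′ r ≡ false
      root′ h with remove⁻ {K = K} h
      ... | r∈K , r≢b with root r∈K
      ...   | Lr , m = trans (fixed m) (trans (cong merge Lr) (merge-other r≢b)) , still-core m
      a∈ : a ∈ remove b K
      a∈ = remove⁺ a∈K (λ e → Ly≢a (sym e))
      label′ : ∀ w → L′ w ∈ remove b K
      label′ w with w Fin.≟ u
      ... | yes _ = a∈
      ... | no  _ with L w Fin.≟ b
      ...   | yes _ = a∈
      ...   | no ≢b = remove⁺ (label w) ≢b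
      anchored′ : ∀ {w} → M′ w ≡ true → lookup X w ≡ false × ∃[ z ] InX z × E w z × L′ z ≡ L′ w
      anchored′ m′ with free⁻ m′
      ... | m , w≢u with anchored m
      ...   | w∉X , z , z∈X , e , Lz =
        w∉X , z , z∈X , e , trans (fixed (X-core z∈X)) (trans (cong merge Lz) (sym (elsewhere w≢u)))
      linked′ : ∀ {w} → M′ w ≡ false → Star (CoreStep L′ M′) w (L′ w)
      old-core : ∀ {w} → M′ w ≡ false → w ≢ u → M w ≡ false
      old-core m′ w≢u = not-true (λ m → true-false (∧⁺ m (not⁺ (≟-no w≢u))) m′)
      linked′ {w} m′ with w Fin.≟ u | old-core {w} m′
      ... | yes refl | _ = u⇝a
      ... | no  w≢u  | old with L w Fin.≟ b
      ...   | yes Lw≡b = subst (Star _ w) Lw≡b (path (old w≢u)) ◅◅ b⇝a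
      ...   | no  _    = path (old w≢u)

-- Raising all classes to the target size

module Filling (i : Instance) (cover : VertexCover (Instance.G i) (Instance.X i)) where
  open Algorithm i
  open Correct i cover

  module _ {L : Labels} {a b v : V} (Lv : L v ≡ a) (a≢b : a ≢ b) where

    private
      same : ∀ {w} → w ≢ v → assign L v b w ≡ L w
      same = assign-other {L} {v} {b}

      at : assign L v b v ≡ b
      at = assign-at {L} {v} {b}

    assign-target : suc (classSize L b) ≤ classSize (assign L v b) b
    assign-target = ♯-mono-< keeps v (≟-no (λ e → a≢b (trans (sym Lv) e))) (≟⁺ at)
      where
      keeps : ∀ w → (L w ≈ᵇ b) ≡ true → (assign L v b w ≈ᵇ b) ≡ true
      keeps w e with w Fin.≟ v
      ... | yes _ = ≟⁺ {u = b} refl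
      ... | no  _ = e

    assign-source : classSize L a ≤ suc (classSize (assign L v b) a)
    assign-source = ♯-except v (λ w w≢v e → ≟⁺ (trans (same w≢v) (≟⁻ e)))

    assign-source-< : classSize (assign L v b) a < classSize L a
    assign-source-< = ♯-mono-< keeps v (≟-no (λ e → a≢b (sym (trans (sym at) e)))) (≟⁺ Lv)
      where
      keeps : ∀ w → (assign L v b w ≈ᵇ a) ≡ true → (L w ≈ᵇ a) ≡ true
      keeps w e with w Fin.≟ v
      ... | yes refl = ≟⁺ Lv
      ... | no  _    = e

    assign-elsewhere : ∀ {c} → c ≢ a → classSize L c ≤ classSize (assign L v b) c
    assign-elsewhere {c} c≢a = ♯-mono keeps
      where
      keeps : ∀ w → (L w ≈ᵇ c) ≡ true → (assign L v b w ≈ᵇ c) ≡ true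
      keeps w e = ≟⁺ (trans (same (λ { refl → c≢a (trans (sym (≟⁻ e)) Lv) })) (≟⁻ e))

  module _ (K : List V) (M : Mask) (t : V) where

    private
      target : ℕ
      target = suc (toℕ t)

    -- Classes below the target do not shrink, no class falls below the target, and only free vertices move.
    _⊑_ : Labels → Labels → Set
    L ⊑ L′ = (∀ c → classSize L c ⊓ target ≤ classSize L′ c) × (∀ {v} → M v ≡ false → L′ v ≡ L v)

    ⊑-refl : ∀ L → L ⊑ L
    ⊑-refl L = (λ c → m⊓n≤m _ _) , λ _ → refl

    ⊑-trans : ∀ {L L′ L″} → L ⊑ L′ → L′ ⊑ L″ → L ⊑ L″
    ⊑-trans (p , p′) (q , q′) = (λ c → ≤-trans (⊓-glb (p c) (m⊓n≤n _ target)) (q c)) , λ m → trans (q′ m) (p′ m)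

    assign-core : ∀ {L a b v} → Movable M L a b v → ∀ {w} → M w ≡ false → assign L v b w ≡ L w
    assign-core {L} {a} {b} {v} mv m = assign-other {L} {v} {b} (λ { refl → true-false (proj₁ mv) m })

    -- A class not above the target is below it after giving up a vertex, as the recursive call
    -- requires, and the success of that call restores its size. That b is not in U makes the source
    -- of each move differ from b.
    pull-sound : ∀ fuel {U b L L′} → Valid K L M → (∀ {x} → x ∈ U → x ∈ K) → b ∈ K → b ∉ U →
                 classSize L b ≤ toℕ t → pull t M fuel (U , b , L) ≡ just L′ →
                 Valid K L′ M × suc (classSize L b) ≤ classSize L′ b × L ⊑ L′
    pull-sound (_ ∷ fuel) {U} {b} {L} {L′} valid U⊆K b∈K b∉U low e
      with first⁻ (λ a → maybe′ (λ v → if above t L a then just (assign L v b)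
                                       else pull t M fuel (remove a U , a , assign L v b))
                                nothing (candidate M L a b)) U e
    ... | a , a∈U , e′ with candidate M L a b in cand
    ... | just v with candidate⁻ {M} {L} cand
    ... | mv with above t L a in ab
    pull-sound (_ ∷ fuel) {U} {b} {L} valid U⊆K b∈K b∉U low e | a , a∈U , refl | just v | mv | true =
      assign-valid valid b∈K mv , assign-target Lv a≢b , grows , assign-core mv
      where
      Lv = proj₁ (proj₂ mv)
      a≢b : a ≢ b
      a≢b refl = b∉U a∈U
      grows : ∀ c → classSize L c ⊓ target ≤ classSize (assign L v b) c
      grows c with c Fin.≟ a
      ... | yes refl = ≤-trans (m⊓n≤n _ target) (≤-pred (≤-trans (above⁻ {t} {L} ab) (assign-source Lv a≢b)))
      ... | no  c≢a  = ≤-trans (m⊓n≤m _ target) (assign-elsewhere Lv a≢b c≢a)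
    ... | false
      with pull-sound fuel (assign-valid valid b∈K mv) (λ h → U⊆K (proj₁ (remove⁻ h))) (U⊆K a∈U)
             (λ h → proj₂ (remove⁻ {a} {U} h) refl)
             (≤-pred (≤-trans (assign-source-< (proj₁ (proj₂ mv)) (λ { refl → b∉U a∈U })) (¬above⁻ {t} {L} ab))) e′
    -- Class b was below the target, so one vertex more does not exceed it; and `⊑` protects sizes
    -- up to the target from the later moves.
    ...   | valid′ , more , grow , fixes = valid′ , ≤-trans (⊓-glb (assign-target Lv a≢b) (s≤s low)) (grow b) ,
      grows , λ m → trans (fixes m) (assign-core mv m)
      where
      Lv = proj₁ (proj₂ mv)
      a≢b : a ≢ b
      a≢b refl = b∉U a∈U
      grows : ∀ c → classSize L c ⊓ target ≤ classSize L′ c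
      grows c with c Fin.≟ a
      ... | yes refl = ≤-trans (m⊓n≤m _ target) (≤-trans (assign-source Lv a≢b) more)
      ... | no  c≢a  = ≤-trans (⊓-monoˡ-≤ target (assign-elsewhere Lv a≢b c≢a)) (grow c)

    -- The set R that obstructs the target.
    explored : List V → List V × V × Labels → List V
    explored []         (U , b , L) = b ∷ []
    explored (_ ∷ fuel) (U , b , L) = b ∷ List.concatMap
      (λ a → maybe′ (λ v → explored fuel (remove a U , a , assign L v b)) [] (candidate M L a b)) U

    explored-head : ∀ fuel {U b L} → b ∈ explored fuel (U , b , L)
    explored-head []      = here refl
    explored-head (_ ∷ _) = here refl

    record Stuck (U : List V) (b : V) (L : Labels) (R : List V) : Set where
      field
        small : ∀ {c} → c ∈ R → c ≡ b ⊎ (c ∈ U × classSize L c ≤ target)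
        shut  : ∀ {c b′ v} → c ∈ U → c ∉ R → b′ ∈ R → ¬ Movable M L c b′ v

    -- The recursive calls see labels in which v has moved from a to b, but what they find carries
    -- back to L. Classes other than a lost nothing. A move of some w out of c is available before
    -- and after: w is not v, which was in class a, and the neighbour that permits it lies in X,
    -- while v is free. The fuel lasts because U shrinks with every call.
    pull-stuck : ∀ fuel {U b L} → Valid K L M → (∀ {x} → x ∈ U → x ∈ K) → b ∈ K → b ∉ U →
                 length U ≤ length fuel → pull t M fuel (U , b , L) ≡ nothing →
                 Stuck U b L (explored fuel (U , b , L))
    pull-stuck [] {[]} valid U⊆K b∈K b∉U len e = record { small = λ { (here p) → inj₁ p } ; shut = λ () }
    pull-stuck (x ∷ fuel) {U} {b} {L} valid U⊆K b∈K b∉U len e = record { small = small ; shut = shut }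
      where
      attempt : V → Maybe Labels
      attempt a = maybe′ (λ v → if above t L a then just (assign L v b)
                                else pull t M fuel (remove a U , a , assign L v b)) nothing (candidate M L a b)
      sub : V → List V
      sub a = maybe′ (λ v → explored fuel (remove a U , a , assign L v b)) [] (candidate M L a b)
      R : List V
      R = explored (x ∷ fuel) (U , b , L)
      sub⊆R : ∀ {a c} → a ∈ U → c ∈ sub a → c ∈ R
      sub⊆R a∈U h = there (∈-concatMap⁺ sub (lose a∈U h))
      split : ∀ {c} → c ∈ R → c ≡ b ⊎ ∃[ a ] a ∈ U × c ∈ sub a
      split (here p)  = inj₁ p
      split (there h) with find (∈-concatMap⁻ sub {xs = U} h)
      ... | a , a∈U , h′ = inj₂ (a , a∈U , h′)
      below-a : ∀ {a} → a ∈ U → ∀ {v} → candidate M L a b ≡ just v →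
                Movable M L a b v × classSize L a ≤ target ×
                sub a ≡ explored fuel (remove a U , a , assign L v b) ×
                Stuck (remove a U) a (assign L v b) (explored fuel (remove a U , a , assign L v b))
      below-a {a} a∈U {v} cand with candidate⁻ {M} {L} cand | first-nothing attempt {U} e a∈U
      ... | mv | e′ rewrite cand with above t L a in ab
      ... | false = mv , ¬above⁻ {t} {L} ab , refl ,
        pull-stuck fuel (assign-valid valid b∈K mv) (λ h → U⊆K (proj₁ (remove⁻ h))) (U⊆K a∈U)
          (λ h → proj₂ (remove⁻ {a} {U} h) refl)
          (≤-pred (≤-trans (select-shorter (λ x → not (x ≈ᵇ a)) a∈U (cong not (≟⁺ {u = a} refl))) len)) e′
      inside : ∀ {a c} → a ∈ U → c ∈ sub a → ∃[ v ] candidate M L a b ≡ just v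
      inside {a} a∈U h with candidate M L a b
      ... | just v = v , refl
      small : ∀ {c} → c ∈ R → c ≡ b ⊎ (c ∈ U × classSize L c ≤ target)
      small h with split h
      ... | inj₁ p = inj₁ p
      ... | inj₂ (a , a∈U , h′) with inside a∈U h′
      ...   | v , cand with below-a a∈U cand
      ...     | (_ , Lv , _) , le , eq , stuck with Stuck.small stuck (subst (_ ∈_) eq h′)
      ...       | inj₁ refl = inj₂ (a∈U , le)
      ...       | inj₂ (c∈ , le′) = inj₂ (proj₁ (remove⁻ c∈) ,
                    ≤-trans (assign-elsewhere Lv (λ { refl → b∉U a∈U }) (proj₂ (remove⁻ {a} {U} c∈))) le′)
      shut : ∀ {c b′ v} → c ∈ U → c ∉ R → b′ ∈ R → ¬ Movable M L c b′ v
      shut {c} {b′} {w} c∈U c∉R b′∈R (m , Lw , u , e , Lu) with split b′∈R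
      ... | inj₁ refl with candidate M L c b in cand
      ...   | nothing = candidate-nothing {M} {L} cand (m , Lw , u , e , Lu)
      ...   | just v  with below-a c∈U cand
      ...     | _ , _ , eq , _ = c∉R (sub⊆R c∈U (subst (c ∈_) (sym eq) (explored-head fuel)))
      shut {c} {b′} {w} c∈U c∉R b′∈R (m , Lw , u , ewu , Lu) | inj₂ (a , a∈U , h′) with inside a∈U h′
      ...   | v , cand with below-a a∈U cand
      ...     | (mv , Lv , _) , _ , eq , stuck =
        Stuck.shut stuck (remove⁺ c∈U c≢a) (λ h → c∉R (sub⊆R a∈U (subst (c ∈_) (sym eq) h)))
          (subst (b′ ∈_) eq h′)
          (m , trans (assign-other {L} {v} {b} w≢v) Lw , u , ewu , trans (assign-other {L} {v} {b} u≢v) Lu)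
        where
        c≢a : c ≢ a
        c≢a refl = c∉R (sub⊆R a∈U (subst (c ∈_) (sym eq) (explored-head fuel)))
        w≢v : w ≢ v
        w≢v refl = c≢a (trans (sym Lw) Lv)
        u≢v : u ≢ v
        u≢v refl = true-false mv (Valid.X-core valid (Valid.free-neighbour valid m ewu))

    enlarge-sound : ∀ {c L L′} → Valid K L M → c ∈ K → enlarge t M K c L ≡ just L′ →
                    Valid K L′ M × suc (classSize L c) ⊓ target ≤ classSize L′ c × L ⊑ L′
    enlarge-sound {c} {L} valid c∈K e with below t L c in bel
    ... | true with pull-sound K {remove c K} valid (λ h → proj₁ (remove⁻ h)) c∈K
                      (λ h → proj₂ (remove⁻ {c} {K} h) refl) (below⁻ {t} {L} bel) e
    ...   | valid′ , more , grow = valid′ , ≤-trans (m⊓n≤m _ target) more , grow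
    enlarge-sound {c} {L} valid c∈K refl | false =
      valid , ≤-trans (m⊓n≤n _ target) (¬below⁻ {t} {L} bel) , ⊑-refl L

    fillClass-sound : ∀ {c L L′} → Valid K L M → c ∈ K → fillClass t M K c (just L) ≡ just L′ →
                      Valid K L′ M × target ≤ classSize L′ c × L ⊑ L′
    fillClass-sound {c} {L} valid c∈K e with loop verts e
      where
      loop : ∀ ys {L′} → foldr (λ _ r → maybe′ (enlarge t M K c) nothing r) (just L) ys ≡ just L′ →
             Valid K L′ M × length ys ⊓ target ≤ classSize L′ c × L ⊑ L′
      loop []       refl = valid , z≤n , ⊑-refl L
      loop (_ ∷ ys) {L′} e with foldr (λ _ r → maybe′ (enlarge t M K c) nothing r) (just L) ys in eq
      ... | just L″ with loop ys eq
      ...   | valid″ , size″ , grow″ with enlarge-sound valid″ c∈K e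
      ...     | valid′ , more , grow =
        valid′ , ≤-trans (⊓-glb (s≤s (≤-trans (⊓-monoʳ-≤ (length ys) (n≤1+n (toℕ t))) size″)) (m⊓n≤n _ target)) more ,
        ⊑-trans {L} {L″} {L′} grow″ grow
    ... | valid′ , sized , grow =
      valid′ , ≤-trans (⊓-glb (≤-trans (toℕ<n t) (≤-reflexive (sym (length-tabulate (λ v → v))))) ≤-refl) sized , grow

    fill-sound : ∀ {L L′} → Valid K L M → fill t M K L ≡ just L′ →
                 Valid K L′ M × (∀ {c} → c ∈ K → target ≤ classSize L′ c) × L ⊑ L′
    fill-sound {L} valid e = loop K (λ h → h) e
      where
      loop : ∀ ys {L′} → (∀ {c} → c ∈ ys → c ∈ K) → foldr (fillClass t M K) (just L) ys ≡ just L′ →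
             Valid K L′ M × (∀ {c} → c ∈ ys → target ≤ classSize L′ c) × L ⊑ L′
      loop []       sub refl = valid , (λ ()) , ⊑-refl L
      loop (y ∷ ys) {L′} sub e with foldr (fillClass t M K) (just L) ys in eq
      ... | nothing with trans (sym (nothing-stays verts)) e
        where
        nothing-stays : ∀ (zs : List V) → foldr (λ _ r → maybe′ (enlarge t M K y) nothing r) nothing zs ≡ nothing
        nothing-stays []       = refl
        nothing-stays (_ ∷ zs) rewrite nothing-stays zs = refl
      ...   | ()
      loop (y ∷ ys) {L′} sub e | just L″ with loop ys (λ h → sub (there h)) eq
      ... | valid″ , sized″ , grow″ with fillClass-sound valid″ (sub (here refl)) e
      ...   | valid′ , sized , grow = valid′ , sizes , ⊑-trans {L} {L″} {L′} grow″ grow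
        where
        sizes : ∀ {c} → c ∈ y ∷ ys → target ≤ classSize L′ c
        sizes (here refl) = sized
        sizes (there h)   = ≤-trans (⊓-glb (sized″ h) ≤-refl) (proj₁ grow _)

    -- Filling moves free vertices only, so agreement with L₀ on the core is an invariant, and
    -- failure of `enlarge` has to be excluded only under it.
    fill-total : ∀ {L₀} → Valid K L₀ M →
                 (∀ {L c} → Valid K L M → (∀ {v} → M v ≡ false → L v ≡ L₀ v) → c ∈ K → enlarge t M K c L ≢ nothing) →
                 ∃[ L′ ] fill t M K L₀ ≡ just L′
    fill-total {L₀} valid total with loop K (λ h → h)
      where
      Inv : Labels → Set
      Inv L = Valid K L M × (∀ {v} → M v ≡ false → L v ≡ L₀ v)
      enlarge-total : ∀ {L c} → Inv L → c ∈ K → ∃[ L′ ] enlarge t M K c L ≡ just L′ × Inv L′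
      enlarge-total {L} {c} (valid , fixes) c∈K with enlarge t M K c L in eq
      ... | nothing = contradiction eq (total valid fixes c∈K)
      ... | just L′ with enlarge-sound valid c∈K eq
      ...   | valid′ , _ , _ , fixes′ = L′ , refl , valid′ , λ m → trans (fixes′ m) (fixes m)
      fillClass-total : ∀ {L c} → Inv L → c ∈ K → ∀ (ys : List V) →
        ∃[ L′ ] foldr (λ _ r → maybe′ (enlarge t M K c) nothing r) (just L) ys ≡ just L′ × Inv L′
      fillClass-total inv c∈K []       = _ , refl , inv
      fillClass-total inv c∈K (_ ∷ ys) with fillClass-total inv c∈K ys
      ... | L″ , eq , inv″ rewrite eq = enlarge-total inv″ c∈K
      loop : ∀ ys → (∀ {c} → c ∈ ys → c ∈ K) → ∃[ L′ ] foldr (fillClass t M K) (just L₀) ys ≡ just L′ × Inv L′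
      loop []       sub = L₀ , refl , valid , λ _ → refl
      loop (y ∷ ys) sub with loop ys (λ h → sub (there h))
      ... | L″ , eq , inv″ rewrite eq = fillClass-total inv″ (sub (here refl)) verts
    ... | L′ , eq , _ = L′ , eq

    -- The target is 1, and no class is below it, since each contains its root.
    fill-trivial : ∀ {L} → Valid K L M → toℕ t ≡ 0 → ∃[ L′ ] fill t M K L ≡ just L′
    fill-trivial valid t≡0 = fill-total valid total
      where
      total : ∀ {L c} → Valid K L M → _ → c ∈ K → enlarge t M K c L ≢ nothing
      total {L} {c} valid _ c∈K e with below t L c in bel
      ... | true = <⇒≱ (♯-some c (≟⁺ (proj₁ (Valid.root valid c∈K))))
                       (≤-trans (below⁻ {t} {L} bel) (≤-reflexive t≡0))
      total valid _ c∈K () | false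

    module _ {m : ℕ} {q : V → Fin m}
             (q-connected : ∀ {u v} → q u ≡ q v → Star (λ x y → E x y × q x ≡ q y) u v)
             (q-injective : ∀ {a b} → a ∈ K → b ∈ K → q a ≡ q b → a ≡ b)
             (q-large : ∀ c → target ≤ ♯ (λ v → does (q v Fin.≟ q c))) where

      -- If the chain search failed, count the pairs of a class c in R and a vertex of it, once with
      -- the classes of L and once with those of q. By sizes L has fewer: its classes in R have at
      -- most the target size and that of b is smaller, whereas those of q reach the target. But by
      -- `absorbed` every vertex counted for q is counted for L as well.
      pull-complete : ∀ {L b} → Valid K L M → (∀ {v} → M v ≡ false → q v ≡ q (L v)) →
                      b ∈ K → classSize L b ≤ toℕ t → pull t M K (remove b K , b , L) ≢ nothing
      pull-complete {L} {b} valid refines b∈K low e = <⇒≱ fewer more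
        where
        open Valid valid
        U R : List V
        U = remove b K
        R = explored K (U , b , L)
        stuck : Stuck U b L R
        stuck = pull-stuck K valid (λ h → proj₁ (remove⁻ h)) b∈K (λ h → proj₂ (remove⁻ {b} {K} h) refl)
                  (<⇒≤ (select-shorter (λ x → not (x ≈ᵇ b)) b∈K (cong not (≟⁺ {u = b} refl)))) e
        in-R : ∀ {c} → (c ∈ᵇ R) ≡ true → c ∈ R
        in-R = ∈ᵇ⁻ R
        R-in : ∀ {c} → c ∈ R → (c ∈ᵇ R) ≡ true
        R-in = ∈ᵇ⁺
        R⊆K : ∀ {c} → c ∈ R → c ∈ K
        R⊆K h with Stuck.small stuck h
        ... | inj₁ refl      = b∈K
        ... | inj₂ (c∈U , _) = proj₁ (remove⁻ c∈U)
        -- For a free v, the first step of a walk to r inside the class of q ends in X, at a core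
        -- vertex which therefore has label r. So v could be moved into class r, which is impossible
        -- for vertices of classes outside R.
        absorbed : ∀ {v r} → r ∈ R → q v ≡ q r → L v ∈ R
        absorbed {v} {r} r∈R qv with M v in free
        ... | false = subst (_∈ R) (sym (q-injective (label v) (R⊆K r∈R) (trans (sym (refines free)) qv))) r∈R
        ... | true  with q-connected qv
        ...   | ε = true-false free (proj₂ (root (R⊆K r∈R)))
        ...   | _◅_ {j = z} (vz , qz) _ = in-R (not-false λ out →
          Stuck.shut stuck (remove⁺ (label v) (λ { refl → true-false (R-in (explored-head K)) out }))
            (λ h → true-false (R-in h) out) r∈R (free , refl , z , vz , Lz))
          where
          not-false : ∀ {x} → ¬ (x ≡ false) → x ≡ true
          not-false {true}  h = refl
          not-false {false} h = contradiction refl h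
          Lz : L z ≡ r
          Lz = q-injective (label z) (R⊆K r∈R)
                 (trans (sym (refines (X-core (free-neighbour free vz)))) (trans (sym qz) qv))
        ours theirs : V → V → Bool
        ours   c v = (c ∈ᵇ R) ∧ (L v ≈ᵇ c)
        theirs c v = (c ∈ᵇ R) ∧ does (q v Fin.≟ q c)
        small-class : ∀ {c} → c ∈ R → classSize L c ≤ target
        small-class h with Stuck.small stuck h
        ... | inj₁ refl     = ≤-trans low (n≤1+n _)
        ... | inj₂ (_ , le) = le
        per-class : ∀ c → ♯ (ours c) ≤ ♯ (theirs c)
        per-class c with c ∈ᵇ R in eq
        ... | false = ≤-refl
        ... | true  = ≤-trans (small-class (in-R eq)) (q-large c)
        per-class-b : ♯ (ours b) < ♯ (theirs b)
        per-class-b rewrite R-in (explored-head K {U} {b} {L}) = ≤-trans (s≤s low) (q-large b)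
        fewer : sum (λ c → ♯ (ours c)) < sum (λ c → ♯ (theirs c))
        fewer = sum-mono-< per-class b per-class-b
        per-vertex : ∀ v → ♯ (λ c → theirs c v) ≤ ♯ (λ c → ours c v)
        per-vertex v with exists (λ c → theirs c v) verts in eq
        ... | false = ≤-trans (≤-reflexive (♯-none (λ c → not-true
                        (λ h → true-false (exists⁺ (λ c → theirs c v) (∈-allFin c) h) eq)))) z≤n
        ... | true with exists⁻ (λ c → theirs c v) verts eq
        ...   | r , _ , h = ≤-trans (♯-one unique-class) (♯-some (L v) (∧⁺ (R-in (absorbed (in-R (proj₁ (∧⁻ h)))
                              (≟⁻ (proj₂ (∧⁻ {r ∈ᵇ R} h))))) (≟⁺ {u = L v} refl)))
          where
          unique-class : ∀ c d → theirs c v ≡ true → theirs d v ≡ true → c ≡ d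
          unique-class c d h h′ = q-injective (R⊆K (in-R (proj₁ (∧⁻ h)))) (R⊆K (in-R (proj₁ (∧⁻ h′))))
            (trans (sym (≟⁻ {u = q v} (proj₂ (∧⁻ {c ∈ᵇ R} h)))) (≟⁻ {u = q v} (proj₂ (∧⁻ {d ∈ᵇ R} h′))))
        more : sum (λ c → ♯ (theirs c)) ≤ sum (λ c → ♯ (ours c))
        more = begin
          sum (λ c → ♯ (theirs c))            ≡⟨ ∑-comm (λ c v → 𝟙 (theirs c v)) ⟩
          sum (λ v → ♯ (λ c → theirs c v))    ≤⟨ sum-mono per-vertex ⟩
          sum (λ v → ♯ (λ c → ours c v))      ≡⟨ ∑-comm (λ v c → 𝟙 (ours c v)) ⟩
          sum (λ c → ♯ (ours c))              ∎
          where open ≤-Reasoning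

      fill-complete : ∀ {L} → Valid K L M → (∀ {v} → M v ≡ false → q v ≡ q (L v)) → ∃[ L′ ] fill t M K L ≡ just L′
      fill-complete {L₀} valid refines = fill-total valid total
        where
        total : ∀ {L c} → Valid K L M → (∀ {v} → M v ≡ false → L v ≡ L₀ v) → c ∈ K → enlarge t M K c L ≢ nothing
        total {L} {c} valid fixes c∈K e with below t L c in bel
        ... | true = pull-complete valid (λ m → trans (refines m) (cong q (sym (fixes m)))) c∈K (below⁻ {t} {L} bel) e
        total valid fixes c∈K () | false

-- Searching for the core

module Searching (i : Instance) (cover : VertexCover (Instance.G i) (Instance.X i)) where
  open Algorithm i
  open Correct i cover
  open Filling i cover

  xs-InX : ∀ {x} → x ∈ xs → InX x
  xs-InX h = proj₂ (select⁻ (lookup X) verts h)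

  InX-xs : ∀ {x} → InX x → x ∈ xs
  InX-xs h = select⁺ (lookup X) (∈-allFin _) h

  remove-length : ∀ {b K} → Unique K → b ∈ K → suc (length (remove b K)) ≡ length K
  remove-length {b} (n ∷ u) (here refl) rewrite ≟⁺ {u = b} refl = cong (suc ∘ length) (absent n)
    where
    absent : ∀ {ys} → All (b ≢_) ys → remove b ys ≡ ys
    absent []      = refl
    absent (n ∷ ns) rewrite ≟-no (λ e → n (sym e)) = cong (_ ∷_) (absent ns)
  remove-length {b} {y ∷ K} (n ∷ u) (there h) rewrite ≟-no (All.lookup n h) = cong suc (remove-length u h)

  splitBy-⊆ : ∀ y gs {g u} → g ∈ foldr (splitBy y) [] gs → u ∈ g → ∃[ g₀ ] g₀ ∈ gs × u ∈ g₀
  splitBy-⊆ y (g₀ ∷ gs) (here refl)         h = g₀ , here refl , proj₁ (select⁻ (λ v → adj v y) g₀ h)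
  splitBy-⊆ y (g₀ ∷ gs) (there (here refl)) h = g₀ , here refl , proj₁ (select⁻ (λ v → not (adj v y)) g₀ h)
  splitBy-⊆ y (g₀ ∷ gs) (there (there k))   h with splitBy-⊆ y gs k h
  ... | g₁ , k₁ , h₁ = g₁ , there k₁ , h₁

  splitBy-keeps : ∀ y {gs g w} → g ∈ gs → w ∈ g →
    ∃[ g′ ] g′ ∈ foldr (splitBy y) [] gs × w ∈ g′ × (∀ {u} → u ∈ g′ → u ∈ g × adj u y ≡ adj w y)
  splitBy-keeps y {g ∷ gs} {w = w} (here refl) h with adj w y in eq
  ... | true  = _ , here refl , select⁺ (λ v → adj v y) h eq , select⁻ (λ v → adj v y) g
  ... | false = _ , there (here refl) , select⁺ (λ v → not (adj v y)) h (not⁺ eq) ,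
                λ k → map₂ not⁻ (select⁻ (λ v → not (adj v y)) g k)
  splitBy-keeps y {_ ∷ gs} (there k) h with splitBy-keeps y k h
  ... | g′ , k′ , h′ , all = g′ , there (there k′) , h′ , all

  refineAll-⊆ : ∀ gs {g u} → g ∈ proj₁ (refineAll gs) → u ∈ g → ∃[ g₀ ] g₀ ∈ gs × u ∈ g₀
  refineAll-⊆ gs = loop xs
    where
    loop : ∀ (zs : List V) {g u} → g ∈ proj₁ (foldr (λ _ → refine) (gs , xs) zs) → u ∈ g → ∃[ g₀ ] g₀ ∈ gs × u ∈ g₀
    loop []       k h = _ , k , h
    loop (_ ∷ zs) k h with foldr (λ _ → refine) (gs , xs) zs | loop zs
    ... | gs′ , []     | ih = ih k h
    ... | gs′ , y ∷ ys | ih with splitBy-⊆ y gs′ k h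
    ...   | _ , k′ , h′ = ih k′ h′

  -- `Kept` leaves open how the group is adjacent to the vertices of X still waiting. Each of the
  -- |X| rounds takes one of them, so none is left at the end.
  refineAll-keeps : ∀ {gs g w} → g ∈ gs → w ∈ g →
    ∃[ g′ ] g′ ∈ proj₁ (refineAll gs) × w ∈ g′ × (∀ {u} → u ∈ g′ → u ∈ g × (∀ {x} → x ∈ xs → adj u x ≡ adj w x))
  refineAll-keeps {gs} {g} {w} k h = finished (loop xs)
    where
    Kept : List (List V) × List V → Set
    Kept (gs′ , ys) = ∃[ g′ ] g′ ∈ gs′ × w ∈ g′ ×
      (∀ {u} → u ∈ g′ → u ∈ g × (∀ {x} → x ∈ xs → x ∈ ys ⊎ adj u x ≡ adj w x))
    loop : ∀ (zs : List V) → Kept (foldr (λ _ → refine) (gs , xs) zs) ×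
           length (proj₂ (foldr (λ _ → refine) (gs , xs) zs)) ≡ length xs ∸ length zs
    loop []       = (g , k , h , λ h′ → h′ , inj₁) , refl
    loop (_ ∷ zs) with foldr (λ _ → refine) (gs , xs) zs | loop zs
    ... | gs′ , []     | kept , len = kept ,
          trans (cong pred len) (pred[m∸n]≡m∸[1+n] (length xs) (length zs))
    ... | gs′ , y ∷ ys | (g′ , k′ , h′ , all) , len with splitBy-keeps y k′ h′
    ...   | g″ , k″ , h″ , all′ = (g″ , k″ , h″ , both) , trans (cong pred len) (pred[m∸n]≡m∸[1+n] (length xs) (length zs))
      where
      both : ∀ {u} → u ∈ g″ → u ∈ g × (∀ {x} → x ∈ xs → x ∈ ys ⊎ adj u x ≡ adj w x)
      both {u} h = proj₁ (all (proj₁ (all′ h))) , λ x∈ → next (proj₂ (all (proj₁ (all′ h))) x∈)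
        where
        next : ∀ {x} → x ∈ y ∷ ys ⊎ adj u x ≡ adj w x → x ∈ ys ⊎ adj u x ≡ adj w x
        next (inj₁ (here refl)) = inj₂ (proj₂ (all′ h))
        next (inj₁ (there x∈))  = inj₁ x∈
        next (inj₂ e)           = inj₂ e
    finished : Kept (refineAll gs) × length (proj₂ (refineAll gs)) ≡ length xs ∸ length xs →
      ∃[ g′ ] g′ ∈ proj₁ (refineAll gs) × w ∈ g′ × (∀ {u} → u ∈ g′ → u ∈ g × (∀ {x} → x ∈ xs → adj u x ≡ adj w x))
    finished ((g′ , k′ , h′ , all) , len) = g′ , k′ , h′ , λ u∈ → proj₁ (all u∈) , λ x∈ → done (proj₂ (all u∈) x∈)
      where
      done : ∀ {x u} → x ∈ proj₂ (refineAll gs) ⊎ adj u x ≡ adj w x → adj u x ≡ adj w x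
      done (inj₂ e) = e
      done (inj₁ h) with proj₂ (refineAll gs) | trans len (n∸n≡0 (length xs))
      done (inj₁ ()) | [] | _

  core⁻ : ∀ {L M a u} → u ∈ core L M a → M u ≡ false × L u ≡ a
  core⁻ {L} {M} {a} {u} h with select⁻ (λ v → not (M v) ∧ (L v ≈ᵇ a)) verts h
  ... | _ , e = not⁻ (proj₁ (∧⁻ e)) , ≟⁻ (proj₂ (∧⁻ {not (M u)} e))

  core⁺ : ∀ {L M a u} → M u ≡ false → L u ≡ a → u ∈ core L M a
  core⁺ {L} {M} {a} m l = select⁺ (λ v → not (M v) ∧ (L v ≈ᵇ a)) (∈-allFin _) (∧⁺ (not⁺ m) (≟⁺ l))

  fringe⁻ : ∀ {L M a u} → u ∈ fringe L M a → M u ≡ true × ∃[ z ] E u z × L z ≡ a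
  fringe⁻ {L} {M} {a} {u} h with select⁻ (λ v → M v ∧ touches L v a) verts h
  ... | _ , e = proj₁ (∧⁻ e) , touches⁻ {L} {u} {a} (proj₂ (∧⁻ {M u} e))

  fringe⁺ : ∀ {L M a u} z → M u ≡ true → E u z → L z ≡ a → u ∈ fringe L M a
  fringe⁺ {L} {M} {a} {u} z m e l = select⁺ (λ v → M v ∧ touches L v a) (∈-allFin _) (∧⁺ m (touches⁺ {L} {u} {a} z e l))

  groups-join : ∀ {L M a g u} → g ∈ groups L M a → u ∈ g → Joins L M a u
  groups-join {L} {M} {a} k h with refineAll-⊆ (core L M a ∷ fringe L M a ∷ []) k h
  ... | _ , here refl         , h′ = inj₁ (core⁻ {L} {M} h′)
  ... | _ , there (here refl) , h′ = inj₂ (fringe⁻ {L} {M} h′)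

  record Result (t : V) (o : V → ℕ) : Set where
    field
      {roots}  : List V
      {labels} : Labels
      {mask}   : Mask
      valid    : Valid roots labels mask
      k-many   : length roots ≡ k
      large    : ∀ {c} → c ∈ roots → suc (toℕ t) ≤ classSize labels c
      outputs  : ∀ v → o v ≡ output roots labels v

  private
    tryVertex : (State → Maybe (V → ℕ)) → State → V → V → V → Maybe (V → ℕ)
    tryVertex rec s a u y =
      if joinable (proj₁ (proj₂ s)) a u y then rec (join s a u (proj₁ (proj₂ s) y)) else nothing

    tryGroup : (State → Maybe (V → ℕ)) → State → V → List V → Maybe (V → ℕ)
    tryGroup rec s a = listCase nothing (λ u _ → first (tryVertex rec s a u) xs)

    tryRoot : (State → Maybe (V → ℕ)) → State → V → Maybe (V → ℕ)
    tryRoot rec s a = first (tryGroup rec s a) (groups (proj₁ (proj₂ s)) (proj₂ (proj₂ s)) a)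

  -- A join removes exactly one root, so the number of roots exceeds k by the remaining fuel and is
  -- k at a leaf.
  search-sound : ∀ t fuel {K L M o} → Valid K L M → length K ≡ k + length fuel →
                 search t fuel (K , L , M) ≡ just o → Result t o
  search-sound t [] {K} {L} {M} valid len e with fill t M K L in eq
  search-sound t [] {K} {L} {M} valid len refl | just L′ with fill-sound K M t valid eq
  ... | valid′ , sized , _ = record
    { valid = valid′ ; k-many = trans len (+-identityʳ k) ; large = sized ; outputs = λ _ → refl }
  search-sound t (x ∷ fuel) {K} {L} {M} valid len e
    with first⁻ (tryRoot (search t fuel) (K , L , M)) K e
  ... | a , a∈K , e₁ with first⁻ (tryGroup (search t fuel) (K , L , M) a) (groups L M a) e₁
  ... | u ∷ g , g∈ , e₂ with first⁻ (tryVertex (search t fuel) (K , L , M) a u) xs e₂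
  ... | y , y∈ , e₃ with joinable L a u y in eq
  ... | true = search-sound t fuel
      (Joining.join-valid valid a∈K (groups-join {L} {M} g∈ (here refl)) (xs-InX y∈) (proj₁ (∧⁻ eq)) Ly≢a)
      (suc-injective (trans (remove-length (Valid.unique valid) (Valid.label valid y)) (trans len (+-suc k (length fuel))))) e₃
    where
    Ly≢a : L y ≢ a
    Ly≢a p = true-false (≟⁺ p) (not⁻ (proj₂ (∧⁻ {adj u y} eq)))

  module Swap (w u : V) where

    π : V → V
    π v = if v ≈ᵇ w then u else (if v ≈ᵇ u then w else v)

    π-w : π w ≡ u
    π-w rewrite ≟⁺ {u = w} refl = refl

    π-u : π u ≡ w
    π-u with u Fin.≟ w
    ... | yes p = p
    ... | no  _ rewrite ≟⁺ {u = u} refl = refl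

    π-other : ∀ {v} → v ≢ w → v ≢ u → π v ≡ v
    π-other p q rewrite ≟-no p | ≟-no q = refl

    data Position : V → Set where
      at-w  : Position w
      at-u  : Position u
      other : ∀ {v} → v ≢ w → v ≢ u → Position v

    position? : ∀ v → Position v
    position? v with v Fin.≟ w
    ... | yes refl = at-w
    ... | no  p with v Fin.≟ u
    ...   | yes refl = at-u
    ...   | no  q    = other p q

    π-involutive : ∀ v → π (π v) ≡ v
    π-involutive v with position? v
    ... | at-w      = trans (cong π π-w) π-u
    ... | at-u      = trans (cong π π-u) π-w
    ... | other p q = trans (cong π (π-other p q)) (π-other p q)

    permute : Permutation n n
    permute = permutation π π π-involutive π-involutive

    adj-comm : ∀ p r → adj p r ≡ adj r p
    adj-comm p r with adj p r in e | adj r p in e′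
    ... | true  | true  = refl
    ... | false | false = refl
    ... | true  | false = true-false (E-sym e) e′
    ... | false | true  = true-false (E-sym e′) e

    module _ (twins : ∀ x → adj u x ≡ adj w x) where

      adj-π : ∀ p r → adj (π p) (π r) ≡ adj p r
      adj-π p r = trans (left p (π r)) (trans (adj-comm p (π r)) (trans (left r p) (adj-comm r p)))
        where
        left : ∀ p r → adj (π p) r ≡ adj p r
        left p r with position? p
        ... | at-w      = trans (cong (λ z → adj z r) π-w) (twins r)
        ... | at-u      = trans (cong (λ z → adj z r) π-u) (sym (twins r))
        ... | other h k = cong (λ z → adj z r) (π-other h k)

  module _ {m : ℕ} where

    Joined : (V → Fin m) → V → V → Set
    Joined q x y = E x y × q x ≡ q y

    Connects : (V → Fin m) → Set
    Connects q = ∀ {u v} → q u ≡ q v → Star (Joined q) u v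

    -- The core built so far is compatible with q: the core of no class straddles two classes of q.
    -- Free vertices may still be placed differently.
    Refined : (V → Fin m) → Labels → Mask → Set
    Refined q L M = ∀ {v} → M v ≡ false → q v ≡ q (L v)

    -- If the target is 1, then every leaf of the search will do; otherwise q has to be a solution.
    Reaches : V → (V → Fin m) → Set
    Reaches t q = toℕ t ≡ 0 ⊎ (m ≡ k × (∀ c → ∃[ x ] InX x × q x ≡ c) ×
                               (∀ c → suc (toℕ t) ≤ ♯ (λ v → does (q v Fin.≟ c))))

    -- A merger suggested by q itself: an edge inside a class of q that joins class a, or a helper
    -- of it, to another class. This is what the search has to guess next.
    record Crossing (q : V → Fin m) (K : List V) (L : Labels) (M : Mask) : Set where
      constructor crossing
      field
        {a w y} : V
        a∈K     : a ∈ K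
        kind    : w ∈ core L M a ⊎ w ∈ fringe L M a
        y∈X     : InX y
        wy      : E w y
        Ly≢a    : L y ≢ a
        qw      : q w ≡ q a
        qy      : q w ≡ q y

    -- Follow the walk, with `p` always a core vertex of the class where it began. After a free
    -- vertex it must continue into X, so it leaves this class along one edge or through one helper.
    -- It cannot end at a free vertex, because `z` is in the core.
    cross : ∀ {q K L M} → Valid K L M → Refined q L M → ∀ {p z} → M p ≡ false → M z ≡ false → L p ≢ L z →
            Star (Joined q) p z → Crossing q K L M
    cross valid refined mp mz p≢z ε = contradiction refl p≢z
    cross {q} {K} {L} {M} valid refined {p} {z} mp mz p≢z (_◅_ {j = r} (pr , qpr) rest) with M r in mr
    ... | false with L r Fin.≟ L p
    ...   | yes e = cross valid refined mr mz (λ e′ → p≢z (trans (sym e) e′)) rest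
    ...   | no  r≢p with covered pr
    ...     | inj₂ r∈X = crossing (Valid.label valid p) (inj₁ (core⁺ {L} {M} mp refl)) r∈X pr r≢p (refined mp) qpr
    ...     | inj₁ p∈X = crossing (Valid.label valid r) (inj₁ (core⁺ {L} {M} mr refl)) p∈X (E-sym pr)
                           (λ e → r≢p (sym e)) (refined mr) (sym qpr)
    cross {q} {K} {L} {M} valid refined {p} {z} mp mz p≢z (_◅_ {j = r} (pr , qpr) ε) | true = true-false mr mz
    cross {q} {K} {L} {M} valid refined {p} {z} mp mz p≢z (_◅_ {j = r} (pr , qpr) (_◅_ {j = r′} (rr′ , qrr′) rest)) | true
      with L r′ Fin.≟ L p
    ... | yes e = cross valid refined (Valid.X-core valid (Valid.free-neighbour valid mr rr′)) mz
                    (λ e′ → p≢z (trans (sym e) e′)) rest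
    ... | no r′≢p = crossing (Valid.label valid p) (inj₂ (fringe⁺ {L} {M} p mr (E-sym pr) refl))
                      (Valid.free-neighbour valid mr rr′) rr′ r′≢p (trans (sym qpr) (refined mp)) qrr′

    module _ {q : V → Fin m} {w u : V} (twins : ∀ x → adj u x ≡ adj w x)
             (w∉X : lookup X w ≡ false) (u∉X : lookup X u ≡ false) where
      open Swap w u

      private
        fixed : ∀ {x} → InX x → π x ≡ x
        fixed h = π-other (λ { refl → true-false h w∉X }) (λ { refl → true-false h u∉X })

      swap-connects : Connects q → Connects (q ∘ π)
      swap-connects connects {x} {y} e = subst₂ (Star (Joined (q ∘ π))) (π-involutive x) (π-involutive y)
        (Star.gmap π (λ {p} {r} (e , e′) → trans (adj-π twins p r) e ,
           trans (cong q (π-involutive p)) (trans e′ (cong q (sym (π-involutive r))))) (connects e))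

      swap-reaches : ∀ {t} → Reaches t q → Reaches t (q ∘ π)
      swap-reaches (inj₁ t≡0) = inj₁ t≡0
      swap-reaches {t} (inj₂ (m≡k , meets , large)) = inj₂ (m≡k , meets′ , large′)
        where
        meets′ : ∀ c → ∃[ x ] InX x × q (π x) ≡ c
        meets′ c with meets c
        ... | x , h , e = x , h , trans (cong q (fixed h)) e
        large′ : ∀ c → suc (toℕ t) ≤ ♯ (λ v → does (q (π v) Fin.≟ c))
        large′ c = ≤-trans (large c) (≤-reflexive (sum-permute (λ v → 𝟙 (does (q v Fin.≟ c))) permute))

    -- If two roots lay in one class of q, then without one of them fewer than m roots would still
    -- meet all m classes.
    distinct-roots : ∀ {q : V → Fin m} {K} → length K ≡ m → (∀ c → ∃[ a ] a ∈ K × q a ≡ c) →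
                     ∀ {a b} → a ∈ K → b ∈ K → q a ≡ q b → a ≡ b
    distinct-roots {q} {K} len onto {a} {b} a∈K b∈K qab with a Fin.≟ b
    ... | yes p   = p
    ... | no  a≢b = contradiction same (<⇒≢ (proj₁ (proj₂ (proj₂ collision))) ∘ cong toℕ)
      where
      hit : ∀ c → ∃[ d ] d ∈ remove a K × q d ≡ c
      hit c with onto c
      ... | d , d∈K , e with d Fin.≟ a
      ...   | yes refl = b , remove⁺ b∈K (λ p → a≢b (sym p)) , trans (sym qab) e
      ...   | no  d≢a  = d , remove⁺ d∈K d≢a , e
      smaller : length (remove a K) < m
      smaller = subst (length (remove a K) <_) len
                  (select-shorter (λ x → not (x ≈ᵇ a)) a∈K (cong not (≟⁺ {u = a} refl)))
      place : Fin m → Fin (length (remove a K))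
      place c = Any.index (proj₁ (proj₂ (hit c)))
      collision : ∃[ c ] ∃[ c′ ] c Fin.< c′ × place c ≡ place c′
      collision = pigeonhole smaller place
      value : ∀ c → q (List.lookup (remove a K) (place c)) ≡ c
      value c = trans (cong q (sym (lookup-index (proj₁ (proj₂ (hit c)))))) (proj₂ (proj₂ (hit c)))
      same : proj₁ collision ≡ proj₁ (proj₂ collision)
      same = trans (sym (value _)) (trans (cong (q ∘ List.lookup (remove a K)) (proj₂ (proj₂ (proj₂ collision)))) (value _))

    -- With more than k ≥ m roots two lie in one class of q, and the walk between them contains a
    -- merger compatible with q. The search may know only a twin u of the vertex w on that walk. If
    -- these are free, the induction continues with q composed with their transposition, for which
    -- all hypotheses hold again; this is why q varies in the induction.
    search-complete : ∀ t fuel {q K L M} → Valid K L M → Refined q L M → length K ≡ k + length fuel → m ≤ k →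
                      Connects q → Reaches t q → ∃[ o ] search t fuel (K , L , M) ≡ just o
    search-complete t [] {q} {K} {L} {M} valid refined len m≤k connects reaches with filled reaches
      where
      filled : Reaches t q → ∃[ L′ ] fill t M K L ≡ just L′
      filled (inj₁ t≡0) = fill-trivial K M t valid t≡0
      filled (inj₂ (m≡k , meets , large)) = fill-complete K M t connects
        (distinct-roots (trans len (trans (+-identityʳ k) (sym m≡k)))
          (λ c → let x , h , e = meets c in L x , Valid.label valid x , trans (sym (refined (Valid.X-core valid h))) e))
        (λ c → large (q c)) valid refined
    ... | L′ , eq rewrite eq = output K L′ , refl
    search-complete t (x ∷ fuel) {q} {K} {L} {M} valid refined len m≤k connects reaches
      with pigeonhole enough (λ j → q (List.lookup K j))
      where
      enough : m < length K
      enough = ≤-trans (s≤s m≤k) (≤-trans (s≤s (m≤m+n k (length fuel)))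
        (≤-reflexive (trans (sym (+-suc k (length fuel))) (sym len))))
    ... | j , j′ , j<j′ , qe with cross valid refined (proj₂ (root a₀)) (proj₂ (root b₀)) distinct (connects qe)
      where
      open Valid valid
      a₀ = ∈-lookup {xs = K} j
      b₀ = ∈-lookup {xs = K} j′
      distinct : L (List.lookup K j) ≢ L (List.lookup K j′)
      distinct e = <⇒≢ j<j′ (cong toℕ (lookup-injective unique j j′
        (trans (sym (proj₁ (root a₀))) (trans e (proj₁ (root b₀))))))
    ... | crossing {a} {w} {y} a∈K kind y∈X wy Ly≢a qw qy =
      first⁺ (tryRoot rec s) a∈K (grouped kind)
      where
      open Valid valid
      rec : State → Maybe (V → ℕ)
      rec = search t fuel
      s : State
      s = K , L , M
      b : V
      b = L y
      qb : q b ≡ q a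
      qb = trans (sym (refined (X-core y∈X))) (trans (sym qy) qw)

      module _ {u} (joins : Joins L M a u) (twin : ∀ {x} → x ∈ xs → adj u x ≡ adj w x) where
        uy : E u y
        uy = trans (twin (InX-xs y∈X)) wy
        open Joining valid a∈K joins y∈X uy Ly≢a using (L′; M′; merge; fixed; join-valid) renaming (at-u to L′-u)

        q-merge : ∀ c → q (merge c) ≡ q c
        q-merge c with c Fin.≟ b
        ... | yes refl = sym qb
        ... | no  _    = refl

        new-core : ∀ {v} → M′ v ≡ false → v ≡ u ⊎ M v ≡ false
        new-core {v} m′ with v Fin.≟ u | (λ (p : v ≢ u) (m : M v ≡ true) → ∧⁺ m (not⁺ (≟-no p)))
        ... | yes p | _    = inj₁ p
        ... | no  p | free = inj₂ (not-true (λ m → true-false (free p m) m′))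

        continue : ∀ {q′} → Refined q′ L′ M′ → Connects q′ → Reaches t q′ → ∃[ o ] rec (join s a u b) ≡ just o
        continue refined′ connects′ reaches′ = search-complete t fuel join-valid refined′
          (suc-injective (trans (remove-length unique (label y)) (trans len (+-suc k (length fuel))))) m≤k connects′ reaches′

        -- Here q can stay: a core vertex `u` of class `a` is in the same class of q as `a` already.
        from-core : M u ≡ false → L u ≡ a → ∃[ o ] rec (join s a u b) ≡ just o
        from-core mu Lu = continue refined′ connects reaches
          where
          refined′ : Refined q L′ M′
          refined′ m′ with new-core m′
          ... | inj₁ refl = trans (refined mu) (trans (cong q Lu) (cong q (sym L′-u)))
          ... | inj₂ m    = trans (refined m) (trans (sym (q-merge _)) (cong q (sym (fixed m))))

        from-fringe : M u ≡ true → M w ≡ true → ∃[ o ] rec (join s a u b) ≡ just o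
        from-fringe mu mw = continue refined′ (swap-connects twins w∉X u∉X connects) (swap-reaches twins w∉X u∉X {t} reaches)
          where
          open Swap w u
          w∉X = proj₁ (anchored mw)
          u∉X = proj₁ (anchored mu)
          -- Groups compare adjacency to X only, but free vertices have no neighbours elsewhere.
          twins : ∀ x → adj u x ≡ adj w x
          twins x with lookup X x in x∈
          ... | true  = twin (InX-xs x∈)
          ... | false = trans (not-true (λ e → true-false (free-neighbour mu e) x∈))
                              (sym (not-true (λ e → true-false (free-neighbour mw e) x∈)))
          core-fixed : ∀ {v} → M v ≡ false → π v ≡ v
          core-fixed m = π-other (λ { refl → true-false mw m }) (λ { refl → true-false mu m })
          refined′ : Refined (q ∘ π) L′ M′
          refined′ {v} m′ with new-core m′
          ... | inj₁ refl = trans (cong q π-u) (trans qw (cong q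
                              (sym (trans (cong π L′-u) (core-fixed (proj₂ (root a∈K)))))))
          ... | inj₂ m = trans (cong q (core-fixed m)) (trans (refined m) (trans (sym (q-merge _))
                           (cong q (trans (sym (fixed m)) (sym (core-fixed (proj₂ (root
                             (proj₁ (remove⁻ (Valid.label join-valid v)))))))))))

        tried : (∃[ o ] rec (join s a u b) ≡ just o) → ∃[ o ] first (tryVertex rec s a u) xs ≡ just o
        tried (o , e) = first⁺ (tryVertex rec s a u) (InX-xs y∈X)
          (o , trans (cong (λ z → if z then rec (join s a u b) else nothing) (∧⁺ uy (not⁺ (≟-no Ly≢a)))) e)

      grouped : w ∈ core L M a ⊎ w ∈ fringe L M a → ∃[ o ] tryRoot rec s a ≡ just o
      grouped (inj₁ h) with refineAll-keeps {core L M a ∷ fringe L M a ∷ []} (here refl) h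
      ... | u ∷ g , k , _ , all with all (here refl)
      ...   | u∈ , twin with core⁻ {L} {M} u∈
      ...     | mu , Lu = first⁺ (tryGroup rec s a) k (tried (inj₁ (mu , Lu)) twin (from-core (inj₁ (mu , Lu)) twin mu Lu))
      grouped (inj₂ h) with refineAll-keeps {core L M a ∷ fringe L M a ∷ []} (there (here refl)) h
      ... | u ∷ g , k , _ , all with all (here refl)
      ...   | u∈ , twin with fringe⁻ {L} {M} u∈
      ...     | mu , z = first⁺ (tryGroup rec s a) k
                           (tried (inj₂ (mu , z)) twin (from-fringe (inj₂ (mu , z)) twin mu (proj₁ (fringe⁻ {L} {M} h))))

-- From labels to optimal connected partitions

minimum-≤ : ∀ {k} .{{_ : NonZero k}} (f : Fin k → ℕ) j → minimum f ≤ f j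
minimum-≤ {suc zero}    f zero    = ≤-refl
minimum-≤ {suc (suc k)} f zero    = m⊓n≤m (f zero) _
minimum-≤ {suc (suc k)} f (suc j) = ≤-trans (m⊓n≤n (f zero) _) (minimum-≤ (λ i → f (suc i)) j)

minimum-glb : ∀ {k} .{{_ : NonZero k}} (f : Fin k → ℕ) {a} → (∀ j → a ≤ f j) → a ≤ minimum f
minimum-glb {suc zero}    f h = h zero
minimum-glb {suc (suc k)} f h = ⊓-glb (h zero) (minimum-glb (λ i → f (suc i)) (λ j → h (suc j)))

module Optimal (i : Instance) (cover : VertexCover (Instance.G i) (Instance.X i)) where
  open Algorithm i
  open Correct i cover
  open Searching i cover

  position-lookup : ∀ {K v} → v ∈ K → Σ[ p ∈ position K v < length K ] List.lookup K (fromℕ< p) ≡ v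
  position-lookup {x ∷ K} {v} h with x Fin.≟ v
  position-lookup {x ∷ K} {v} h         | yes e = s≤s z≤n , e
  position-lookup {x ∷ K} {v} (here p)  | no ≢v = contradiction (sym p) ≢v
  position-lookup {x ∷ K} {v} (there h) | no ≢v with position-lookup h
  ... | p , e = s≤s p , e

  ∈class⁻ : ∀ {k} (P : ConnectedPartition G k) {j v} → v ∈ˢ class P j → index P v ≡ j
  ∈class⁻ P {j} {v} h = ≟⁻ (trans (sym (lookup∘tabulate (λ v → does (index P v Fin.≟ j)) v)) ([]=⇒lookup h))

  module _ {K L M} (valid : Valid K L M) where
    open Valid valid

    private
      place : V → Fin (length K)
      place v = fromℕ< (proj₁ (position-lookup (label v)))

      lookup-place : ∀ v → List.lookup K (place v) ≡ L v
      lookup-place v = proj₂ (position-lookup (label v))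

      place-≡ : ∀ {v j} → L v ≡ List.lookup K j → place v ≡ j
      place-≡ {v} {j} e = lookup-injective unique (place v) j (trans (lookup-place v) e)

      block : Fin (length K) → Subset n
      block j = Vec.tabulate (λ v → does (place v Fin.≟ j))

      ∈block⁺ : ∀ {v j} → L v ≡ List.lookup K j → v ∈ˢ block j
      ∈block⁺ {v} {j} e = lookup⇒[]= v (block j) (trans (lookup∘tabulate _ v) (≟⁺ (place-≡ e)))

      ∈block⁻ : ∀ {v j} → v ∈ˢ block j → L v ≡ List.lookup K j
      ∈block⁻ {v} {j} h = trans (sym (lookup-place v)) (cong (List.lookup K)
        (≟⁻ (trans (sym (lookup∘tabulate (λ v → does (place v Fin.≟ j)) v)) ([]=⇒lookup h))))

      Link : V → V → Set
      Link x y = E x y × L x ≡ L y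

      to-root : ∀ v → Star Link v (L v)
      to-root v with M v in m
      ... | false = Star.map (λ c → CoreStep.edge c , CoreStep.same c) (linked m)
      ... | true with anchored m
      ...   | _ , z , z∈X , e , Lz = (e , sym Lz) ◅
              subst (Star Link z) Lz (Star.map (λ c → CoreStep.edge c , CoreStep.same c) (linked (X-core z∈X)))

      within-block : ∀ {u v j} → L u ≡ List.lookup K j → Star Link u v →
                     Star (λ x y → Graph.Adj G x y × x ∈ˢ block j × y ∈ˢ block j) u v
      within-block e ε = ε
      within-block e ((edge , same) ◅ rest) =
        (Equivalence.from T-≡ edge , ∈block⁺ e , ∈block⁺ (trans (sym same) e)) ◅ within-block (trans (sym same) e) rest

    partition : ConnectedPartition G (length K)
    partition = record
      { index     = place
      ; nonempty  = λ j → List.lookup K j , ∈block⁺ (proj₁ (root (∈-lookup j)))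
      ; connected = λ j u∈ v∈ → within-block (∈block⁻ u∈) (to-root _ ◅◅
          subst (λ r → Star Link r _) (trans (∈block⁻ v∈) (sym (∈block⁻ u∈)))
            (Star.reverse (λ (e , s) → E-sym e , sym s) (to-root _)))
      }

    partition-index : ∀ v → toℕ (index partition v) ≡ output K L v
    partition-index v = toℕ-fromℕ< _

    partition-size : ∀ j → ∣ class partition j ∣ ≡ classSize L (List.lookup K j)
    partition-size j = trans (∣tabulate∣ (λ v → does (place v Fin.≟ j))) (sum-cong-≗ (λ v → cong 𝟙 (same v)))
      where
      same : ∀ v → does (place v Fin.≟ j) ≡ does (L v Fin.≟ List.lookup K j)
      same v with L v Fin.≟ List.lookup K j
      ... | yes e = ≟⁺ (place-≡ e)
      ... | no ≢j = ≟-no (λ e → ≢j (trans (sym (lookup-place v)) (cong (List.lookup K) e)))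

    partition-min : .{{_ : NonZero (length K)}} → ∀ {a} → (∀ {c} → c ∈ K → a ≤ classSize L c) → a ≤ minClass partition
    partition-min h = minimum-glb _ (λ j → ≤-trans (h (∈-lookup j)) (≤-reflexive (sym (partition-size j))))

  module _ (connected : Connected G) where

    module Starting {K : List V} (unique : Unique K) (xs⊆K : ∀ {x} → x ∈ xs → x ∈ K) {r : V} (r∈K : r ∈ K) where

      neighbour-edge : ∀ {v z} → E v z → E v (neighbour v)
      neighbour-edge {v} {z} e = loop (∈-allFin z)
        where
        loop : ∀ {ys} → z ∈ ys → E v (foldr (λ z r → if adj v z then z else r) v ys)
        loop {y ∷ ys} h with adj v y in eq
        loop {y ∷ ys} h           | true  = eq
        loop {y ∷ ys} (here refl) | false = true-false e eq
        loop {y ∷ ys} (there h)   | false = loop h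

      attach-root : ∀ {v} → v ∈ K → attach K v ≡ v
      attach-root h rewrite ∈ᵇ⁺ h = refl

      attached : ∀ {v} → (v ∈ᵇ K) ≡ false → lookup X v ≡ false × InX (neighbour v) × E v (neighbour v)
      attached {v} out = v∉X , nbr∈X , edge
        where
        v∉X : lookup X v ≡ false
        v∉X = not-true (λ h → true-false (∈ᵇ⁺ (xs⊆K (InX-xs h))) out)
        edge : E v (neighbour v)
        edge with connected {v} {r} ∈⊤ ∈⊤
        ... | ε           = true-false (∈ᵇ⁺ r∈K) out
        ... | (e , _) ◅ _ = neighbour-edge (Equivalence.to T-≡ e)
        nbr∈X : InX (neighbour v)
        nbr∈X with covered edge
        ... | inj₁ h = true-false h v∉X
        ... | inj₂ h = h

      -- Serves both cases: for K = X this starts the search, and for `many` it is already the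
      -- solution. A vertex outside K has a neighbour because a walk leads from it to r.
      start-valid : Valid K (attach K) (outside K)
      start-valid = record
        { unique   = unique
        ; root     = λ h → attach-root h , cong not (∈ᵇ⁺ h)
        ; label    = label′
        ; anchored = anchored′
        ; linked   = linked′
        }
        where
        label′ : ∀ v → attach K v ∈ K
        label′ v with v ∈ᵇ K in e
        ... | true  = ∈ᵇ⁻ K e
        ... | false = xs⊆K (InX-xs (proj₁ (proj₂ (attached e))))
        anchored′ : ∀ {v} → outside K v ≡ true → lookup X v ≡ false × ∃[ z ] InX z × E v z × attach K z ≡ attach K v
        anchored′ {v} out with v ∈ᵇ K in e
        ... | false with attached e
        ...   | v∉X , z∈X , vz = v∉X , neighbour v , z∈X , vz , attach-root (xs⊆K (InX-xs z∈X))
        linked′ : ∀ {v} → outside K v ≡ false → Star (CoreStep (attach K) (outside K)) v (attach K v)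
        linked′ {v} out with v ∈ᵇ K
        ... | true = ε

  module _ (Q : ConnectedPartition G k) where

    private
      q : V → Fin k
      q = index Q

    Q-connects : Connects q
    Q-connects {u} {v} e = Star.map (λ (a , x∈ , y∈) → Equivalence.to T-≡ a , trans (∈class⁻ Q x∈) (sym (∈class⁻ Q y∈)))
      (ConnectedPartition.connected Q (q v) (∈class⁺ e) (∈class⁺ refl))
      where
      ∈class⁺ : ∀ {w j} → q w ≡ j → w ∈ˢ class Q j
      ∈class⁺ {w} {j} e = lookup⇒[]= w (class Q j) (trans (lookup∘tabulate _ w) (≟⁺ e))

    Q-large : .{{_ : NonZero k}} → ∀ c → minClass Q ≤ ♯ (λ v → does (q v Fin.≟ c))
    Q-large c = ≤-trans (minimum-≤ _ c) (≤-reflexive (∣tabulate∣ (λ v → does (q v Fin.≟ c))))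

    -- A class that misses X has no edges, hence a single vertex.
    Q-meets : .{{_ : NonZero k}} → 2 ≤ minClass Q → ∀ c → ∃[ x ] InX x × q x ≡ c
    Q-meets two c with exists (λ x → lookup X x ∧ does (q x Fin.≟ c)) verts in eq
    ... | true with exists⁻ (λ x → lookup X x ∧ does (q x Fin.≟ c)) verts eq
    ...   | x , _ , e = x , proj₁ (∧⁻ e) , ≟⁻ (proj₂ (∧⁻ {lookup X x} e))
    Q-meets two c | false = contradiction (≤-trans two (≤-trans (Q-large c) (♯-one single))) (λ { (s≤s ()) })
      where
      avoids : ∀ {x} → q x ≡ c → ¬ InX x
      avoids {x} e h = true-false (exists⁺ (λ x → lookup X x ∧ does (q x Fin.≟ c)) (∈-allFin x) (∧⁺ h (≟⁺ e))) eq
      single : ∀ u v → does (q u Fin.≟ c) ≡ true → does (q v Fin.≟ c) ≡ true → u ≡ v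
      single u v eu ev with Q-connects (trans (≟⁻ {u = q u} eu) (sym (≟⁻ {u = q v} ev)))
      ... | ε = refl
      ... | (e , same) ◅ _ with covered e
      ...   | inj₁ h = contradiction h (avoids (≟⁻ eu))
      ...   | inj₂ h = contradiction h (avoids (trans (sym same) (≟⁻ eu)))

    -- If all classes had at least two vertices, each of the k classes would own a vertex of X.
    Q-small : .{{_ : NonZero k}} → length xs < k → minClass Q ≤ 1
    Q-small s<k with minClass Q ≤? 1
    ... | yes p = p
    ... | no  p = contradiction same (<⇒≢ (proj₁ (proj₂ (proj₂ collision))) ∘ cong toℕ)
      where
      meets : ∀ c → ∃[ x ] InX x × q x ≡ c
      meets = Q-meets (≰⇒> p)
      at : ∀ c → proj₁ (meets c) ∈ xs
      at c = InX-xs (proj₁ (proj₂ (meets c)))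
      collision : ∃[ c ] ∃[ c′ ] c Fin.< c′ × Any.index (at c) ≡ Any.index (at c′)
      collision = pigeonhole s<k (λ c → Any.index (at c))
      value : ∀ c → q (List.lookup xs (Any.index (at c))) ≡ c
      value c = trans (cong q (sym (lookup-index (at c)))) (proj₂ (proj₂ (meets c)))
      same : proj₁ collision ≡ proj₁ (proj₂ collision)
      same = trans (sym (value _)) (trans (cong (q ∘ List.lookup xs) (proj₂ (proj₂ (proj₂ collision)))) (value _))

  record Solved .{{_ : NonZero k}} (o : V → ℕ) : Set where
    field
      partition′ : ConnectedPartition G k
      optimal    : IsMaxMin partition′
      numbered   : ∀ v → toℕ (index partition′ v) ≡ o v

  from-valid : .{{_ : NonZero k}} → ∀ {K L M} {o : V → ℕ} {a} → Valid K L M → length K ≡ k →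
               (∀ {c} → c ∈ K → a ≤ classSize L c) → (∀ v → o v ≡ output K L v) →
               Σ[ P ∈ ConnectedPartition G k ] a ≤ minClass P × (∀ v → toℕ (index P v) ≡ o v)
  from-valid {K} {L} {M} {o} {a} valid len large outs = go len
    where
    go : ∀ {k} .{{_ : NonZero k}} → length K ≡ k →
         Σ[ P ∈ ConnectedPartition G k ] a ≤ minClass P × (∀ v → toℕ (index P v) ≡ o v)
    go refl = partition valid , partition-min valid large , λ v → trans (partition-index valid v) (sym (outs v))

  module Solving .{{_ : NonZero k}} (connected : Connected G) where

    length-units : length units ≡ k
    length-units = length-replicate k

    xs-unique : Unique xs
    xs-unique = select-unique (lookup X) (allFin⁺ n)

    member : ∀ {ys : List V} → 1 ≤ length ys → ∃[ y ] y ∈ ys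
    member {y ∷ _} _ = y , here refl

    module Few (k≤s : k ≤ length xs) where

      open Starting connected xs-unique (λ h → h) (proj₂ (member (≤-trans 1≤k k≤s)))

      fuel : List V
      fuel = dropBy units xs

      enough : length xs ≡ k + length fuel
      enough = sym (trans (cong (k +_) (trans (length-dropBy units xs) (cong (length xs ∸_) length-units))) (m+[n∸m]≡n k≤s))

      attempt : V → Maybe (V → ℕ)
      attempt t = search t fuel (start xs)

      refined : ∀ {m} (q : V → Fin m) → Refined q (attach xs) (outside xs)
      refined q {v} out with v ∈ᵇ xs
      ... | true = refl

      complete : ∀ {m t} (q : V → Fin m) → m ≤ k → Connects q → Reaches t q → ∃[ o ] attempt t ≡ just o
      complete {t = t} q m≤k connects reaches = search-complete t fuel {q} start-valid (refined q) enough m≤k connects reaches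

      0<n : 0 < n
      0<n = ≤-trans 1≤k k≤n

      -- For target 1 completeness asks for no solution: the partition of V into a single class,
      -- with m = 1, already guides the search to a leaf. So some output exists.
      trivially : ∃[ o ] attempt (fromℕ< 0<n) ≡ just o
      trivially = complete {1} (λ _ → zero) 1≤k
        (λ {u} {v} _ → Star.map (λ (e , _) → Equivalence.to T-≡ e , refl) (connected {u} {v} ∈⊤ ∈⊤))
        (inj₁ (toℕ-fromℕ< 0<n))

      best : List V → Maybe (V → ℕ)
      best = foldr (λ t r → maybe′ just (attempt t) r) nothing

      best-nothing : ∀ {ys t} → best ys ≡ nothing → t ∈ ys → attempt t ≡ nothing
      best-nothing {y ∷ ys} e h with best ys in eq
      best-nothing {y ∷ ys} e (here refl) | nothing = e
      best-nothing {y ∷ ys} e (there h)   | nothing = best-nothing eq h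

      best-just : ∀ {ys o} → AllPairs (λ t t′ → toℕ t ≤ toℕ t′) ys → best ys ≡ just o →
                  ∃[ t ] t ∈ ys × attempt t ≡ just o × (∀ {t′ o′} → t′ ∈ ys → attempt t′ ≡ just o′ → toℕ t′ ≤ toℕ t)
      best-just {y ∷ ys} {o} (below ∷ sorted) e with best ys in eq
      ... | nothing = y , here refl , e , last
        where
        last : ∀ {t′ o′} → t′ ∈ y ∷ ys → attempt t′ ≡ just o′ → toℕ t′ ≤ toℕ y
        last (here refl) _ = ≤-refl
        last (there h)   e′ with trans (sym e′) (best-nothing eq h)
        ... | ()
      best-just {y ∷ ys} {o} (below ∷ sorted) refl | just _ with best-just sorted eq
      ... | t , t∈ , e , last = t , there t∈ , e , last′
        where
        last′ : ∀ {t′ o′} → t′ ∈ y ∷ ys → attempt t′ ≡ just o′ → toℕ t′ ≤ toℕ t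
        last′ (here refl) _  = All.lookup below t∈
        last′ (there h)   e′ = last h e′

      solved : ∀ {o} → solve ≡ just o → Solved o
      solved {o} e with best-just (tabulate⁺-< <⇒≤) e
      ... | t , _ , found , last with search-sound t fuel start-valid enough found
      ...   | result with from-valid {o = o} (Result.valid result) (Result.k-many result)
                                     (Result.large result) (Result.outputs result)
      ...     | P , large , numbered = record { partition′ = P ; optimal = λ Q → ≤-trans (upper Q) large ; numbered = numbered }
        where
        -- The minimum of a better Q is at most n, hence of the form 1 + t′ for a vertex number t′ >
        -- t. By completeness the search for t′ succeeds, contrary to the choice of t.
        upper : (Q : ConnectedPartition G k) → minClass Q ≤ suc (toℕ t)
        upper Q with minClass Q ≤? suc (toℕ t)
        ... | yes p = p
        ... | no  p = contradiction (last (∈-allFin t′) (proj₂ found′)) (<⇒≱ t<t′)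
          where
          more : suc (toℕ t) < minClass Q
          more = ≰⇒> p
          c₀ : Fin k
          c₀ = fromℕ< 1≤k
          positive : suc (pred (minClass Q)) ≡ minClass Q
          positive = suc-pred (minClass Q) {{>-nonZero (≤-trans (s≤s z≤n) more)}}
          in-range : pred (minClass Q) < n
          in-range = ≤-trans (≤-reflexive positive) (≤-trans (Q-large Q c₀) ♯-all)
          t′ : V
          t′ = fromℕ< in-range
          target′ : suc (toℕ t′) ≡ minClass Q
          target′ = trans (cong suc (toℕ-fromℕ< in-range)) positive
          t<t′ : toℕ t < toℕ t′
          t<t′ = ≤-pred (≤-trans more (≤-reflexive (sym target′)))
          found′ : ∃[ o′ ] attempt t′ ≡ just o′
          found′ = complete (index Q) ≤-refl (Q-connects Q) (inj₂ (refl , Q-meets Q (≤-trans (s≤s (s≤s z≤n)) more) ,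
                     λ c → ≤-trans (≤-reflexive target′) (Q-large Q c)))

      solvable : ∃[ o ] solve ≡ just o
      solvable with solve in eq
      ... | just o  = o , refl
      ... | nothing with trans (sym (proj₂ trivially)) (best-nothing eq (∈-allFin (fromℕ< 0<n)))
      ...   | ()

    module Many (s<k : length xs < k) where

      others : List V
      others = select (λ v → not (lookup X v)) verts

      many-drop : many ≡ List.drop (n ∸ k) (others ++ xs)
      many-drop = trans (dropBy-drop (dropBy units verts) _) (cong₂ List.drop
        (trans (length-dropBy units verts) (cong₂ _∸_ (length-tabulate (λ v → v)) length-units)) (append others))
        where
        append : ∀ ys → foldr _∷_ xs ys ≡ ys ++ xs
        append []       = refl
        append (y ∷ ys) = cong (y ∷_) (append ys)

      complementary : ∀ (p : V → Bool) ys → length (select (λ v → not (p v)) ys) + length (select p ys) ≡ length ys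
      complementary p []       = refl
      complementary p (y ∷ ys) with p y
      ... | true  = trans (+-suc _ _) (cong suc (complementary p ys))
      ... | false = cong suc (complementary p ys)

      lengths : length others + length xs ≡ n
      lengths = trans (complementary (lookup X) verts) (length-tabulate (λ v → v))

      many-length : length many ≡ k
      many-length = begin
        length many                                    ≡⟨ cong length many-drop ⟩
        length (List.drop (n ∸ k) (others ++ xs))      ≡⟨ length-drop (n ∸ k) (others ++ xs) ⟩
        length (others ++ xs) ∸ (n ∸ k)                ≡⟨ cong (_∸ (n ∸ k)) (trans (length-++ others) lengths) ⟩
        n ∸ (n ∸ k)                                    ≡⟨ m∸[m∸n]≡n k≤n ⟩
        k                                              ∎
        where open ≡-Reasoning

      many-unique : Unique many
      many-unique = subst Unique (sym many-drop) (drop⁺ (n ∸ k) (++⁺ (select-unique _ (allFin⁺ n)) xs-unique disjoint))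
        where
        disjoint : ∀ {v} → ¬ (v ∈ others × v ∈ xs)
        disjoint (h , h′) = true-false (xs-InX h′) (not⁻ (proj₂ (select⁻ (λ v → not (lookup X v)) verts h)))

      xs⊆many : ∀ {x} → x ∈ xs → x ∈ many
      xs⊆many {x} h = subst (x ∈_) (sym many-drop) (keeps (n ∸ k) others few)
        where
        -- As |X| < k, the dropped part ends before X begins.
        few : n ∸ k ≤ length others
        few = ≤-trans (∸-monoʳ-≤ n (<⇒≤ s<k)) (≤-reflexive (trans (cong (_∸ length xs) (sym lengths)) (m+n∸n≡m _ (length xs))))
        keeps : ∀ a ys → a ≤ length ys → x ∈ List.drop a (ys ++ xs)
        keeps zero    ys       le       = ∈-++⁺ʳ ys h
        keeps (suc a) (_ ∷ ys) (s≤s le) = keeps a ys le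

      open Starting connected many-unique xs⊆many (proj₂ (member (≤-trans 1≤k (≤-reflexive (sym many-length)))))

      solved : Solved (output many (attach many))
      solved with from-valid start-valid many-length
                    (λ {c} h → ♯-some c (≟⁺ (proj₁ (Valid.root start-valid h)))) (λ _ → refl)
      ... | P , large , numbered = record { partition′ = P ; optimal = λ Q → ≤-trans (Q-small Q s<k) large ; numbered = numbered }

    solution-solved : Solved solution
    solution-solved with List.null (dropBy xs units) in eq
    ... | true with solve in eq′ | Few.solvable k≤s | (λ {o} → Few.solved k≤s {o})
      where
      k≤s : k ≤ length xs
      k≤s = subst (_≤ length xs) length-units (null-drop (length xs) units (trans (cong List.null (sym (dropBy-drop xs units))) eq))
    ...   | just o | _ | solved = solved refl
    solution-solved | false = Many.solved (subst (length xs <_) length-units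
      (null-drop-false (length xs) units (trans (cong List.null (sym (dropBy-drop xs units))) eq)))

-- Output encoding and running time

open Implementation
open Programs Instance graphSize cover# graphSize>0

encodes : ∀ {n m} (g : Fin n → Fin m) (o : Fin n → ℕ) → (∀ v → toℕ (g v) ≡ o v) → ∀ {w} →
          ListRep (λ a u → u ≡ encodeℕ a) (List.tabulate o) w →
          w ≡ encodeVec (λ c → encodeℕ (toℕ c)) (Vec.tabulate g)
encodes {zero}  g o eq []         = refl
encodes {suc n} g o eq (refl ∷ r) =
  cong₂ _∙_ (cong encodeℕ (sym (eq zero))) (encodes (λ v → g (suc v)) (λ v → o (suc v)) (λ v → eq (suc v)) r)

Solves : Program → (ℕ → ℕ) → ℕ → Set
Solves p f c = ∀ (G : Graph) (k : ℕ) .{{_ : NonZero k}} (X : Subset (order G)) →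
  Connected G → k ≤ order G → VertexCover G X →
  Σ[ P ∈ ConnectedPartition G k ]
  IsMaxMin P ×
  (p on encodeInstance G k X yields encodePartition P
  within (f ∣ X ∣ * size G ^ c))

-- Stated for an arbitrary implementation `m` of `solution`, so that the argument depends on the
-- specification and the bound alone and not on the concrete term.
program-solves : (m : Comp₀ (InputT ∷ []) (MapT NatT) (λ i _ → Algorithm.solution i)) →
                 Solves (code m (zero , tt)) ⟦ Bd.coef (bound m) ⟧ (Bd.deg (bound m))
program-solves m G k X connected k≤n cover =
  combine (Optimal.Solving.solution-solved i cover connected)
          (ok m (tt , tt) (zero , tt) (refl , refl))
  where
  i : Instance
  i = record { G = G ; k = k ; X = X ; 1≤k = >-nonZero⁻¹ k ; k≤n = k≤n }
  o : Fin (order G) → ℕ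
  o = Algorithm.solution i
  combine : Optimal.Solved i cover o →
            (encodeInstance G k X ∷ [] ⊢ code m (zero , tt) ⇓ Rep (MapT NatT) {i} o within cost (bound m) i 0) →
            Σ[ P ∈ ConnectedPartition G k ]
            IsMaxMin P ×
            (code m (zero , tt) on encodeInstance G k X yields encodePartition P
            within (⟦ Bd.coef (bound m) ⟧ ∣ X ∣ * size G ^ Bd.deg (bound m)))
  combine S (returns {t = t} d r t≤) = P , Optimal.Solved.optimal S , t , ≤-trans t≤ (cost-pure (bound m)) ,
    subst (λ w → _ ⊢ _ ⇓ w [ t ]) (encodes (index P) o (Optimal.Solved.numbered S) r) d
    where
    P : ConnectedPartition G k
    P = Optimal.Solved.partition′ S

theorem12 : Σ[ f ∈ (ℕ → ℕ) ] Σ[ c ∈ ℕ ] Σ[ p ∈ Program ]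
    Computable f ×
    (∀ (G : Graph) (k : ℕ) .{{_ : NonZero k}} (X : Subset (order G)) →
    Connected G → k ≤ order G → VertexCover G X →
    Σ[ P ∈ ConnectedPartition G k ]
    IsMaxMin P ×
    (p on encodeInstance G k X yields encodePartition P
    within (f ∣ X ∣ * size G ^ c)))
theorem12 = ⟦ Bd.coef (bound mainᶜ) ⟧ , Bd.deg (bound mainᶜ) , code mainᶜ (zero , tt) ,
  growth-computable (Bd.coef (bound mainᶜ)) , program-solves mainᶜ
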